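{- The decision problem $\mathrm{MSAT}_{\mathbb{N}}(\Box,\downarrow,@)$ (satisfiability over the frame $(\mathbb{N},<)$ of monotone hybrid formulae with the operators $\Box,\downarrow,@$) is in LOGSPACE (deterministic logarithmic space).
   Context: Syntax. Let SVAR be a countable set of state variables. The formulae considered are given by $$\varphi ::= x \mid \top \mid \bot \mid \varphi\wedge\varphi \mid \varphi\vee\varphi \mid \Box\varphi \mid \downarrow x.\varphi \mid @_x\varphi \qquad (x\in \mathrm{SVAR}),$$ with no negation, atomic propositions or nominals. By convention free state variables are never bound later in the formula and every state variable is bound by $\downarrow$ at most once. Semantics over $(\mathbb{N},<)$. For an assignment $g:\mathrm{SVAR}\to\mathbb{N}$ and $n\in\mathbb{N}$, $g^x_n$ maps $x$ to $n$ and agrees with $g$ elsewhere. Satisfaction: $g,n\models x$ iff $g(x)=n$; $\top,\bot,\wedge,\vee$ as usual; $g,n\models\Box\varphi$ iff $g,n'\models\varphi$ for all $n'>n$; $g,n\models @_x\varphi$ iff $g,g(x)\models\varphi$; $g,n\models\,\downarrow x.\varphi$ iff $g^x_n,n\models\varphi$. $\mathrm{MSAT}_{\mathbb{N}}(\Box,\downarrow,@)$: given such a formula $\varphi$, do there exist $g:\mathrm{SVAR}\to\mathbb{N}$ and $n\in\mathbb{N}$ with $g,n\models\varphi$? -}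

module Defs where

open import Data.Bool using (if_then_else_)
open import Data.Empty using (⊥)
open import Data.Fin using (Fin)
open import Data.List using (List; []; _∷_; _++_; [_]; length; filter)
open import Data.List.Relation.Binary.Disjoint.Propositional using (Disjoint)
open import Data.List.Relation.Unary.Unique.Propositional using (Unique)
open import Data.Nat using (ℕ; zero; suc; pred; _+_; _*_; _⊓_; _≤_; _<_; _≟_)
open import Data.Nat.Binary using (ℕᵇ; 2[1+_]; 1+[2_]; fromℕ)
open import Data.Nat.Logarithm using (⌊log₂_⌋)
open import Data.Product using (_×_; _,_; ∃-syntax)
open import Data.Sum using (_⊎_; inj₁; inj₂)
open import Data.Unit using (⊤)
open import Data.Vec using (Vec)
import Data.Vec as Vec
open import Function using (_↔_; _⇔_)
open import Relation.Binary.PropositionalEquality using (_≡_)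
open import Relation.Nullary using (does; ¬?)

------------------------------------------------------------------------
-- Monotone hybrid formulae with □, ↓ and @

SVAR : Set
SVAR = ℕ

infixr 7 _∧_
infixr 6 _∨_
infix  8 □_ ↓[_]_ at[_]_

-- at[ x ] φ is @ₓ φ; Agda reserves the character @.
data Formula : Set where
  var     : SVAR → Formula
  top bot : Formula
  _∧_ _∨_ : Formula → Formula → Formula
  □_      : Formula → Formula
  ↓[_]_   : SVAR → Formula → Formula
  at[_]_  : SVAR → Formula → Formula

freeVars : Formula → List SVAR
freeVars (var x)     = [ x ]
freeVars top         = []
freeVars bot         = []
freeVars (φ ∧ ψ)     = freeVars φ ++ freeVars ψ
freeVars (φ ∨ ψ)     = freeVars φ ++ freeVars ψ
freeVars (□ φ)       = freeVars φ
freeVars (↓[ x ] φ)  = filter (λ y → ¬? (x ≟ y)) (freeVars φ)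
freeVars (at[ x ] φ) = x ∷ freeVars φ

-- One entry for each occurrence of ↓.
boundVars : Formula → List SVAR
boundVars (var x)     = []
boundVars top         = []
boundVars bot         = []
boundVars (φ ∧ ψ)     = boundVars φ ++ boundVars ψ
boundVars (φ ∨ ψ)     = boundVars φ ++ boundVars ψ
boundVars (□ φ)       = boundVars φ
boundVars (↓[ x ] φ)  = x ∷ boundVars φ
boundVars (at[ x ] φ) = boundVars φ

-- The convention on variables: every variable is bound at most once, and no
-- variable occurring free is bound.
WellNamed : Formula → Set
WellNamed φ = Unique (boundVars φ) × Disjoint (freeVars φ) (boundVars φ)

------------------------------------------------------------------------
-- Semantics over (ℕ, <)

Assignment : Set
Assignment = SVAR → ℕ

_[_↦_] : Assignment → SVAR → ℕ → Assignment
(g [ x ↦ n ]) y = if does (x ≟ y) then n else g y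

infix 4 _,_⊨_

_,_⊨_ : Assignment → ℕ → Formula → Set
g , n ⊨ var x       = g x ≡ n
g , n ⊨ top         = ⊤
g , n ⊨ bot         = ⊥
g , n ⊨ (φ ∧ ψ)     = (g , n ⊨ φ) × (g , n ⊨ ψ)
g , n ⊨ (φ ∨ ψ)     = (g , n ⊨ φ) ⊎ (g , n ⊨ ψ)
g , n ⊨ (□ φ)       = ∀ n′ → n < n′ → g , n′ ⊨ φ
g , n ⊨ (↓[ x ] φ)  = g [ x ↦ n ] , n ⊨ φ
g , n ⊨ (at[ x ] φ) = g , g x ⊨ φ

Satisfiable : Formula → Set
Satisfiable φ = ∃[ g ] ∃[ n ] (g , n ⊨ φ)

------------------------------------------------------------------------
-- Formulae as strings over a finite alphabet, and the decision problem

data Symbol : Set where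
  ‵x ‵1 ‵2 ‵⊤ ‵⊥ ‵∧ ‵∨ ‵□ ‵↓ ‵at : Symbol

-- ℕᵇ is bijective base-2 notation, so each number has exactly one numeral over
-- the digits 1 and 2; the least significant digit comes first.
digits : ℕᵇ → List Symbol
digits ℕᵇ.zero  = []
digits 2[1+ b ] = ‵2 ∷ digits b
digits 1+[2 b ] = ‵1 ∷ digits b

encodeVar : SVAR → List Symbol
encodeVar x = ‵x ∷ digits (fromℕ x)

-- Polish notation, with variable indices in binary.
encode : Formula → List Symbol
encode (var x)     = encodeVar x
encode top         = [ ‵⊤ ]
encode bot         = [ ‵⊥ ]
encode (φ ∧ ψ)     = ‵∧ ∷ encode φ ++ encode ψ
encode (φ ∨ ψ)     = ‵∨ ∷ encode φ ++ encode ψ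
encode (□ φ)       = ‵□ ∷ encode φ
encode (↓[ x ] φ)  = ‵↓ ∷ encodeVar x ++ encode φ
encode (at[ x ] φ) = ‵at ∷ encodeVar x ++ encode φ

Language : Set → Set₁
Language Σ = List Σ → Set

-- Strings that do not encode a formula obeying the convention on variables are
-- not in the language, so a machine deciding it must reject them.
MSAT-ℕ : Language Symbol
MSAT-ℕ w = ∃[ φ ] (w ≡ encode φ × WellNamed φ × Satisfiable φ)

------------------------------------------------------------------------
-- Deterministic Turing machines with a two-way read-only input tape and
-- finitely many read-write work tapes

Finite : Set → Set
Finite A = ∃[ n ] (A ↔ Fin n)

data InputSymbol (Σ : Set) : Set where
  ⊢ ⊣ : InputSymbol Σ
  sym : Σ → InputSymbol Σ

data Move : Set where
  left stay right : Move

data Verdict : Set where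
  accept reject : Verdict

-- State consists of the non-halting states; accepting and rejecting are the
-- two values of Verdict. A work tape symbol is written before the head moves.
record Machine (Σ : Set) : Set₁ where
  field
    State          : Set
    Γ              : Set
    finite-input   : Finite Σ
    finite-states  : Finite State
    finite-symbols : Finite Γ
    blank          : Γ
    start          : State
    tapes          : ℕ
    δ              : State → InputSymbol Σ → Vec Γ tapes →
                     Verdict ⊎ (State × Move × Vec (Γ × Move) tapes)

-- The visited portion of a work tape that is infinite in both directions: both
-- lists start with the cell nearest to the head, and all unlisted cells are blank.
-- Cells are never dropped.
record Tape (Γ : Set) : Set where
  constructor tape
  field
    before  : List Γ
    scanned : Γ
    after   : List Γ

open Tape public

cells : ∀ {Γ} → Tape Γ → ℕ
cells (tape ls _ rs) = length ls + suc (length rs)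

update : ∀ {Γ} → Γ → Tape Γ → Γ × Move → Tape Γ
update _     (tape ls       _ rs)       (a , stay)  = tape ls a rs
update blank (tape []       _ rs)       (a , left)  = tape [] blank (a ∷ rs)
update _     (tape (l ∷ ls) _ rs)       (a , left)  = tape ls l (a ∷ rs)
update blank (tape ls       _ [])       (a , right) = tape (a ∷ ls) blank []
update _     (tape ls       _ (r ∷ rs)) (a , right) = tape (a ∷ ls) r rs

nth : ∀ {Σ} → List Σ → ℕ → InputSymbol Σ
nth []       _       = ⊣
nth (a ∷ _)  zero    = sym a
nth (_ ∷ as) (suc i) = nth as i

module Run {Σ : Set} (M : Machine Σ) (w : List Σ) where
  open Machine M

  -- Position 0 holds ⊢, positions 1 to length w hold w, and the next one holds ⊣.
  read : ℕ → InputSymbol Σ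
  read zero    = ⊢
  read (suc i) = nth w i

  -- The input head cannot leave the region delimited by the end markers.
  moveInput : Move → ℕ → ℕ
  moveInput left  i = pred i
  moveInput stay  i = i
  moveInput right i = suc i ⊓ suc (length w)

  record Config : Set where
    constructor config
    field
      state     : State
      inputHead : ℕ
      work      : Vec (Tape Γ) tapes

  open Config public

  initial : Config
  initial = config start 0 (Vec.replicate tapes (tape [] blank []))

  space : Config → ℕ
  space c = Vec.sum (Vec.map cells (work c))

  step : Config → Verdict ⊎ Config
  step (config q i ts) with δ q (read i) (Vec.map scanned ts)
  ... | inj₁ v               = inj₁ v
  ... | inj₂ (q′ , m , acts) =
    inj₂ (config q′ (moveInput m i) (Vec.zipWith (update blank) ts acts))

  -- The run from c halts with verdict v, using at most s work tape cells throughout.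
  data _Halts[_]In_ (c : Config) (v : Verdict) (s : ℕ) : Set where
    halt     : space c ≤ s → step c ≡ inj₁ v → c Halts[ v ]In s
    continue : ∀ {c′} → space c ≤ s → step c ≡ inj₂ c′ → c′ Halts[ v ]In s → c Halts[ v ]In s

open Run using (initial; _Halts[_]In_)

DecidesInSpace : ∀ {Σ} → Machine Σ → (ℕ → ℕ) → Language Σ → Set
DecidesInSpace M s L =
  ∀ w → ∃[ v ] (_Halts[_]In_ M w (initial M w) v (s (length w)) × (v ≡ accept ⇔ L w))

-- The summand 1 is needed because ⌊log₂ 0 ⌋ and ⌊log₂ 1 ⌋ are 0.
LOGSPACE : ∀ {Σ} → Language Σ → Set₁
LOGSPACE {Σ} L =
  ∃[ M ] ∃[ c ] DecidesInSpace {Σ} M (λ n → c * (1 + ⌊log₂ n ⌋)) L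

{-# OPTIONS --safe #-}

-- The points of (ℕ, <) that a monotone formula talks about are the initial one and
-- those introduced by □. Satisfaction can only gain from further equalities between
-- points, and n < n′ holds for some n′ different from any finitely many points.
-- Hence □ φ holds iff φ holds at a fresh point, and φ is satisfiable iff it evaluates
-- to true when all free variables denote the initial point and every □ moves to a new
-- point, which may be represented by the position of this □ in the input. The point
-- denoted by a variable is then found by following ancestors and binders, without
-- storing an assignment, and the resulting Boolean formula is evaluated in one pass over
-- the Polish notation. All of this needs only a fixed number of input positions, which
-- are kept in binary on the work tapes.

module Submission where

open import Defs

open import Data.Bool using (Bool; true; false; if_then_else_; not)
import Data.Bool as Bool
open import Data.Bool.Properties using (∨-zeroʳ)
open import Data.Empty using (⊥; ⊥-elim)
open import Data.Fin using (Fin; zero; suc; toℕ)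
open import Data.Fin.Properties using (+↔⊎; 1↔⊤)
import Data.Fin.Properties as Fin
open import Data.List using (List; []; _∷_; _++_; [_]; length; map; replicate)
open import Data.List.Membership.Propositional using (_∈_)
open import Data.List.Membership.Propositional.Properties
  using (∈-++⁺ˡ; ∈-++⁺ʳ; ∈-++⁻; ∈-filter⁺; ∈-filter⁻)
open import Data.List.Properties using (++-assoc; ++-identityʳ; length-++; length-replicate)
open import Data.List.Relation.Binary.Disjoint.Propositional using (Disjoint)
open import Data.List.Relation.Unary.All using (All; []; _∷_)
import Data.List.Relation.Unary.All as All
import Data.List.Relation.Unary.All.Properties as All
open import Data.List.Relation.Unary.AllPairs using ([]; _∷_)
open import Data.List.Relation.Unary.Any using (here; there)
open import Data.List.Relation.Unary.Unique.Propositional using (Unique)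
import Data.List.Relation.Unary.Unique.Propositional.Properties as Unique
open import Data.Nat
open import Data.Nat.Binary using (ℕᵇ; 2[1+_]; 1+[2_]; fromℕ)
import Data.Nat.Binary as ℕᵇ
import Data.Nat.Binary.Properties as ℕᵇ
open import Data.Nat.Logarithm using (⌊log₂_⌋; ⌊log₂[2^n]⌋≡n; ⌊log₂⌋-mono-≤)
open import Data.Nat.Properties
open import Data.Product using (_×_; _,_; ∃-syntax; proj₁; proj₂)
import Data.Product as Product
open import Data.Sum using (_⊎_; inj₁; inj₂)
import Data.Sum as Sum
open import Data.Sum.Function.Propositional using (_⊎-↔_)
open import Data.Unit using (⊤; tt)
open import Data.Vec using (Vec; []; _∷_; lookup; zipWith; _[_]≔_)
import Data.Vec as Vec
open import Data.Vec.Properties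
  using (lookup∘update; lookup∘update′; lookup-map; lookup-replicate;
         []≔-lookup; []≔-idempotent; []≔-commutes)
open import Function using (_∘_; const; _⇔_; mk⇔; mk↔ₛ′; Equivalence)
open import Function.Construct.Composition using (_↔-∘_)
open import Function.Construct.Symmetry using (↔-sym)
open import Relation.Binary.Definitions using (tri<; tri≈; tri>)
open import Relation.Binary.PropositionalEquality hiding ([_]) renaming (sym to symm)
open import Relation.Nullary using (¬_; Dec; yes; no; does; ¬?; contradiction)
open import Relation.Nullary.Decidable using (dec-true; dec-false)


-- Binary counters on a tape

-- An explicit machine has to be exhibited, so the procedure is written in a small language, `Term`,
-- whose values are input positions. A closed term fixes its nesting depth and hence the number of
-- registers; subroutines such as `pointT` or `cutT` are recomputed at every call instead of being
-- stored, which does the work of composing logspace transducers. The same number `length w + 1` of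
-- iterations serves every loop, since each loop moves positions in one direction only until it is
-- done. A variable name may be as long as the input, so it never enters a register: it is
-- represented by the position of an occurrence and compared digit by digit. Binders are searched
-- for by name alone, which is correct only under the convention on variables; hence syntax and
-- convention are tested first, and the evaluation is specified only for inputs that pass both
-- tests. The single pass over the Polish notation works by short-circuiting: a right argument is
-- either skipped or has the value of the whole, so no stack of pending operators is kept.

data Cell : Set where
  blank : Cell
  bit   : Bool → Cell

-- Decrementing doubles as the zero test: a borrow that runs off the digits has found 0, and
-- `restore` turns the ones it wrote back into zeros.
data Phase : Set where
  inc₀ carry dec₀ borrow back restore : Phase

-- The home position of a counter is the blank cell to the left of its digits,
-- which are listed from the least significant one.
table : Phase → Cell → (Bool ⊎ Phase) × Cell × Move
table inc₀    c           = inj₂ carry , c , right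
table carry   blank       = inj₂ back , bit true , left
table carry   (bit false) = inj₂ back , bit true , left
table carry   (bit true)  = inj₂ carry , bit false , right
table dec₀    c           = inj₂ borrow , c , right
table borrow  blank       = inj₂ restore , blank , left
table borrow  (bit false) = inj₂ borrow , bit true , right
table borrow  (bit true)  = inj₂ back , bit false , left
table back    blank       = inj₁ true , blank , stay
table back    (bit b)     = inj₂ back , bit b , left
table restore blank       = inj₁ false , blank , stay
table restore (bit b)     = inj₂ restore , bit false , left

data TapeRun (C : ℕ) : Phase → Tape Cell → Bool → Tape Cell → Set where
  stop : ∀ {s t b c m} → cells t ≤ C → table s (scanned t) ≡ (inj₁ b , c , m) →
         TapeRun C s t b (update blank t (c , m))
  more : ∀ {s s′ t b c m t′} → cells t ≤ C → table s (scanned t) ≡ (inj₂ s′ , c , m) →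
         TapeRun C s′ (update blank t (c , m)) b t′ → TapeRun C s t b t′

from : ∀ {C s t t′ b u} → t ≡ t′ → TapeRun C s t′ b u → TapeRun C s t b u
from refl run = run

val : List Cell → ℕ
val []               = 0
val (blank ∷ _)      = 0
val (bit false ∷ as) = 2 * val as
val (bit true ∷ as)  = suc (2 * val as)

-- `gap` is the blank cell visited by a failed borrow beyond the last digit; tapes never drop cells.
-- Numerals may end in zeros, so decrementing never has to shorten one.
data Short : ℕ → List Cell → Set where
  none  : ∀ {L} → Short L []
  gap   : ∀ {L} → Short L (blank ∷ [])
  digit : ∀ {L b as} → Short L as → Short (suc L) (bit b ∷ as)

record Counter (L v : ℕ) (t : Tape Cell) : Set where
  constructor counter
  field
    {numeral} : List Cell
    at-home   : t ≡ tape [] blank numeral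
    short     : Short L numeral
    value     : val numeral ≡ v

short-length : ∀ {L as} → Short L as → length as ≤ suc L
short-length none      = z≤n
short-length gap       = s≤s z≤n
short-length (digit p) = s≤s (short-length p)

counter-cells : ∀ {L v t} → Counter L v t → cells t ≤ 2 + L
counter-cells (counter refl p _) = s≤s (short-length p)

-- The head on the first cell of as, or on the last cell of bs, which are reversed.
rightOf leftOf : List Bool → List Cell → Tape Cell
rightOf bs []       = tape (map bit bs ++ [ blank ]) blank []
rightOf bs (a ∷ as) = tape (map bit bs ++ [ blank ]) a as
leftOf []       as = tape [] blank as
leftOf (b ∷ bs) as = tape (map bit bs ++ [ blank ]) (bit b) as

unwind : List Bool → List Cell → List Cell
unwind []       as = as
unwind (b ∷ bs) as = unwind bs (bit b ∷ as)

length-before : ∀ bs → length (map bit bs ++ [ blank ]) ≡ suc (length bs)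
length-before []       = refl
length-before (b ∷ bs) = cong suc (length-before bs)

move-right : ∀ bs x b as →
  update blank (tape (map bit bs ++ [ blank ]) x as) (bit b , right) ≡ rightOf (b ∷ bs) as
move-right []      _ b []       = refl
move-right []      _ b (_ ∷ as) = refl
move-right (_ ∷ _) _ b []       = refl
move-right (_ ∷ _) _ b (_ ∷ as) = refl

move-left : ∀ bs x a as →
  update blank (tape (map bit bs ++ [ blank ]) x as) (a , left) ≡ leftOf bs (a ∷ as)
move-left []      _ a as = refl
move-left (_ ∷ _) _ a as = refl

cells-rightOf : ∀ {C L} bs {as} → Short L as → length bs + L + 2 ≤ C → cells (rightOf bs as) ≤ C
cells-rightOf {C} {L} bs {as} p le = ≤-trans (bound p) le
  where
  open ≤-Reasoning
  bound : ∀ {L as} → Short L as → cells (rightOf bs as) ≤ length bs + L + 2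
  bound {L} none = begin
    length (map bit bs ++ [ blank ]) + 1 ≡⟨ cong (_+ 1) (length-before bs) ⟩
    suc (length bs) + 1                  ≡⟨ +-suc (length bs) 1 ⟨
    length bs + 2                        ≤⟨ +-monoˡ-≤ 2 (m≤m+n (length bs) L) ⟩
    length bs + L + 2                    ∎
  bound {L} gap = bound {L} none
  bound {suc L} (digit {as = as} q) = begin
    length (map bit bs ++ [ blank ]) + suc (length as) ≡⟨ cong (_+ suc (length as)) (length-before bs) ⟩
    suc (length bs) + suc (length as)                  ≤⟨ +-monoʳ-≤ (suc (length bs)) (s≤s (short-length q)) ⟩
    suc (length bs) + suc (suc L)                      ≡⟨ cong suc (cong (length bs +_) (+-comm 1 (suc L))) ⟩
    suc (length bs) + (suc L + 1)                      ≡⟨ +-assoc (suc (length bs)) (suc L) 1 ⟨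
    suc (length bs) + suc L + 1                        ≡⟨ +-suc (length bs + suc L) 1 ⟨
    length bs + suc L + 2                              ∎

cells-leftOf : ∀ bs as → cells (leftOf bs as) ≡ length bs + suc (length as)
cells-leftOf []       as = refl
cells-leftOf (b ∷ bs) as = cong (_+ suc (length as)) (length-before bs)

back-run : ∀ {C} bs as → length bs + suc (length as) ≤ C →
  TapeRun C back (leftOf bs as) true (tape [] blank (unwind bs as))
back-run []       as le = stop le refl
back-run (b ∷ bs) as le = more (≤-trans (≤-reflexive (cells-leftOf (b ∷ bs) as)) le) refl
  (from (move-left bs _ (bit b) as)
    (back-run bs (bit b ∷ as) (≤-trans (≤-reflexive (+-suc (length bs) (suc (length as)))) le)))

restore-run : ∀ {C} k as → k + suc (length as) ≤ C →
  TapeRun C restore (leftOf (replicate k true) as) false (tape [] blank (unwind (replicate k false) as))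
restore-run zero    as le = stop le refl
restore-run (suc k) as le =
  more (≤-trans (≤-reflexive (trans (cells-leftOf (replicate (suc k) true) as)
                                     (cong (λ l → suc l + suc (length as)) (length-replicate k)))) le) refl
  (from (move-left (replicate k true) _ (bit false) as)
    (restore-run k (bit false ∷ as) (≤-trans (≤-reflexive (+-suc k (suc (length as)))) le)))

-- The room needed at the turning point of a counter operation.
turn : ∀ {C L l} m → l ≤ suc L → m + L + 2 ≤ C → m + suc l ≤ C
turn {C} {L} {l} m p le = begin
  m + suc l     ≤⟨ +-monoʳ-≤ m (s≤s p) ⟩
  m + (2 + L)   ≡⟨ cong (m +_) (+-comm 2 L) ⟩
  m + (L + 2)   ≡⟨ +-assoc m L 2 ⟨
  m + L + 2     ≤⟨ le ⟩
  C             ∎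
  where open ≤-Reasoning

-- The bound on the value is halved with each digit that the carry passes, and it excludes `L = 0`;
-- so the carry always finds its place within the `L` digits.
carry-run : ∀ {C L as} → Short L as → suc (val as) < 2 ^ L → ∀ bs → length bs + L + 2 ≤ C →
  ∃[ as′ ] (Short L as′ × val as′ ≡ suc (val as) ×
            TapeRun C carry (rightOf bs as) true (tape [] blank (unwind bs as′)))
carry-run {L = zero}  none (s≤s ()) bs le
carry-run {L = suc L} none lt bs le =
  bit true ∷ [] , digit none , refl ,
  more (cells-rightOf bs (none {suc L}) le) refl
    (from (move-left bs blank (bit true) [])
      (back-run bs (bit true ∷ []) (turn {L = suc L} (length bs) (s≤s z≤n) le)))
carry-run {L = zero}  gap (s≤s ()) bs le
carry-run {L = suc L} gap lt bs le =
  bit true ∷ [] , digit none , refl ,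
  more (cells-rightOf bs (gap {suc L}) le) refl
    (from (move-left bs blank (bit true) [])
      (back-run bs (bit true ∷ []) (turn {L = suc L} (length bs) (s≤s z≤n) le)))
carry-run (digit {L} {false} {as} p) lt bs le =
  bit true ∷ as , digit p , refl ,
  more (cells-rightOf bs (digit {b = false} p) le) refl
    (from (move-left bs (bit false) (bit true) as)
      (back-run bs (bit true ∷ as) (turn {L = suc L} (length bs) (s≤s (short-length p)) le)))
carry-run {C} (digit {L} {true} {as} p) lt bs le
  with carry-run p (*-cancelˡ-< 2 (suc (val as)) (2 ^ L)
                     (subst (_< 2 ^ suc L) (cong suc (symm (+-suc (val as) (val as + 0)))) lt))
                 (false ∷ bs) (subst (λ x → x + 2 ≤ C) (+-suc (length bs) L) le)
... | as′ , p′ , eq , run =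
  bit false ∷ as′ , digit p′ ,
  trans (cong (2 *_) eq) (cong suc (+-suc (val as) (val as + 0))) ,
  more (cells-rightOf bs (digit {b = true} p) le) refl
    (from (move-right bs (bit true) false as) run)

borrow-run : ∀ {C L as v} → Short L as → val as ≡ suc v → ∀ bs → length bs + L + 2 ≤ C →
  ∃[ as′ ] (Short L as′ × val as′ ≡ v ×
            TapeRun C borrow (rightOf bs as) true (tape [] blank (unwind bs as′)))
borrow-run none () bs le
borrow-run gap  () bs le
borrow-run {C} {v = v} (digit {L} {false} {as} p) eq bs le with val as in eq₁
... | suc u
  with borrow-run {v = u} p eq₁ (true ∷ bs) (subst (λ x → x + 2 ≤ C) (+-suc (length bs) L) le)
... | as′ , p′ , eq′ , run =
  bit true ∷ as′ , digit p′ ,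
  trans (cong (λ x → suc (2 * x)) eq′) (trans (symm (+-suc u (u + 0))) (suc-injective eq)) ,
  more (cells-rightOf bs (digit {b = false} p) le) refl
    (from (move-right bs (bit false) true as) run)
borrow-run (digit {L} {true} {as} p) eq bs le =
  bit false ∷ as , digit p , suc-injective eq ,
  more (cells-rightOf bs (digit {b = true} p) le) refl
    (from (move-left bs (bit true) (bit false) as)
      (back-run bs (bit false ∷ as) (turn {L = suc L} (length bs) (s≤s (short-length p)) le)))

-- All digits are 0, so the borrow turns each of them into 1 until it meets a blank.
-- `replicate k true` records the ones written so far, which `restore-run` undoes.
borrow-zero-run : ∀ {C L as} → Short L as → val as ≡ 0 → ∀ k → k + L + 2 ≤ C →
  ∃[ as′ ] (Short L as′ × val as′ ≡ 0 ×
            TapeRun C borrow (rightOf (replicate k true) as) false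
                             (tape [] blank (unwind (replicate k false) as′)))
borrow-zero-run {C} {L} none eq k le =
  blank ∷ [] , gap , refl ,
  more (cells-rightOf (replicate k true) (none {L})
         (subst (λ x → x + L + 2 ≤ C) (symm (length-replicate k)) le)) refl
    (from (move-left (replicate k true) blank blank [])
      (restore-run k (blank ∷ []) (turn {L = L} k (s≤s z≤n) le)))
borrow-zero-run {C} {L} gap eq k le = borrow-zero-run {C} {L} none refl k le
borrow-zero-run {C} (digit {L} {false} {as} p) eq k le
  with borrow-zero-run p (m+n≡0⇒m≡0 (val as) eq) (suc k) (subst (λ x → x + 2 ≤ C) (+-suc k L) le)
... | as′ , p′ , eq′ , run =
  bit false ∷ as′ , digit p′ , cong (2 *_) eq′ ,
  more (cells-rightOf (replicate k true) (digit {b = false} p)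
         (subst (λ x → x + suc L + 2 ≤ C) (symm (length-replicate k)) le)) refl
    (from (move-right (replicate k true) (bit false) true as) run)

leave-home : ∀ {C s s′ b t} as → length as < C → table s blank ≡ (inj₂ s′ , blank , right) →
  TapeRun C s′ (rightOf [] as) b t → TapeRun C s (tape [] blank as) b t
leave-home []      le eq run = more le eq run
leave-home (_ ∷ _) le eq run = more le eq run

inc-run : ∀ {L v t} → Counter L v t → suc v < 2 ^ L →
  ∃[ t′ ] (Counter L (suc v) t′ × TapeRun (2 + L) inc₀ t true t′)
inc-run {L} (counter refl p refl) lt =
  let (as , p′ , eq , run) = carry-run p lt [] (≤-reflexive (+-comm L 2))
  in _ , counter refl p′ eq , leave-home _ (s≤s (short-length p)) refl run

dec-run : ∀ {L v t} → Counter L (suc v) t →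
  ∃[ t′ ] (Counter L v t′ × TapeRun (2 + L) dec₀ t true t′)
dec-run {L} (counter refl p eq₀) =
  let (as , p′ , eq , run) = borrow-run p eq₀ [] (≤-reflexive (+-comm L 2))
  in _ , counter refl p′ eq , leave-home _ (s≤s (short-length p)) refl run

dec-zero-run : ∀ {L t} → Counter L 0 t →
  ∃[ t′ ] (Counter L 0 t′ × TapeRun (2 + L) dec₀ t false t′)
dec-zero-run {L} (counter refl p eq₀) =
  let (as , p′ , eq , run) = borrow-zero-run p eq₀ 0 (≤-reflexive (+-comm L 2))
  in _ , counter refl p′ eq , leave-home _ (s≤s (short-length p)) refl run

-- Structured counter programs

-- Every program ends with a Boolean, on which `cond` branches; `while` repeats its body until that
-- returns false. `count s r` starts a counter operation in phase `s` on tape `r`.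
data Prog (Σ : Set) : Set where
  count : Phase → ℕ → Prog Σ
  test  : (InputSymbol Σ → Bool) → Prog Σ
  mv    : Move → Prog Σ
  cond  : Prog Σ → Prog Σ → Prog Σ → Prog Σ
  while : Prog Σ → Prog Σ

-- Control points of a program. Branching and looping add none of their own, because `branch` and
-- `again` redirect the halting transitions of the parts.
St : ∀ {Σ} → Prog Σ → Set
St (count _ _)  = Phase
St (test _)     = ⊤
St (mv _)       = ⊤
St (cond p q r) = St p ⊎ (St q ⊎ St r)
St (while p)    = St p

entry : ∀ {Σ} (p : Prog Σ) → St p
entry (count s _)  = s
entry (test _)     = tt
entry (mv _)       = tt
entry (cond p q r) = inj₁ (entry p)
entry (while p)    = entry p

Phase-finite : Finite Phase
Phase-finite = 6 , mk↔ₛ′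
  (λ { inc₀ → zero ; carry → suc zero ; dec₀ → suc (suc zero) ; borrow → suc (suc (suc zero))
     ; back → suc (suc (suc (suc zero))) ; restore → suc (suc (suc (suc (suc zero)))) })
  (λ { zero → inc₀ ; (suc zero) → carry ; (suc (suc zero)) → dec₀ ; (suc (suc (suc zero))) → borrow
     ; (suc (suc (suc (suc zero)))) → back ; (suc (suc (suc (suc (suc zero))))) → restore })
  (λ { zero → refl ; (suc zero) → refl ; (suc (suc zero)) → refl ; (suc (suc (suc zero))) → refl
     ; (suc (suc (suc (suc zero)))) → refl ; (suc (suc (suc (suc (suc zero))))) → refl })
  (λ { inc₀ → refl ; carry → refl ; dec₀ → refl ; borrow → refl ; back → refl ; restore → refl })

Cell-finite : Finite Cell
Cell-finite = 3 , mk↔ₛ′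
  (λ { blank → zero ; (bit false) → suc zero ; (bit true) → suc (suc zero) })
  (λ { zero → blank ; (suc zero) → bit false ; (suc (suc zero)) → bit true })
  (λ { zero → refl ; (suc zero) → refl ; (suc (suc zero)) → refl })
  (λ { blank → refl ; (bit false) → refl ; (bit true) → refl })

⊎-finite : ∀ {A B} → Finite A → Finite B → Finite (A ⊎ B)
⊎-finite (m , f) (n , g) = m + n , ↔-sym +↔⊎ ↔-∘ (f ⊎-↔ g)

St-finite : ∀ {Σ} (p : Prog Σ) → Finite (St p)
St-finite (count _ _)  = Phase-finite
St-finite (test _)     = 1 , ↔-sym 1↔⊤
St-finite (mv _)       = 1 , ↔-sym 1↔⊤
St-finite (cond p q r) = ⊎-finite (St-finite p) (⊎-finite (St-finite q) (St-finite r))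
St-finite (while p)    = St-finite p

-- Programs name registers by plain numbers, so that they can be written before the number of tapes
-- is fixed. Clamping makes `control` total and changes nothing as long as there are enough tapes.
clamp : ∀ {T} → ℕ → Fin (suc T)
clamp         zero    = zero
clamp {zero}  (suc r) = zero
clamp {suc T} (suc r) = suc (clamp r)

toℕ-clamp : ∀ {T r} → r ≤ T → toℕ (clamp {T} r) ≡ r
toℕ-clamp z≤n      = refl
toℕ-clamp (s≤s le) = cong suc (toℕ-clamp le)

branch : ∀ {Σ} (p q r : Prog Σ) → Bool ⊎ St p → Bool ⊎ St (cond p q r)
branch p q r (inj₁ true)  = inj₂ (inj₂ (inj₁ (entry q)))
branch p q r (inj₁ false) = inj₂ (inj₂ (inj₂ (entry r)))
branch p q r (inj₂ s)     = inj₂ (inj₁ s)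

again : ∀ {Σ} (p : Prog Σ) → Bool ⊎ St p → Bool ⊎ St (while p)
again p (inj₁ true)  = inj₂ (entry p)
again p (inj₁ false) = inj₁ false
again p (inj₂ s)     = inj₂ s

idle : ∀ {T} → Vec Cell T → Vec (Cell × Move) T
idle = Vec.map (_, stay)

control : ∀ {Σ T} (p : Prog Σ) → St p → InputSymbol Σ → Vec Cell (suc T) →
          (Bool ⊎ St p) × Move × Vec (Cell × Move) (suc T)
control (count _ r) s a xs =
  let (q , act) = table s (lookup xs (clamp r)) in q , stay , (idle xs [ clamp r ]≔ act)
control (test f) _ a xs = inj₁ (f a) , stay , idle xs
control (mv m)   _ a xs = inj₁ true , m , idle xs
control (cond p q r) (inj₁ s)        a xs = Product.map₁ (branch p q r) (control p s a xs)
control (cond p q r) (inj₂ (inj₁ s)) a xs = Product.map₁ (Sum.map₂ (inj₂ ∘ inj₁)) (control q s a xs)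
control (cond p q r) (inj₂ (inj₂ s)) a xs = Product.map₁ (Sum.map₂ (inj₂ ∘ inj₂)) (control r s a xs)
control (while p) s a xs = Product.map₁ (again p) (control p s a xs)

-- Execution of counter programs.

module _ {Σ : Set} (w : List Σ) where

  -- `symbolAt` and `moveHead` repeat `read` and `moveInput` without reference to a machine, so that
  -- terms have a semantics before they are compiled.
  symbolAt : ℕ → InputSymbol Σ
  symbolAt zero    = ⊢
  symbolAt (suc i) = nth w i

  moveHead : Move → ℕ → ℕ
  moveHead left  i = pred i
  moveHead stay  i = i
  moveHead right i = suc i ⊓ suc (length w)

idle-update : ∀ {T} (ts : Vec (Tape Cell) T) →
  zipWith (update blank) ts (idle (Vec.map scanned ts)) ≡ ts
idle-update []       = refl
idle-update (t ∷ ts) = cong (t ∷_) (idle-update ts)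

single-update : ∀ {T} (ts : Vec (Tape Cell) T) j act →
  zipWith (update blank) ts (idle (Vec.map scanned ts) [ j ]≔ act) ≡
  ts [ j ]≔ update blank (lookup ts j) act
single-update (t ∷ ts) zero    act = cong (_ ∷_) (idle-update ts)
single-update (t ∷ ts) (suc j) act = cong (t ∷_) (single-update ts j act)

module Execution {Σ : Set} (w : List Σ) (T C : ℕ) where

  Tapes : Set
  Tapes = Vec (Tape Cell) (suc T)

  Fits : Tapes → Set
  Fits ts = ∀ j → cells (lookup ts j) ≤ C

  perform : (p : Prog Σ) → St p → ℕ → Tapes → (Bool ⊎ St p) × ℕ × Tapes
  perform p s h ts =
    let (q , m , acts) = control p s (symbolAt w h) (Vec.map scanned ts)
    in q , moveHead w m h , zipWith (update blank) ts acts

  data Runs (p : Prog Σ) (s : St p) (h : ℕ) (ts : Tapes) (b : Bool) (h′ : ℕ) (ts′ : Tapes) : Set where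
    stop : Fits ts → perform p s h ts ≡ (inj₁ b , h′ , ts′) → Runs p s h ts b h′ ts′
    more : ∀ {s₁ h₁ ts₁} → Fits ts → perform p s h ts ≡ (inj₂ s₁ , h₁ , ts₁) →
           Runs p s₁ h₁ ts₁ b h′ ts′ → Runs p s h ts b h′ ts′

  module _ {p q r : Prog Σ} where

    inThen : ∀ {s h ts b h′ ts′} → Runs q s h ts b h′ ts′ → Runs (cond p q r) (inj₂ (inj₁ s)) h ts b h′ ts′
    inThen (stop fits eq)     = stop fits (cong (Product.map₁ (Sum.map₂ (inj₂ ∘ inj₁))) eq)
    inThen (more fits eq run) = more fits (cong (Product.map₁ (Sum.map₂ (inj₂ ∘ inj₁))) eq) (inThen run)

    inElse : ∀ {s h ts b h′ ts′} → Runs r s h ts b h′ ts′ → Runs (cond p q r) (inj₂ (inj₂ s)) h ts b h′ ts′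
    inElse (stop fits eq)     = stop fits (cong (Product.map₁ (Sum.map₂ (inj₂ ∘ inj₂))) eq)
    inElse (more fits eq run) = more fits (cong (Product.map₁ (Sum.map₂ (inj₂ ∘ inj₂))) eq) (inElse run)

    cond-true : ∀ {s h ts h₁ ts₁ b h′ ts′} → Runs p s h ts true h₁ ts₁ →
      Runs q (entry q) h₁ ts₁ b h′ ts′ → Runs (cond p q r) (inj₁ s) h ts b h′ ts′
    cond-true (stop fits eq) run′     = more fits (cong (Product.map₁ (branch p q r)) eq) (inThen run′)
    cond-true (more fits eq run) run′ =
      more fits (cong (Product.map₁ (branch p q r)) eq) (cond-true run run′)

    cond-false : ∀ {s h ts h₁ ts₁ b h′ ts′} → Runs p s h ts false h₁ ts₁ →
      Runs r (entry r) h₁ ts₁ b h′ ts′ → Runs (cond p q r) (inj₁ s) h ts b h′ ts′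
    cond-false (stop fits eq) run′     = more fits (cong (Product.map₁ (branch p q r)) eq) (inElse run′)
    cond-false (more fits eq run) run′ =
      more fits (cong (Product.map₁ (branch p q r)) eq) (cond-false run run′)

  module _ {p : Prog Σ} where

    while-true : ∀ {s h ts h₁ ts₁ b h′ ts′} → Runs p s h ts true h₁ ts₁ →
      Runs (while p) (entry p) h₁ ts₁ b h′ ts′ → Runs (while p) s h ts b h′ ts′
    while-true (stop fits eq) run′     = more fits (cong (Product.map₁ (again p)) eq) run′
    while-true (more fits eq run) run′ = more fits (cong (Product.map₁ (again p)) eq) (while-true run run′)

    while-false : ∀ {s h ts h′ ts′} → Runs p s h ts false h′ ts′ → Runs (while p) s h ts false h′ ts′
    while-false (stop fits eq)     = stop fits (cong (Product.map₁ (again p)) eq)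
    while-false (more fits eq run) = more fits (cong (Product.map₁ (again p)) eq) (while-false run)

  perform-count : ∀ {e r} s h ts →
    let (q , act) = table s (scanned (lookup ts (clamp r))) in
    perform (count e r) s h ts ≡ (q , h , (ts [ clamp r ]≔ update blank (lookup ts (clamp r)) act))
  perform-count {r = r} s h ts
    rewrite lookup-map (clamp r) scanned ts
          | single-update ts (clamp r) (proj₂ (table s (scanned (lookup ts (clamp r))))) = refl

  count-runs : ∀ {e r s t b t′ h} → TapeRun C s t b t′ → ∀ ts → lookup ts (clamp r) ≡ t →
    (∀ j → j ≢ clamp r → cells (lookup ts j) ≤ C) →
    Runs (count e r) s h ts b h (ts [ clamp r ]≔ t′)
  count-runs {e} {r} {s} {h = h} (stop {c = c} {m} le eq) ts refl fits =
    stop all-fit (trans (perform-count {e} {r} s h ts) (cong (λ (q , act) → q , h , (ts [ clamp r ]≔ update blank (lookup ts (clamp r)) act)) eq))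
    where
    all-fit : Fits ts
    all-fit j with j Fin.≟ clamp r
    ... | yes refl = le
    ... | no  j≢   = fits j j≢
  count-runs {e} {r} {s} {t′ = t′} {h} (more {s′ = s′} {c = c} {m} le eq run) ts refl fits =
    more all-fit (trans (perform-count {e} {r} s h ts) (cong (λ (q , act) → q , h , (ts [ clamp r ]≔ update blank (lookup ts (clamp r)) act)) eq))
      (subst (Runs (count e r) s′ h ts₁ _ h) ([]≔-idempotent ts (clamp r))
        (count-runs run ts₁ (lookup∘update (clamp r) ts _)
          (λ j j≢ → subst (λ t → cells t ≤ C) (symm (lookup∘update′ j≢ ts _)) (fits j j≢))))
    where
    ts₁ = ts [ clamp r ]≔ update blank (lookup ts (clamp r)) (c , m)
    all-fit : Fits ts
    all-fit j with j Fin.≟ clamp r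
    ... | yes refl = le
    ... | no  j≢   = fits j j≢

-- A stack of depth d keeps its bottom element in register 0; all registers from d on hold 0.

level : ∀ {d} → Fin d → ℕ
level {suc d} zero    = d
level {suc d} (suc j) = level j

register : ∀ {d} → Vec ℕ d → ℕ → ℕ
register {zero}  []       r = 0
register {suc d} (x ∷ xs) r with r ≟ d
... | yes _ = x
... | no  _ = register xs r

level< : ∀ {d} (j : Fin d) → level j < d
level< {suc d} zero    = ≤-refl
level< {suc d} (suc j) = m<n⇒m<1+n (level< j)

register-level : ∀ {d} (xs : Vec ℕ d) j → register xs (level j) ≡ lookup xs j
register-level {suc d} (x ∷ xs) zero with d ≟ d
... | yes _  = refl
... | no d≢d = contradiction refl d≢d
register-level {suc d} (x ∷ xs) (suc j) with level j ≟ d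
... | yes eq = contradiction (level< j) (<-irrefl eq)
... | no _   = register-level xs j

register-other : ∀ {d} (xs : Vec ℕ d) j v {r} → r ≢ level j → register (xs [ j ]≔ v) r ≡ register xs r
register-other {suc d} (x ∷ xs) zero v {r} r≢ with r ≟ d
... | yes eq = contradiction eq r≢
... | no _   = refl
register-other {suc d} (x ∷ xs) (suc j) v {r} r≢ with r ≟ d
... | yes _ = refl
... | no _  = register-other xs j v r≢

register-beyond : ∀ {d} (xs : Vec ℕ d) {r} → d ≤ r → register xs r ≡ 0
register-beyond []       _  = refl
register-beyond {suc d} (x ∷ xs) {r} le with r ≟ d
... | yes refl = contradiction le 1+n≰n
... | no _     = register-beyond xs (<⇒≤ le)

register-push : ∀ {d} (xs : Vec ℕ d) r → register (0 ∷ xs) r ≡ register xs r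
register-push {d} xs r with r ≟ d
... | yes refl = symm (register-beyond xs ≤-refl)
... | no _     = refl

-- Correctness of programs acting on a stack of registers.

module Stack {Σ : Set} (w : List Σ) (T L : ℕ) where

  open Execution w T (2 + L) public

  Holds : ∀ {d} → Vec ℕ d → Tapes → Set
  Holds xs ts = ∀ j → Counter L (register xs (toℕ j)) (lookup ts j)

  -- Total correctness, for every content of the tapes that represents `xs`. The two stacks may
  -- differ in depth, since depth is only a way of reading the registers.
  record Exec (p : Prog Σ) (h : ℕ) {d} (xs : Vec ℕ d) (b : Bool) (h′ : ℕ) {d′} (ys : Vec ℕ d′) : Set where
    constructor exec
    field
      run : ∀ {ts} → Holds xs ts → ∃[ ts′ ] (Holds ys ts′ × Runs p (entry p) h ts b h′ ts′)

  open Exec public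

  fits : ∀ {d} (xs : Vec ℕ d) {ts} → Holds xs ts → Fits ts
  fits xs holds j = counter-cells (holds j)

  holds-update : ∀ {d} (xs : Vec ℕ d) j {v ts t} i → toℕ i ≡ level j →
    Holds xs ts → Counter L v t → Holds (xs [ j ]≔ v) (ts [ i ]≔ t)
  holds-update xs j {v} {ts} {t} i toℕ-i holds c k with k Fin.≟ i
  ... | yes refl =
    subst₂ (Counter L)
      (symm (trans (cong (register (xs [ j ]≔ v)) toℕ-i)
                   (trans (register-level (xs [ j ]≔ v) j) (lookup∘update j xs v))))
      (symm (lookup∘update i ts t)) c
  ... | no k≢i =
    subst₂ (Counter L)
      (symm (register-other xs j v (λ eq → k≢i (Fin.toℕ-injective (trans eq (symm toℕ-i))))))
      (symm (lookup∘update′ k≢i ts t)) (holds k)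

  -- Registers beyond the depth hold 0, so pushing or popping a 0 takes no machine step: the same
  -- tapes are read at another depth.
  exec-push : ∀ {p h d b h′ d′} {xs : Vec ℕ d} {ys : Vec ℕ d′} →
    Exec p h (0 ∷ xs) b h′ ys → Exec p h xs b h′ ys
  exec-push {xs = xs} e = exec λ holds →
    run e (λ j → subst (λ v → Counter L v _) (symm (register-push xs (toℕ j))) (holds j))

  exec-pop : ∀ {p h d b h′ d′} {xs : Vec ℕ d} {ys : Vec ℕ d′} →
    Exec p h xs b h′ (0 ∷ ys) → Exec p h xs b h′ ys
  exec-pop {ys = ys} e = exec λ holds → let (ts′ , holds′ , r) = run e holds in
    ts′ , (λ j → subst (λ v → Counter L v _) (register-push ys (toℕ j)) (holds′ j)) , r

  exec-test : ∀ {f h d} {xs : Vec ℕ d} → Exec (test f) h xs (f (symbolAt w h)) h xs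
  exec-test {f} {h} {xs = xs} = exec λ {ts} holds → ts , holds ,
    stop (fits xs {ts} holds) (cong (λ ts′ → inj₁ (f (symbolAt w h)) , h , ts′) (idle-update ts))

  exec-mv : ∀ {m h d} {xs : Vec ℕ d} → Exec (mv m) h xs true (moveHead w m h) xs
  exec-mv {m} {h} {xs = xs} = exec λ {ts} holds → ts , holds ,
    stop (fits xs {ts} holds) (cong (λ ts′ → inj₁ true , moveHead w m h , ts′) (idle-update ts))

  exec-count : ∀ {s b h d} (xs : Vec ℕ d) (j : Fin d) v → d ≤ suc T →
    (∀ {t} → Counter L (lookup xs j) t → ∃[ t′ ] (Counter L v t′ × TapeRun (2 + L) s t b t′)) →
    Exec (count s (level j)) h xs b h (xs [ j ]≔ v)
  exec-count xs j v d≤ op = exec λ {ts} holds →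
    let i             = clamp (level j)
        toℕ-i         = toℕ-clamp (≤-pred (≤-trans (level< j) d≤))
        (t′ , c , r) = op (subst (λ x → Counter L x (lookup ts i))
                                  (trans (cong (register xs) toℕ-i) (register-level xs j)) (holds i))
    in (ts [ i ]≔ t′) , holds-update xs j {ts = ts} i toℕ-i holds c ,
       count-runs r ts refl (λ k _ → counter-cells (holds k))

  exec-cond-true : ∀ {p q r h d h₁ d₁ b h′ d′} {xs : Vec ℕ d} {ys : Vec ℕ d₁} {zs : Vec ℕ d′} →
    Exec p h xs true h₁ ys → Exec q h₁ ys b h′ zs → Exec (cond p q r) h xs b h′ zs
  exec-cond-true e e′ = exec λ holds →
    let (_ , holds₁ , r₁) = run e holds ; (_ , holds₂ , r₂) = run e′ holds₁
    in _ , holds₂ , cond-true r₁ r₂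

  exec-cond-false : ∀ {p q r h d h₁ d₁ b h′ d′} {xs : Vec ℕ d} {ys : Vec ℕ d₁} {zs : Vec ℕ d′} →
    Exec p h xs false h₁ ys → Exec r h₁ ys b h′ zs → Exec (cond p q r) h xs b h′ zs
  exec-cond-false e e′ = exec λ holds →
    let (_ , holds₁ , r₁) = run e holds ; (_ , holds₂ , r₂) = run e′ holds₁
    in _ , holds₂ , cond-false r₁ r₂

  exec-while-true : ∀ {p h d h₁ d₁ b h′ d′} {xs : Vec ℕ d} {ys : Vec ℕ d₁} {zs : Vec ℕ d′} →
    Exec p h xs true h₁ ys → Exec (while p) h₁ ys b h′ zs → Exec (while p) h xs b h′ zs
  exec-while-true e e′ = exec λ holds →
    let (_ , holds₁ , r₁) = run e holds ; (_ , holds₂ , r₂) = run e′ holds₁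
    in _ , holds₂ , while-true r₁ r₂

  exec-while-false : ∀ {p h d h′ d′} {xs : Vec ℕ d} {ys : Vec ℕ d′} →
    Exec p h xs false h′ ys → Exec (while p) h xs false h′ ys
  exec-while-false e = exec λ holds →
    let (_ , holds₁ , r₁) = run e holds in _ , holds₁ , while-false r₁

-- A language of total functions on input positions

infix 9 #_

-- `br` is the only access to the input. `lett` gives an argument an index, by which it can be used
-- under the loop variables of `iter`.
data Term (Σ : Set) (k : ℕ) : Set where
  #_      : Fin k → Term Σ k
  ze      : Term Σ k
  up down : Term Σ k → Term Σ k
  br      : (InputSymbol Σ → Bool) → (e a b : Term Σ k) → Term Σ k
  lett    : Term Σ k → Term Σ (suc k) → Term Σ k
  iter    : (a b : Term Σ k) (f g u : Term Σ (2 + k)) → Term Σ k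

iterate : {A : Set} → ℕ → (A → A) → A → A
iterate zero    f x = x
iterate (suc m) f x = iterate m f (f x)

both : (f g : ℕ → ℕ → ℕ) → ℕ × ℕ → ℕ × ℕ
both f g (x , y) = f x y , g x y

-- The values are positions: up saturates at length w + 1, down at 0, and iter
-- repeats its body length w + 1 times.
⟦_⟧ : ∀ {Σ k} → Term Σ k → List Σ → Vec ℕ k → ℕ
⟦ # i ⟧          w ρ = lookup ρ i
⟦ ze ⟧           w ρ = 0
⟦ up e ⟧         w ρ = moveHead w right (⟦ e ⟧ w ρ)
⟦ down e ⟧       w ρ = pred (⟦ e ⟧ w ρ)
⟦ br t e a b ⟧   w ρ = if t (symbolAt w (⟦ e ⟧ w ρ)) then ⟦ a ⟧ w ρ else ⟦ b ⟧ w ρ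
⟦ lett e u ⟧     w ρ = ⟦ u ⟧ w (⟦ e ⟧ w ρ ∷ ρ)
⟦ iter a b f g u ⟧ w ρ =
  let (x , y) = iterate (suc (length w)) (both (λ x y → ⟦ f ⟧ w (x ∷ y ∷ ρ)) (λ x y → ⟦ g ⟧ w (x ∷ y ∷ ρ)))
                        (⟦ a ⟧ w ρ , ⟦ b ⟧ w ρ)
  in ⟦ u ⟧ w (x ∷ y ∷ ρ)

Bounded : ∀ {k} → ℕ → Vec ℕ k → Set
Bounded n ρ = ∀ i → lookup ρ i ≤ n

bounded-∷ : ∀ {n k x} {ρ : Vec ℕ k} → x ≤ n → Bounded n ρ → Bounded n (x ∷ ρ)
bounded-∷ p q zero    = p
bounded-∷ p q (suc i) = q i

iterate-invariant : {A : Set} (P : A → Set) (f : A → A) → (∀ {x} → P x → P (f x)) →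
  ∀ m {x} → P x → P (iterate m f x)
iterate-invariant P f pres zero    p = p
iterate-invariant P f pres (suc m) p = iterate-invariant P f pres m (pres p)

-- The source of the space bound: every intermediate value is an input position and therefore fits
-- into logarithmically many bits.
⟦⟧-bounded : ∀ {Σ k} (e : Term Σ k) (w : List Σ) {ρ} →
  Bounded (suc (length w)) ρ → ⟦ e ⟧ w ρ ≤ suc (length w)
⟦⟧-bounded (# i)        w p = p i
⟦⟧-bounded ze           w p = z≤n
⟦⟧-bounded (up e)       w p = m⊓n≤n _ (suc (length w))
⟦⟧-bounded (down e)     w p = ≤-trans pred[n]≤n (⟦⟧-bounded e w p)
⟦⟧-bounded (br t e a b) w {ρ} p with t (symbolAt w (⟦ e ⟧ w ρ))
... | true  = ⟦⟧-bounded a w p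
... | false = ⟦⟧-bounded b w p
⟦⟧-bounded (lett e u)   w p = ⟦⟧-bounded u w (bounded-∷ (⟦⟧-bounded e w p) p)
⟦⟧-bounded (iter a b f g u) w {ρ} p =
  let (x≤ , y≤) = iterate-invariant (λ (x , y) → x ≤ suc (length w) × y ≤ suc (length w))
        (both (λ x y → ⟦ f ⟧ w (x ∷ y ∷ ρ)) (λ x y → ⟦ g ⟧ w (x ∷ y ∷ ρ)))
        (λ (x≤ , y≤) → ⟦⟧-bounded f w (bounded-∷ x≤ (bounded-∷ y≤ p)) ,
                       ⟦⟧-bounded g w (bounded-∷ x≤ (bounded-∷ y≤ p)))
        (suc (length w)) (⟦⟧-bounded a w p , ⟦⟧-bounded b w p)
  in ⟦⟧-bounded u w (bounded-∷ x≤ (bounded-∷ y≤ p))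

is⊢ is⊣ : ∀ {Σ} → InputSymbol Σ → Bool
is⊢ ⊢ = true
is⊢ _ = false
is⊣ ⊣ = true
is⊣ _ = false

-- Compilation of terms to counter programs.

infixr 5 _⨾_

nop : ∀ {Σ} → Prog Σ
nop = test (const true)

_⨾_ : ∀ {Σ} → Prog Σ → Prog Σ → Prog Σ
p ⨾ q = cond p q q

loop : ∀ {Σ} → Prog Σ → Prog Σ → Prog Σ
loop c p = while (cond c (p ⨾ nop) (test (const false)))

-- The second component of a loop lies on top of the first one on the stack, whereas variable 0 of
-- the loop body is the first; hence the swap. `m` counts the temporaries above both.
raise : ∀ {k d} m → (Fin k → Fin d) → Fin (2 + k) → Fin (m + (2 + d))
raise zero    η zero          = suc zero
raise zero    η (suc zero)    = zero
raise zero    η (suc (suc i)) = suc (suc (η i))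
raise (suc m) η i             = suc (raise m η i)

module _ {Σ : Set} where

  inc dec : ∀ {d} → Fin d → Prog Σ
  inc j = count inc₀ (level j)
  dec j = count dec₀ (level j)

  -- The value of a register is consumed when it is loaded as the head position.
  -- Conversely, unload p runs p once for every position left of the head, so that
  -- unload (inc j) stores the head position in a register that holds 0.
  load : ∀ {d} → Fin d → Prog Σ
  load j = loop (test (not ∘ is⊢)) (mv left) ⨾ loop (dec j) (mv right)

  unload : Prog Σ → Prog Σ
  unload p = loop (test (not ∘ is⊢)) (mv left ⨾ p)

  clear : ∀ {d} → Fin d → Prog Σ
  clear j = loop (dec j) nop

  move : ∀ {d} → Fin d → Fin d → Prog Σ
  move i j = clear j ⨾ load i ⨾ unload (inc j)

  -- The right end marker stands at position `length w + 1`, the iteration count of `iter`, so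
  -- unloading the head from there yields the loop counter.
  fill : ∀ {d} → Fin d → Prog Σ
  fill j = loop (test (not ∘ is⊢)) (mv left) ⨾ loop (test (not ∘ is⊣)) (mv right) ⨾ unload (inc j)

  compile : ∀ {k d} → (Fin k → Fin d) → Term Σ k → Prog Σ
  -- Loading empties the register, so the unloading refills it along with the new top.
  compile {d = d} η (# i) = load (suc (η i)) ⨾ unload (inc {suc d} zero ⨾ inc (suc (η i)))
  compile η ze            = nop
  -- Saturation is inherited from the input head, which cannot pass the right end marker.
  compile {d = d} η (up e)   = compile η e ⨾ load {suc d} zero ⨾ mv right ⨾ unload (inc {suc d} zero)
  compile {d = d} η (down e) = compile η e ⨾ dec {suc d} zero
  compile {d = d} η (br t e a b) =
    compile η e ⨾ load {suc d} zero ⨾ cond (test t) (compile η a) (compile η b)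
  compile {k} {d} η (lett e u) =
    compile η e ⨾ compile η′ u ⨾ move {2 + d} zero (suc zero)
    where
    η′ : Fin (suc k) → Fin (suc d)
    η′ zero    = zero
    η′ (suc i) = suc (η i)
  compile {d = d} η (iter a b f g u) =
    compile η a ⨾ compile (λ i → suc (η i)) b ⨾
    fill {3 + d} zero ⨾
    loop (dec {3 + d} zero)
      -- Both new values are computed before either is stored. Below them and the counter, the old
      -- components have indices 3 and 4; the first `move` frees the top, so both moves aim at index
      -- 3.
      (compile (raise 1 η) f ⨾ compile (raise 2 η) g ⨾
       move {5 + d} zero (suc (suc (suc zero))) ⨾ move {4 + d} zero (suc (suc (suc zero)))) ⨾
    -- The result overwrites the first component. The counter has run down to 0 and the second
    -- component is cleared, so only zeros remain above the result.
    compile (raise 1 η) u ⨾ move {4 + d} zero (suc (suc (suc zero))) ⨾ clear {3 + d} (suc zero)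

-- The greatest depth that the stack reaches. In `iter` the two components, the counter and the two
-- new values account for `5 + d`.
registers : ∀ {Σ k} → ℕ → Term Σ k → ℕ
registers d (# _)        = suc d
registers d ze           = suc d
registers d (up e)       = registers d e ⊔ suc d
registers d (down e)     = registers d e ⊔ suc d
registers d (br _ e a b) = suc d ⊔ (registers d e ⊔ (registers d a ⊔ registers d b))
registers d (lett e u)   = registers d e ⊔ (registers (suc d) u ⊔ (2 + d))
registers d (iter a b f g u) =
  registers d a ⊔ (registers (1 + d) b ⊔ (registers (3 + d) f ⊔ (registers (4 + d) g ⊔
  (registers (3 + d) u ⊔ (5 + d)))))

nth-length : ∀ {Σ : Set} (w : List Σ) → nth w (length w) ≡ ⊣
nth-length []      = refl
nth-length (_ ∷ w) = nth-length w

module _ {Σ : Set} (w : List Σ) where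

  symbolAt-pos : ∀ h → is⊢ (symbolAt w (suc h)) ≡ false
  symbolAt-pos h = nth≢⊢ w h
    where
    nth≢⊢ : ∀ (w : List Σ) h → is⊢ (nth w h) ≡ false
    nth≢⊢ []      h       = refl
    nth≢⊢ (_ ∷ _) zero    = refl
    nth≢⊢ (_ ∷ w) (suc h) = nth≢⊢ w h

  symbolAt-end : ∀ {h} → h ≤ length w → is⊣ (symbolAt w h) ≡ false
  symbolAt-end {zero}  _  = refl
  symbolAt-end {suc h} le = nth≢⊣ w h le
    where
    nth≢⊣ : ∀ (w : List Σ) h → h < length w → is⊣ (nth w h) ≡ false
    nth≢⊣ (_ ∷ _) zero    _        = refl
    nth≢⊣ (_ ∷ w) (suc h) (s≤s lt) = nth≢⊣ w h lt

  moveHead-right : ∀ {h} → h ≤ length w → moveHead w right h ≡ suc h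
  moveHead-right le = m≤n⇒m⊓n≡m (s≤s le)

module Compilation {Σ : Set} (w : List Σ) (T L : ℕ) (room : suc (length w) < 2 ^ L) where

  open Stack w T L

  private
    n = length w

  exec-seq : ∀ {p q h d b₁ h₁ d₁ b h′ d′} {xs : Vec ℕ d} {ys : Vec ℕ d₁} {zs : Vec ℕ d′} →
    Exec p h xs b₁ h₁ ys → Exec q h₁ ys b h′ zs → Exec (p ⨾ q) h xs b h′ zs
  exec-seq {b₁ = true}  = exec-cond-true
  exec-seq {b₁ = false} = exec-cond-false

  exec-loop-stop : ∀ {c p h d h′ d′} {xs : Vec ℕ d} {ys : Vec ℕ d′} →
    Exec c h xs false h′ ys → Exec (loop c p) h xs false h′ ys
  exec-loop-stop e = exec-while-false (exec-cond-false e exec-test)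

  exec-loop-step : ∀ {c p h d h₁ d₁ b h₂ d₂ h′ d′}
    {xs : Vec ℕ d} {ys : Vec ℕ d₁} {zs : Vec ℕ d₂} {us : Vec ℕ d′} →
    Exec c h xs true h₁ ys → Exec p h₁ ys b h₂ zs → Exec (loop c p) h₂ zs false h′ us →
    Exec (loop c p) h xs false h′ us
  exec-loop-step e e₁ e₂ = exec-while-true (exec-cond-true e (exec-seq e₁ exec-test)) e₂

  test-exec : ∀ {f h d b} {xs : Vec ℕ d} → f (symbolAt w h) ≡ b → Exec (test f) h xs b h xs
  test-exec refl = exec-test

  exec-inc : ∀ {h d} {xs : Vec ℕ d} (j : Fin d) → d ≤ suc T → lookup xs j ≤ n →
    Exec (inc j) h xs true h (xs [ j ]≔ suc (lookup xs j))
  exec-inc {xs = xs} j d≤ le =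
    exec-count xs j _ d≤ (λ c → inc-run c (≤-trans (s≤s (s≤s le)) room))

  exec-dec : ∀ {h d v} {xs : Vec ℕ d} (j : Fin d) → d ≤ suc T → lookup xs j ≡ suc v →
    Exec (dec j) h xs true h (xs [ j ]≔ v)
  exec-dec {xs = xs} j d≤ eq =
    exec-count xs j _ d≤ (λ c → dec-run (subst (λ v → Counter L v _) eq c))

  exec-dec-zero : ∀ {h d} {xs : Vec ℕ d} (j : Fin d) → d ≤ suc T → lookup xs j ≡ 0 →
    Exec (dec j) h xs false h (xs [ j ]≔ 0)
  exec-dec-zero {xs = xs} j d≤ eq =
    exec-count xs j _ d≤ (λ c → dec-zero-run (subst (λ v → Counter L v _) eq c))

  exec-rewind : ∀ {h d} {xs : Vec ℕ d} → Exec (loop (test (not ∘ is⊢)) (mv left)) h xs false 0 xs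
  exec-rewind {h = zero}  = exec-loop-stop exec-test
  exec-rewind {h = suc h} =
    exec-loop-step (test-exec (cong not (symbolAt-pos w h))) exec-mv (exec-rewind {h = h})

  exec-advance : ∀ {h d} {xs : Vec ℕ d} → h ≤ suc n →
    Exec (loop (test (not ∘ is⊣)) (mv right)) h xs false (suc n) xs
  exec-advance {h} le = go (suc n ∸ h) h (m+[n∸m]≡n le)
    where
    go : ∀ m h {d} {xs : Vec ℕ d} → h + m ≡ suc n →
      Exec (loop (test (not ∘ is⊣)) (mv right)) h xs false (suc n) xs
    go zero    h eq rewrite trans (symm (+-identityʳ h)) eq =
      exec-loop-stop (test-exec (cong (not ∘ is⊣) (nth-length w)))
    go (suc m) h {xs = xs} eq =
      exec-loop-step (test-exec (cong not (symbolAt-end w h≤n)))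
        (subst (λ h′ → Exec (mv right) h xs true h′ xs) (moveHead-right w h≤n) exec-mv)
        (go m (suc h) (trans (symm (+-suc h m)) eq))
      where
      h≤n : h ≤ n
      h≤n = ≤-pred (≤-trans (s≤s (m≤m+n h m)) (≤-reflexive (trans (symm (+-suc h m)) eq)))

  exec-load : ∀ {h d} {xs : Vec ℕ d} (j : Fin d) → d ≤ suc T → lookup xs j ≤ suc n →
    Exec (load j) h xs false (lookup xs j) (xs [ j ]≔ 0)
  exec-load {h} {d} {xs} j d≤ le = exec-seq exec-rewind (go (lookup xs j) 0 refl le)
    where
    go : ∀ v h {xs : Vec ℕ d} → lookup xs j ≡ v → h + v ≤ suc n →
      Exec (loop (dec j) (mv right)) h xs false (h + v) (xs [ j ]≔ 0)
    go zero h eq le rewrite +-identityʳ h = exec-loop-stop (exec-dec-zero j d≤ eq)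
    go (suc v) h {xs} eq le =
      subst₂ (λ h′ ys → Exec (loop (dec j) (mv right)) h xs false h′ ys)
        (symm (+-suc h v)) ([]≔-idempotent xs j)
        (exec-loop-step (exec-dec j d≤ eq)
          (subst (λ h′ → Exec (mv right) h (xs [ j ]≔ v) true h′ (xs [ j ]≔ v)) (moveHead-right w h≤n) exec-mv)
          (go v (suc h) (lookup∘update j xs v) le′))
      where
      le′ : suc h + v ≤ suc n
      le′ = ≤-trans (≤-reflexive (symm (+-suc h v))) le
      h≤n : h ≤ n
      h≤n = ≤-trans (m≤m+n h v) (≤-pred le′)

  -- The head position serves as the loop variable: `X i` is the stack at the moment when the head
  -- has come down to `i`.
  exec-unload : ∀ {p d b} h (X : ℕ → Vec ℕ d) →
    (∀ i → i < h → Exec p i (X (suc i)) b i (X i)) → Exec (unload p) h (X h) false 0 (X 0)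
  exec-unload zero    X step = exec-loop-stop exec-test
  exec-unload (suc h) X step =
    exec-loop-step (test-exec (cong not (symbolAt-pos w h)))
      (exec-seq exec-mv (step h ≤-refl)) (exec-unload h X (λ i lt → step i (m<n⇒m<1+n lt)))

  suc-∸-suc : ∀ {i v} → i < v → suc (v ∸ suc i) ≡ v ∸ i
  suc-∸-suc {zero}  (s≤s _)  = refl
  suc-∸-suc {suc i} (s≤s lt) = suc-∸-suc lt

  exec-unload-inc : ∀ {d} {xs : Vec ℕ d} (j : Fin d) h → d ≤ suc T → h ≤ suc n → lookup xs j ≡ 0 →
    Exec (unload (inc j)) h xs false 0 (xs [ j ]≔ h)
  exec-unload-inc {xs = xs} j h d≤ le eq =
    subst (λ ys → Exec (unload (inc j)) h ys false 0 (xs [ j ]≔ h)) start-eq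
      (exec-unload h X λ i lt →
        subst (λ ys → Exec (inc j) i (X (suc i)) true i ys) (step-eq i lt)
          (exec-inc j d≤ (≤-trans (≤-reflexive (lookup∘update j xs _))
            (≤-trans (∸-monoʳ-≤ h (s≤s (z≤n {i}))) (≤-trans (≤-reflexive (pred-∸ h)) (pred-mono-≤ le))))))
    where
    X : ℕ → Vec ℕ _
    X i = xs [ j ]≔ (h ∸ i)
    pred-∸ : ∀ h → h ∸ 1 ≡ pred h
    pred-∸ zero    = refl
    pred-∸ (suc h) = refl
    start-eq : X h ≡ xs
    start-eq = trans (cong (xs [ j ]≔_) (trans (n∸n≡0 h) (symm eq))) ([]≔-lookup xs j)
    step-eq : ∀ i → i < h → X (suc i) [ j ]≔ suc (lookup (X (suc i)) j) ≡ X i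
    step-eq i lt = trans ([]≔-idempotent xs j)
      (cong (xs [ j ]≔_) (trans (cong suc (lookup∘update j xs _)) (suc-∸-suc lt)))

  exec-clear : ∀ {h d} {xs : Vec ℕ d} (j : Fin d) → d ≤ suc T → Exec (clear j) h xs false h (xs [ j ]≔ 0)
  exec-clear {h} {d} {xs} j d≤ = go (lookup xs j) refl
    where
    go : ∀ v {xs : Vec ℕ d} → lookup xs j ≡ v → Exec (clear j) h xs false h (xs [ j ]≔ 0)
    go zero    eq = exec-loop-stop (exec-dec-zero j d≤ eq)
    go (suc v) {xs} eq = subst (λ ys → Exec (clear j) h xs false h ys) ([]≔-idempotent xs j)
      (exec-loop-step (exec-dec j d≤ eq) exec-test (go v (lookup∘update j xs v)))

  -- The final Boolean and head position of a compiled term are left open, since whatever depends on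
  -- the head begins by rewinding it.
  Computes : Prog Σ → ∀ {d d′} → Vec ℕ d → Vec ℕ d′ → Set
  Computes p xs ys = ∀ h → ∃[ b ] ∃[ h′ ] Exec p h xs b h′ ys

  infixr 5 _then_

  _then_ : ∀ {p q d d₁ d′} {xs : Vec ℕ d} {ys : Vec ℕ d₁} {zs : Vec ℕ d′} →
    Computes p xs ys → Computes q ys zs → Computes (p ⨾ q) xs zs
  (e then e′) h = let (_ , h₁ , r) = e h ; (b , h₂ , r′) = e′ h₁ in b , h₂ , exec-seq r r′

  pop : ∀ {p d d′} {xs : Vec ℕ d} {ys : Vec ℕ d′} → Computes p xs (0 ∷ ys) → Computes p xs ys
  pop e h = let (b , h′ , r) = e h in b , h′ , exec-pop r

  computes-move : ∀ {d} {xs : Vec ℕ d} (i j : Fin d) → i ≢ j → d ≤ suc T → lookup xs i ≤ suc n →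
    Computes (move i j) xs ((xs [ j ]≔ lookup xs i) [ i ]≔ 0)
  computes-move {xs = xs} i j i≢j d≤ le h = false , 0 ,
    exec-seq (exec-clear j d≤)
      (exec-seq (subst (λ v → Exec (load i) h xs₁ false v (xs₁ [ i ]≔ 0)) look (exec-load i d≤ (≤-trans (≤-reflexive look) le)))
        (subst (λ ys → Exec (unload (inc j)) (lookup xs i) (xs₁ [ i ]≔ 0) false 0 ys) eq
          (exec-unload-inc j (lookup xs i) d≤ le
            (trans (lookup∘update′ (i≢j ∘ symm) xs₁ 0) (lookup∘update j xs 0)))))
    where
    xs₁ = xs [ j ]≔ 0
    look : lookup xs₁ i ≡ lookup xs i
    look = lookup∘update′ i≢j xs 0
    eq : ((xs [ j ]≔ 0) [ i ]≔ 0) [ j ]≔ lookup xs i ≡ (xs [ j ]≔ lookup xs i) [ i ]≔ 0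
    eq = trans ([]≔-commutes xs₁ i j i≢j) (cong (_[ i ]≔ 0) ([]≔-idempotent xs j))

  exec-iterate : ∀ {p d} (X : ℕ × ℕ → Vec ℕ d) (f : ℕ × ℕ → ℕ × ℕ) (P : ℕ × ℕ → Set) →
    d ≤ T → (∀ {s} → P s → P (f s)) →
    (∀ c {s} → P s → Computes p (c ∷ X s) (c ∷ X (f s))) →
    ∀ c {s} → P s → ∀ h →
    ∃[ h′ ] Exec (loop (dec {d = suc d} zero) p) h (c ∷ X s) false h′ (0 ∷ X (iterate c f s))
  exec-iterate X f P d≤ pres body zero    Ps h = h , exec-loop-stop (exec-dec-zero zero (s≤s d≤) refl)
  exec-iterate X f P d≤ pres body (suc c) Ps h =
    let (_ , h₁ , r) = body c Ps h
        (h₂ , r′)    = exec-iterate X f P d≤ pres body c (pres Ps) h₁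
    in h₂ , exec-loop-step (exec-dec zero (s≤s d≤) refl) r r′

  Matches : ∀ {k d} → (Fin k → Fin d) → Vec ℕ d → Vec ℕ k → Set
  Matches η xs ρ = ∀ i → lookup xs (η i) ≡ lookup ρ i

  raise-matches : ∀ {k d x y} (η : Fin k → Fin d) (xs : Vec ℕ d) (ρ : Vec ℕ k) → Matches η xs ρ →
    ∀ {m} (zs : Vec ℕ m) → Matches (raise m η) (zs Vec.++ (y ∷ x ∷ xs)) (x ∷ y ∷ ρ)
  raise-matches η xs ρ match []       zero          = refl
  raise-matches η xs ρ match []       (suc zero)    = refl
  raise-matches η xs ρ match []       (suc (suc i)) = match i
  raise-matches η xs ρ match (z ∷ zs) i             = raise-matches η xs ρ match zs i

  compile-correct : ∀ {k d} (η : Fin k → Fin d) (e : Term Σ k) {xs ρ} → Matches η xs ρ →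
    Bounded (suc n) ρ → registers d e ≤ suc T → Computes (compile η e) xs (⟦ e ⟧ w ρ ∷ xs)
  compile-correct {d = d} η (# i) {xs} {ρ} match bounded h≤ h =
    false , 0 , exec-push (exec-seq (exec-load (suc (η i)) h≤ v≤)
      (subst₂ (λ ys zs → Exec (unload (inc {d = suc d} zero ⨾ inc (suc (η i)))) v ys false 0 zs)
        (cong (λ u → u ∷ (xs [ η i ]≔ u)) (n∸n≡0 v))
        (cong₂ _∷_ (match i) ([]≔-lookup xs (η i)))
        (exec-unload v X step)))
    where
    v = lookup xs (η i)
    v≤ : v ≤ suc n
    v≤ = ≤-trans (≤-reflexive (match i)) (bounded i)
    -- While the head travels from `v` down to 0, the copy and the original count up together.
    X : ℕ → Vec ℕ (suc d)
    X m = (v ∸ m) ∷ (xs [ η i ]≔ (v ∸ m))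
    below : ∀ m → v ∸ suc m ≤ n
    below m = ≤-trans (∸-monoʳ-≤ v (s≤s (z≤n {m}))) (∸-monoˡ-≤ 1 v≤)
    step : ∀ m → m < v → Exec (inc {d = suc d} zero ⨾ inc (suc (η i))) m (X (suc m)) true m (X m)
    step m lt = exec-seq
      (subst (λ u → Exec (inc {d = suc d} zero) m (X (suc m)) true m (u ∷ (xs [ η i ]≔ (v ∸ suc m))))
             (suc-∸-suc lt) (exec-inc zero h≤ (below m)))
      (subst (Exec (inc (suc (η i))) m ((v ∸ m) ∷ (xs [ η i ]≔ (v ∸ suc m))) true m)
             (cong ((v ∸ m) ∷_) (trans ([]≔-idempotent xs (η i)) (cong (xs [ η i ]≔_)
               (trans (cong suc (lookup∘update (η i) xs (v ∸ suc m))) (suc-∸-suc lt)))))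
             (exec-inc (suc (η i)) h≤ (≤-trans (≤-reflexive (lookup∘update (η i) xs (v ∸ suc m))) (below m))))
  compile-correct η ze match bounded h≤ h = true , h , exec-push exec-test
  compile-correct {d = d} η (up e) {xs} {ρ} match bounded h≤ =
    compile-correct η e match bounded (m⊔n≤o⇒m≤o _ _ h≤) then λ h → false , 0 ,
    exec-seq (exec-load zero d≤ (⟦⟧-bounded e w bounded))
      (exec-seq exec-mv (exec-unload-inc zero _ d≤ (m⊓n≤n _ (suc n)) refl))
    where
    d≤ = m⊔n≤o⇒n≤o (registers d e) (suc d) h≤
  compile-correct {d = d} η (down e) {xs} {ρ} match bounded h≤ =
    compile-correct η e match bounded (m⊔n≤o⇒m≤o _ _ h≤) then decrement (⟦ e ⟧ w ρ)
    where
    d≤ = m⊔n≤o⇒n≤o (registers d e) (suc d) h≤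
    decrement : ∀ v → Computes (dec {d = suc d} zero) (v ∷ xs) (pred v ∷ xs)
    decrement zero    h = false , h , exec-dec-zero zero d≤ refl
    decrement (suc v) h = true , h , exec-dec zero d≤ refl
  compile-correct {d = d} η (br t e a b) {xs} {ρ} match bounded h≤ =
    compile-correct η e match bounded (m⊔n≤o⇒m≤o _ _ h≤₁) then λ h → choose (t (symbolAt w v)) refl
    where
    v = ⟦ e ⟧ w ρ
    d≤  = m⊔n≤o⇒m≤o (suc d) (registers d e ⊔ (registers d a ⊔ registers d b)) h≤
    h≤₁ = m⊔n≤o⇒n≤o (suc d) (registers d e ⊔ (registers d a ⊔ registers d b)) h≤
    h≤₂ = m⊔n≤o⇒n≤o (registers d e) _ h≤₁
    choose : ∀ {h} c → t (symbolAt w v) ≡ c → ∃[ b′ ] ∃[ h′ ]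
      Exec (load {d = suc d} zero ⨾ cond (test t) (compile η a) (compile η b)) h (v ∷ xs) b′ h′
           ((if c then ⟦ a ⟧ w ρ else ⟦ b ⟧ w ρ) ∷ xs)
    choose true eq =
      let (b′ , h′ , r) = compile-correct η a match bounded (m⊔n≤o⇒m≤o _ _ h≤₂) v
      in b′ , h′ , exec-seq (exec-pop (exec-load zero d≤ (⟦⟧-bounded e w bounded)))
                            (exec-cond-true (test-exec eq) r)
    choose false eq =
      let (b′ , h′ , r) = compile-correct η b match bounded (m⊔n≤o⇒n≤o (registers d a) _ h≤₂) v
      in b′ , h′ , exec-seq (exec-pop (exec-load zero d≤ (⟦⟧-bounded e w bounded)))
                            (exec-cond-false (test-exec eq) r)
  compile-correct {d = d} η (lett e u) {xs} {ρ} match bounded h≤ =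
    compile-correct η e match bounded (m⊔n≤o⇒m≤o _ _ h≤) then
    compile-correct _ u (λ { zero → refl ; (suc i) → match i }) bounded′ (m⊔n≤o⇒m≤o _ _ h≤₁) then
    pop (computes-move zero (suc zero) (λ ()) (m⊔n≤o⇒n≤o (registers (suc d) u) _ h≤₁) (⟦⟧-bounded u w bounded′))
    where
    h≤₁ = m⊔n≤o⇒n≤o (registers d e) _ h≤
    bounded′ = bounded-∷ (⟦⟧-bounded e w bounded) bounded
  compile-correct {d = d} η (iter a b f g u) {xs} {ρ} match bounded h≤ =
    compile-correct η a match bounded (m⊔n≤o⇒m≤o _ _ h≤) then
    compile-correct (λ i → suc (η i)) b match bounded (m⊔n≤o⇒m≤o _ _ h≤₁) then
    (λ h → false , 0 , exec-push (exec-seq exec-rewind (exec-seq (exec-advance z≤n)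
      (exec-unload-inc zero (suc n) d≤₃ ≤-refl refl)))) then
    (λ h → let (h′ , r) = exec-iterate X F P (≤-pred d≤₃) pres body (suc n) start h in false , h′ , r) then
    finish (iterate-invariant P F pres (suc n) start)
    where
    h≤₁ = m⊔n≤o⇒n≤o (registers d a) _ h≤
    h≤₂ = m⊔n≤o⇒n≤o (registers (1 + d) b) _ h≤₁
    h≤₃ = m⊔n≤o⇒n≤o (registers (3 + d) f) _ h≤₂
    h≤₄ = m⊔n≤o⇒n≤o (registers (4 + d) g) _ h≤₃
    d≤₅ = m⊔n≤o⇒n≤o (registers (3 + d) u) _ h≤₄
    d≤₄ = <⇒≤ d≤₅
    d≤₃ = <⇒≤ d≤₄
    X : ℕ × ℕ → Vec ℕ (2 + d)
    X (x , y) = y ∷ x ∷ xs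
    F : ℕ × ℕ → ℕ × ℕ
    F = both (λ x y → ⟦ f ⟧ w (x ∷ y ∷ ρ)) (λ x y → ⟦ g ⟧ w (x ∷ y ∷ ρ))
    P : ℕ × ℕ → Set
    P (x , y) = x ≤ suc n × y ≤ suc n
    bounded₂ : ∀ {x y} → P (x , y) → Bounded (suc n) (x ∷ y ∷ ρ)
    bounded₂ (x≤ , y≤) = bounded-∷ x≤ (bounded-∷ y≤ bounded)
    pres : ∀ {s} → P s → P (F s)
    pres p = ⟦⟧-bounded f w (bounded₂ p) , ⟦⟧-bounded g w (bounded₂ p)
    start : P (⟦ a ⟧ w ρ , ⟦ b ⟧ w ρ)
    start = ⟦⟧-bounded a w bounded , ⟦⟧-bounded b w bounded
    body : ∀ c {s} → P s → Computes _ (c ∷ X s) (c ∷ X (F s))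
    body c {x , y} p =
      compile-correct (raise 1 η) f (raise-matches η xs ρ match (c ∷ [])) (bounded₂ p) (m⊔n≤o⇒m≤o _ _ h≤₂) then
      compile-correct (raise 2 η) g (raise-matches η xs ρ match (⟦ f ⟧ w (x ∷ y ∷ ρ) ∷ c ∷ [])) (bounded₂ p) (m⊔n≤o⇒m≤o _ _ h≤₃) then
      pop (computes-move zero (suc (suc (suc zero))) (λ ()) d≤₅ (proj₂ (pres p))) then
      pop (computes-move zero (suc (suc (suc zero))) (λ ()) d≤₄ (proj₁ (pres p)))
    finish : ∀ {s} → P s → Computes
      (compile (raise 1 η) u ⨾ move {d = 4 + d} zero (suc (suc (suc zero))) ⨾ clear {d = 3 + d} (suc zero))
      (0 ∷ X s) (⟦ u ⟧ w (proj₁ s ∷ proj₂ s ∷ ρ) ∷ xs)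
    finish {x , y} p =
      compile-correct (raise 1 η) u (raise-matches η xs ρ match (0 ∷ [])) (bounded₂ p) (m⊔n≤o⇒m≤o _ _ h≤₄) then
      pop (computes-move zero (suc (suc (suc zero))) (λ ()) d≤₄ (⟦⟧-bounded u w (bounded₂ p))) then
      pop (pop (λ h → false , h , exec-clear (suc zero) d≤₃))

-- Machines using logarithmic space.

<2^suc-log : ∀ n → n < 2 ^ (1 + ⌊log₂ n ⌋)
<2^suc-log n = ≰⇒> λ le → 1+n≰n
  (subst (_≤ ⌊log₂ n ⌋) (⌊log₂[2^n]⌋≡n (1 + ⌊log₂ n ⌋)) (⌊log₂⌋-mono-≤ le))

suc<2^ : ∀ n → suc n < 2 ^ (2 + ⌊log₂ n ⌋)
suc<2^ n = ≤-trans (s≤s (<2^suc-log n))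
  (≤-trans (+-monoˡ-≤ (2 ^ (1 + ⌊log₂ n ⌋)) (≤-trans (s≤s z≤n) (<2^suc-log n)))
           (≤-reflexive (cong (2 ^ (1 + ⌊log₂ n ⌋) +_) (symm (+-identityʳ _)))))

verdict : Bool → Verdict
verdict true  = accept
verdict false = reject

transition : ∀ {Q A : Set} → (Bool ⊎ Q) × A → Verdict ⊎ (Q × A)
transition (inj₁ b , _) = inj₁ (verdict b)
transition (inj₂ s , a) = inj₂ (s , a)

machine : ∀ {Σ} → Finite Σ → ℕ → Prog Σ → Machine Σ
machine fin T p = record
  { State          = St p
  ; Γ              = Cell
  ; finite-input   = fin
  ; finite-states  = St-finite p
  ; finite-symbols = Cell-finite
  ; blank          = blank
  ; start          = entry p
  ; tapes          = suc T
  ; δ              = λ s a xs → transition (control p s a xs)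
  }

module _ {Σ : Set} (fin : Finite Σ) (T : ℕ) (p : Prog Σ) (w : List Σ) (C : ℕ) where

  open Execution w T C
  private
    M = machine fin T p
    module R = Run M w

  read≡symbolAt : ∀ h → R.read h ≡ symbolAt w h
  read≡symbolAt zero    = refl
  read≡symbolAt (suc h) = refl

  moveInput≡moveHead : ∀ m h → R.moveInput m h ≡ moveHead w m h
  moveInput≡moveHead left  h = refl
  moveInput≡moveHead stay  h = refl
  moveInput≡moveHead right h = refl

  step-perform : ∀ s h ts → R.step (R.config s h ts) ≡
    (let (q , h′ , ts′) = perform p s h ts in
     Sum.map verdict (λ s′ → R.config s′ h′ ts′) q)
  step-perform s h ts rewrite read≡symbolAt h with control p s (symbolAt w h) (Vec.map scanned ts)
  ... | inj₁ b , _        = refl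
  ... | inj₂ s′ , m , acts rewrite moveInput≡moveHead m h = refl

  fits-space : ∀ {k} (ts : Vec (Tape Cell) k) → (∀ j → cells (lookup ts j) ≤ C) →
    Vec.sum (Vec.map cells ts) ≤ k * C
  fits-space []       fit = z≤n
  fits-space (t ∷ ts) fit = +-mono-≤ (fit zero) (fits-space ts (fit ∘ suc))

  runs-halts : ∀ {s h ts b h′ ts′ S} → suc T * C ≤ S → Runs p s h ts b h′ ts′ →
    R._Halts[_]In_ (R.config s h ts) (verdict b) S
  runs-halts {s} {h} {ts} S≤ (stop fit eq) =
    R.halt (≤-trans (fits-space ts fit) S≤)
      (trans (step-perform s h ts)
        (cong (λ (q , h′ , ts′) → Sum.map verdict (λ s′ → R.config s′ h′ ts′) q) eq))
  runs-halts {s} {h} {ts} S≤ (more fit eq run) =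
    R.continue (≤-trans (fits-space ts fit) S≤)
      (trans (step-perform s h ts)
        (cong (λ (q , h′ , ts′) → Sum.map verdict (λ s′ → R.config s′ h′ ts′) q) eq))
      (runs-halts S≤ run)

nonzero : ℕ → Bool
nonzero zero    = false
nonzero (suc _) = true

-- With `n` the input length, `2 + ⌊log₂ n ⌋` digits hold every value up to `n + 1`; the home cell
-- and a possible `gap` make `4 + ⌊log₂ n ⌋` cells on each of the `suc T` tapes, whence the factor
-- `suc T * 4`.
logspace : ∀ {Σ} → Finite Σ → (e : Term Σ 0) {L : Language Σ} →
  (∀ w → nonzero (⟦ e ⟧ w []) ≡ true ⇔ L w) → LOGSPACE L
logspace {Σ} fin e {L} decides = machine fin T p , suc T * 4 , λ w →
  verdict (nonzero (⟦ e ⟧ w [])) , halts w ,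
  mk⇔ (λ eq → Equivalence.to (decides w) (accepted eq))
      (λ l → cong verdict (Equivalence.from (decides w) l))
  where
  T = registers 0 e
  -- Decrementing succeeds exactly on a nonzero value, so its Boolean is the verdict.
  p = compile {d = 0} (λ ()) e ⨾ dec {d = 1} zero

  accepted : ∀ {b} → verdict b ≡ accept → b ≡ true
  accepted {true} _ = refl

  space≤ : ∀ l → suc T * (4 + l) ≤ suc T * 4 * (1 + l)
  space≤ l = ≤-trans (*-monoʳ-≤ (suc T) (+-monoʳ-≤ 4 (m≤n*m l 4)))
    (≤-reflexive (trans (cong (suc T *_) (symm (*-distribˡ-+ 4 1 l))) (symm (*-assoc (suc T) 4 (1 + l)))))

  halts : ∀ w → Run._Halts[_]In_ (machine fin T p) w (Run.initial (machine fin T p) w)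
    (verdict (nonzero (⟦ e ⟧ w []))) (suc T * 4 * (1 + ⌊log₂ length w ⌋))
  halts w =
    let (_ , _ , r)  = compile-correct (λ ()) e {[]} (λ ()) (λ ()) (n≤1+n T) 0
        (_ , r′)     = final (⟦ e ⟧ w [])
        (_ , _ , rs) = run (exec-seq r r′) initially
    in runs-halts fin T p w (2 + l) (space≤ ⌊log₂ length w ⌋) rs
    where
    l = 2 + ⌊log₂ length w ⌋
    open Compilation w T l (suc<2^ (length w))
    open Stack w T l

    final : ∀ v {h} → ∃[ ys ] Exec (dec {d = 1} zero) h (v ∷ []) (nonzero v) h {1} ys
    final zero    = _ , exec-dec-zero zero (s≤s z≤n) refl
    final (suc v) = _ , exec-dec zero (s≤s z≤n) refl

    initially : Holds [] (Vec.replicate (suc T) (tape [] blank []))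
    initially j = subst (Counter l 0) (symm (lookup-replicate j _)) (counter refl none refl)

-- The decision procedure

on : {Σ : Set} → (Σ → Bool) → InputSymbol Σ → Bool
on f ⊢       = false
on f ⊣       = false
on f (sym a) = f a

one? two? digit? x? top? bot? conj? disj? box? bind? jump? binary? atom? name? modal? : Symbol → Bool
one? ‵1 = true
one? _  = false
two? ‵2 = true
two? _  = false
digit? ‵1 = true
digit? ‵2 = true
digit? _  = false
x? ‵x = true
x? _  = false
top? ‵⊤ = true
top? _  = false
bot? ‵⊥ = true
bot? _  = false
conj? ‵∧ = true
conj? _  = false
disj? ‵∨ = true
disj? _  = false
box? ‵□ = true
box? _  = false
bind? ‵↓ = true
bind? _  = false
jump? ‵at = true
jump? _   = false
binary? ‵∧  = true
binary? ‵∨  = true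
binary? ‵↓  = true
binary? ‵at = true
binary? _   = false
atom? ‵x = true
atom? ‵⊤ = true
atom? ‵⊥ = true
atom? _  = false
name? ‵↓  = true
name? ‵at = true
name? _   = false
modal? ‵□  = true
modal? ‵at = true
modal? _   = false

numeral? : Symbol → Bool
numeral? ‵x = true
numeral? ‵1 = true
numeral? ‵2 = true
numeral? _  = false

root? : InputSymbol Symbol → Bool
root? ⊢       = true
root? (sym a) = box? a
root? ⊣       = false

Tm : ℕ → Set
Tm = Term Symbol

v0 : ∀ {k} → Tm (1 + k)
v0 = # zero
v1 : ∀ {k} → Tm (2 + k)
v1 = # suc zero
v2 : ∀ {k} → Tm (3 + k)
v2 = # suc (suc zero)
v3 : ∀ {k} → Tm (4 + k)
v3 = # suc (suc (suc zero))

oneT : ∀ {k} → Tm k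
oneT = up ze

-- Truth values are numbers, with 0 for false. Only position 0 carries ⊢, so `br is⊢` is the zero
-- test. `subT` lowers both components together until one of them is 0.
andT subT eqT : ∀ {k} → Tm k → Tm k → Tm k
andT a b = br is⊢ a ze b
subT a b = iter a b (br is⊢ v1 v0 (down v0)) (br is⊢ v0 v1 (down v1)) v0
eqT a b  = br is⊢ (subT a b) (br is⊢ (subT b a) oneT ze) ze

notT : ∀ {k} → Tm k → Tm k
notT a = br is⊢ a oneT ze

-- searchT c is j + 1 for the largest position j ≤ length w satisfying c, where
-- j is variable 0 of c, and 0 if there is none.
searchT : ∀ {k} → Tm (2 + k) → Tm k
searchT c = iter ze ze (up v0) (br is⊢ c v1 (up v0)) v1

-- Skipping a formula counts the formulas still to be read in variable 1; a binder
-- and @ count their variable as one.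
skipPosition skipCount : ∀ {k} → Tm (2 + k)
skipPosition = br is⊢ v1 (br (on digit?) v0 (up v0) v0) (up v0)
skipCount    = br is⊢ v1 v1 (br (on binary?) v0 (up v1) (br (on atom?) v0 (down v1) v1))

-- When nothing is left to be read, the loop still passes over digits, so the result lies behind the
-- whole numeral of a final variable.
skipT : ∀ {k} → Tm k → Tm k
skipT a = iter a oneT skipPosition skipCount v0

-- Both positions advance only over equal digits. Hence the loop of `sameT` comes to rest with
-- neither of them on a digit exactly if the numerals are equal.
agree : ∀ {k} → Tm (2 + k) → Tm (2 + k)
agree c = br (on one?) v0 (br (on one?) v1 (up c) c)
                          (br (on two?) v0 (br (on two?) v1 (up c) c) c)

sameT : ∀ {k} → Tm k → Tm k → Tm k
sameT a b = iter (up a) (up b) (agree v0) (agree v1)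
                 (br (on digit?) v0 ze (br (on digit?) v1 ze oneT))

-- Position 0 stands for the absence of a binder or of a modal ancestor.
binderT : ∀ {k} → Tm k → Tm k
binderT a = lett a (down (searchT (br (on bind?) v0 (sameT (up v0) v2) ze)))

insideT : ∀ {k} → Tm k → Tm k → Tm k
insideT a b = andT (subT a b) (subT (skipT b) a)

ancestorT : ∀ {k} → Tm k → Tm k
ancestorT a = lett a (down (searchT (br (on modal?) v0 (insideT v2 v0) ze)))

-- The world in which a formula is evaluated is represented by the position of the □
-- that introduced it, or by 0; nextT leads there from the nearest modal ancestor.
nextT : ∀ {k} → Tm k → Tm k
nextT a = lett a (br root? v0 v0 (br (on jump?) v0 (binderT (up v0)) (ancestorT v0)))

pointT : ∀ {k} → Tm k → Tm k
pointT a = iter a ze (nextT v0) ze v0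

-- An unbound variable is covered as well: its binder is given as 0, and the point of 0 is the
-- initial world.
truthT : ∀ {k} → Tm k → Tm k
truthT a = lett a (eqT (pointT v0) (pointT (binderT v0)))

-- Variable 0 is the start of the right argument of ∧ or ∨ and variable 1 is the
-- truth value of the left one, which decides the value of the whole.
cutT : ∀ {k} → Tm (2 + k)
cutT = searchT (br (on conj?) v0 (br is⊢ v3 (eqT (skipT (up v0)) v2) ze)
               (br (on disj?) v0 (br is⊢ v3 ze (eqT (skipT (up v0)) v2)) ze))

-- Variable 1 is the value of the formula completed last. At ↓ and @ only the variable is jumped
-- over: `skipT (up v0)` treats the bare name as an atomic formula.
evalPosition evalValue : ∀ {k} → Tm (2 + k)
evalPosition = br is⊣ v0 v0
  (br is⊢ cutT (br (on atom?) v0 (skipT v0) (br (on name?) v0 (skipT (up v0)) (up v0))) (skipT v0))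
evalValue = br is⊣ v0 v1
  (br is⊢ cutT (br (on top?) v0 oneT (br (on bot?) v0 ze (br (on x?) v0 (truthT v0) v1))) v1)

evalT : Tm 0
evalT = iter oneT ze evalPosition evalValue v1

-- The count in `skipT` notices neither a compound formula in the place of the variable of ↓ or @
-- nor digits that belong to no variable. Both faults show in two adjacent symbols; position 0 is
-- included to catch a leading digit.
misplacedT : Tm 2
misplacedT = br (on name?) v0 (br (on x?) (up v0) ze oneT)
                             (br (on digit?) (up v0) (br (on numeral?) v0 ze oneT) ze)

syntaxT : Tm 0
syntaxT = br is⊢ (searchT misplacedT)
  (iter oneT oneT skipPosition skipCount (br is⊢ v1 (br is⊣ v0 oneT ze) ze)) ze

-- As `binderT` finds the last binder, a variable bound twice is detected at an earlier binder. If
-- all binders are unique, a variable both free and bound is detected at an occurrence outside the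
-- scope of its only binder.
clashT : Tm 2
clashT = br (on bind?) v0 (notT (eqT (binderT (up v0)) v0))
        (br (on x?) v0 (lett (binderT v0) (andT v0 (notT (insideT v1 v0)))) ze)

decideT : Tm 0
decideT = andT syntaxT (andT (notT (searchT clashT)) evalT)

-- Numbers as truth values, and loops that reach a fixed point.

infix 3 _⊩_

_⊩_ : ℕ → Set → Set
v ⊩ Q = 0 < v ⇔ Q

yes⇒ : ∀ {v Q} → v ⊩ Q → 0 < v → Q
yes⇒ = Equivalence.to

⇒yes : ∀ {v Q} → v ⊩ Q → Q → 0 < v
⇒yes = Equivalence.from

⊩-resp : ∀ {v P Q} → (P → Q) → (Q → P) → v ⊩ P → v ⊩ Q
⊩-resp f g p = mk⇔ (f ∘ yes⇒ p) (⇒yes p ∘ g)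

no⇒ : ∀ {v Q} → v ⊩ Q → ¬ Q → v ≡ 0
no⇒ {zero}  r ¬q = refl
no⇒ {suc v} r ¬q = contradiction (yes⇒ r (s≤s z≤n)) ¬q

⊩-yes : ∀ {v Q} → 0 < v → Q → v ⊩ Q
⊩-yes p q = mk⇔ (const q) (const p)

⊩-no : ∀ {Q : Set} → ¬ Q → 0 ⊩ Q
⊩-no ¬q = mk⇔ (λ ()) (⊥-elim ∘ ¬q)

⊩-∸ : ∀ a b → b ∸ a ⊩ a < b
⊩-∸ a b = mk⇔ (λ lt → ≰⇒> λ le → <-irrefl (symm (m≤n⇒m∸n≡0 le)) lt) m<n⇒0<n∸m

iterate-+ : ∀ {A : Set} j k (f : A → A) x → iterate (j + k) f x ≡ iterate k f (iterate j f x)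
iterate-+ zero    k f x = refl
iterate-+ (suc j) k f x = iterate-+ j k f (f x)

iterate-fixed : ∀ {A : Set} {f : A → A} {x} → f x ≡ x → ∀ m → iterate m f x ≡ x
iterate-fixed eq zero    = refl
iterate-fixed eq (suc m) = trans (cong (iterate m _) eq) (iterate-fixed eq m)

-- The budget bounds the number of steps by the distance that the first component
-- covers, so that length w + 1 iterations always suffice.
record Reaches (f : ℕ × ℕ → ℕ × ℕ) (s t : ℕ × ℕ) : Set where
  constructor reaches
  field
    steps  : ℕ
    budget : proj₁ s + steps ≤ proj₁ t
    meets  : iterate steps f s ≡ t

reach-refl : ∀ {f s} → Reaches f s s
reach-refl {s = p , _} = reaches 0 (≤-reflexive (+-identityʳ p)) refl

reach-step : ∀ {f s t u} → f s ≡ t → proj₁ s < proj₁ t → Reaches f t u → Reaches f s u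
reach-step {s = p , _} refl lt (reaches k le eq) =
  reaches (suc k) (≤-trans (≤-reflexive (+-suc p k)) (≤-trans (+-monoˡ-≤ k lt) le)) eq

reach-trans : ∀ {f s t u} → Reaches f s t → Reaches f t u → Reaches f s u
reach-trans {f} {s} (reaches j le eq) (reaches k le′ eq′) =
  reaches (j + k) (≤-trans (≤-reflexive (symm (+-assoc (proj₁ s) j k))) (≤-trans (+-monoˡ-≤ k le) le′))
    (trans (iterate-+ j k f s) (trans (cong (iterate k f) eq) eq′))

reach-iterate : ∀ {f s t} → Reaches f s t → f t ≡ t → ∀ m → proj₁ t ≤ proj₁ s + m → iterate m f s ≡ t
reach-iterate {f} {s} {t} (reaches k le eq) fixed m bound =
  trans (cong (λ l → iterate l f s) (symm (m+[n∸m]≡n k≤m)))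
    (trans (iterate-+ k (m ∸ k) f s)
      (trans (cong (iterate (m ∸ k) f) eq) (iterate-fixed fixed (m ∸ k))))
  where
  k≤m : k ≤ m
  k≤m = +-cancelˡ-≤ (proj₁ s) k m (≤-trans le bound)

-- Values of the arithmetic and search terms.

module Values (w : List Symbol) where

  n : ℕ
  n = length w

  at : ℕ → InputSymbol Symbol
  at = symbolAt w

  ⊢-pos : ∀ {A : Set} {v} {a b : A} → 0 < v → (if is⊢ (at v) then a else b) ≡ b
  ⊢-pos {v = suc v} _ = cong (if_then _ else _) (symbolAt-pos w v)

  ⊣-before : ∀ {A : Set} {v} {a b : A} → v ≤ n → (if is⊣ (at v) then a else b) ≡ b
  ⊣-before le = cong (if_then _ else _) (symbolAt-end w le)

  up≡suc : ∀ {v} → v ≤ n → moveHead w right v ≡ suc v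
  up≡suc = moveHead-right w

  bounded⇒ : ∀ {v a} → at v ≡ sym a → 0 < v × v ≤ n
  bounded⇒ {zero}  ()
  bounded⇒ {suc v} eq = s≤s z≤n , go w v eq
    where
    go : ∀ (u : List Symbol) v {a} → nth u v ≡ sym a → suc v ≤ length u
    go (_ ∷ _) zero    eq = s≤s z≤n
    go (_ ∷ u) (suc v) eq = s≤s (go u v eq)

  ⊩-and : ∀ {a b P Q} → a ⊩ P → b ⊩ Q → (if is⊢ (at a) then 0 else b) ⊩ (P × Q)
  ⊩-and {zero}  {b} p q = ⊩-no λ (x , _) → contradiction (⇒yes p x) λ ()
  ⊩-and {suc a} {b} p q rewrite symbolAt-pos w a =
    ⊩-resp (yes⇒ p (s≤s z≤n) ,_) proj₂ q

  ⊩-not : ∀ {a P} → a ⊩ P → (if is⊢ (at a) then 1 else 0) ⊩ (¬ P)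
  ⊩-not {zero}  p = ⊩-yes (s≤s z≤n) λ x → contradiction (⇒yes p x) λ ()
  ⊩-not {suc a} p rewrite symbolAt-pos w a = ⊩-no λ ¬x → ¬x (yes⇒ p (s≤s z≤n))

  ⟦sub⟧ : ∀ {k} (a b : Tm k) {ρ} → ⟦ a ⟧ w ρ ≤ suc n → ⟦ subT a b ⟧ w ρ ≡ ⟦ a ⟧ w ρ ∸ ⟦ b ⟧ w ρ
  ⟦sub⟧ a b {ρ} le = cong proj₁ (go (suc n) _ _ le)
    where
    F : ℕ × ℕ → ℕ × ℕ
    F = both (λ x y → if is⊢ (at y) then x else pred x) (λ x y → if is⊢ (at x) then y else pred y)
    go : ∀ m x y → x ≤ m → iterate m F (x , y) ≡ (x ∸ y , y ∸ x)
    go zero    zero    zero    z≤n = refl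
    go zero    zero    (suc y) z≤n = refl
    go (suc m) zero    zero    le = go m zero zero z≤n
    go (suc m) zero    (suc y) le rewrite symbolAt-pos w y = go m zero (suc y) z≤n
    go (suc m) (suc x) zero    le = iterate-fixed (cong (suc x ,_) (⊢-pos {v = suc x} {a = 0} {b = 0} (s≤s z≤n))) (suc m)
    go (suc m) (suc x) (suc y) (s≤s le)
      rewrite symbolAt-pos w x | symbolAt-pos w y = go m x y le

  num : Bool → ℕ
  num b = if b then 1 else 0

  ⟦eq⟧ : ∀ {k} (a b : Tm k) {ρ} → ⟦ a ⟧ w ρ ≤ suc n → ⟦ b ⟧ w ρ ≤ suc n →
    ⟦ eqT a b ⟧ w ρ ≡ num (does (⟦ a ⟧ w ρ ≟ ⟦ b ⟧ w ρ))
  ⟦eq⟧ a b {ρ} a≤ b≤ rewrite ⟦sub⟧ a b {ρ} a≤ | ⟦sub⟧ b a {ρ} b≤ =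
    go (⟦ a ⟧ w ρ) (⟦ b ⟧ w ρ) (⟦ a ⟧ w ρ ≟ ⟦ b ⟧ w ρ)
    where
    go : ∀ x y (d : Dec (x ≡ y)) →
      (if is⊢ (at (x ∸ y)) then (if is⊢ (at (y ∸ x)) then 1 else 0) else 0) ≡ num (does d)
    go x y (yes refl) rewrite n∸n≡0 x = refl
    go x y (no x≢y) with <-cmp x y
    ... | tri< lt _ _ rewrite m≤n⇒m∸n≡0 (<⇒≤ lt) = ⊢-pos (m<n⇒0<n∸m lt)
    ... | tri≈ _ eq _ = contradiction eq x≢y
    ... | tri> _ _ gt = ⊢-pos (m<n⇒0<n∸m gt)

  num-⊩ : ∀ {P : Set} (d : Dec P) → num (does d) ⊩ P
  num-⊩ (yes p) = ⊩-yes (s≤s z≤n) p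
  num-⊩ (no ¬p) = ⊩-no ¬p

  data Largest (Q : ℕ → Set) : ℕ → Set where
    absent : (∀ j → j ≤ n → ¬ Q j) → Largest Q 0
    found  : ∀ {j} → j ≤ n → Q j → (∀ i → i ≤ n → Q i → i ≤ j) → Largest Q (suc j)

  search : ∀ {k} (c : Tm (2 + k)) {ρ} {Q : ℕ → Set} →
    (∀ j r → j ≤ n → ⟦ c ⟧ w (j ∷ r ∷ ρ) ⊩ Q j) → Largest Q (⟦ searchT c ⟧ w ρ)
  search c {ρ} {Q} decides = finish (go (suc n) 0 0 refl (λ j ()))
    where
    F : ℕ × ℕ → ℕ × ℕ
    F = both (λ j r → moveHead w right j)
             (λ j r → if is⊢ (at (⟦ c ⟧ w (j ∷ r ∷ ρ))) then r else moveHead w right j)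

    -- The loop invariant: `Largest` restricted to the positions examined so far.
    Below : ℕ → ℕ → Set
    Below m zero    = ∀ j → j < m → ¬ Q j
    Below m (suc r) = r < m × Q r × (∀ j → j < m → Q j → j ≤ r)

    extend : ∀ j r → j ≤ n → Below j r → Below (suc j) (proj₂ (F (j , r)))
    extend j r j≤ below with ⟦ c ⟧ w (j ∷ r ∷ ρ) | decides j r j≤
    extend j zero j≤ below | zero | p = λ i lt q → case-≤ i (m<1+n⇒m<n∨m≡n lt) q
      where
      case-≤ : ∀ i → i < j ⊎ i ≡ j → ¬ Q i
      case-≤ i (inj₁ lt)   = below i lt
      case-≤ i (inj₂ refl) = λ q → contradiction (⇒yes p q) λ ()
    extend j (suc r) j≤ (lt , q , max) | zero | p = m<n⇒m<1+n lt , q , λ i i< qi → case-≤ i (m<1+n⇒m<n∨m≡n i<) qi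
      where
      case-≤ : ∀ i → i < j ⊎ i ≡ j → Q i → i ≤ r
      case-≤ i (inj₁ lt)   = max i lt
      case-≤ i (inj₂ refl) = λ q → contradiction (⇒yes p q) λ ()
    extend j r j≤ below | suc v | p =
      subst (Below (suc j)) (symm (trans (⊢-pos {v = suc v} (s≤s z≤n)) (up≡suc j≤)))
        (≤-refl , yes⇒ p (s≤s z≤n) , λ i lt _ → ≤-pred lt)

    go : ∀ m j r → j + m ≡ suc n → Below j r → Below (suc n) (proj₂ (iterate m F (j , r)))
    go zero    j r eq below rewrite trans (symm (+-identityʳ j)) eq = below
    go (suc m) j r eq below =
      subst (λ j′ → Below (suc n) (proj₂ (iterate m F (j′ , proj₂ (F (j , r)))))) (symm (up≡suc j≤))
        (go m (suc j) _ (trans (symm (+-suc j m)) eq) (extend j r j≤ below))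
      where
      j≤ : j ≤ n
      j≤ = ≤-pred (≤-trans (s≤s (m≤m+n j m)) (≤-reflexive (trans (symm (+-suc j m)) eq)))

    finish : ∀ {r} → Below (suc n) r → Largest Q r
    finish {zero}  missing          = absent λ j le → missing j (s≤s le)
    finish {suc r} (s≤s le , q , max) = found le q λ i le′ → max i (s≤s le′)

-- Subformula occurrences, given by their positions

digitsEnd : ℕ → ℕᵇ → ℕ
digitsEnd p ℕᵇ.zero  = p
digitsEnd p 2[1+ b ] = digitsEnd (suc p) b
digitsEnd p 1+[2 b ] = digitsEnd (suc p) b

nameEnd : ℕ → SVAR → ℕ
nameEnd p x = digitsEnd (suc p) (fromℕ x)

-- The position after φ when φ starts at p.
end : ℕ → Formula → ℕ
end p (var x)     = nameEnd p x
end p top         = suc p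
end p bot         = suc p
end p (φ ∧ ψ)     = end (end (suc p) φ) ψ
end p (φ ∨ ψ)     = end (end (suc p) φ) ψ
end p (□ φ)       = end (suc p) φ
end p (↓[ x ] φ)  = end (nameEnd (suc p) x) φ
end p (at[ x ] φ) = end (nameEnd (suc p) x) φ

≤-digitsEnd : ∀ p b → p ≤ digitsEnd p b
≤-digitsEnd p ℕᵇ.zero  = ≤-refl
≤-digitsEnd p 2[1+ b ] = <⇒≤ (≤-digitsEnd (suc p) b)
≤-digitsEnd p 1+[2 b ] = <⇒≤ (≤-digitsEnd (suc p) b)

<-nameEnd : ∀ p x → p < nameEnd p x
<-nameEnd p x = ≤-digitsEnd (suc p) (fromℕ x)

<-end : ∀ p φ → p < end p φ
<-end p (var x)     = <-nameEnd p x
<-end p top         = ≤-refl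
<-end p bot         = ≤-refl
<-end p (φ ∧ ψ)     = <-trans (<-trans ≤-refl (<-end (suc p) φ)) (<-end _ ψ)
<-end p (φ ∨ ψ)     = <-trans (<-trans ≤-refl (<-end (suc p) φ)) (<-end _ ψ)
<-end p (□ φ)       = <-trans ≤-refl (<-end (suc p) φ)
<-end p (↓[ x ] φ)  = <-trans (<-trans ≤-refl (<-nameEnd (suc p) x)) (<-end _ φ)
<-end p (at[ x ] φ) = <-trans (<-trans ≤-refl (<-nameEnd (suc p) x)) (<-end _ φ)

data Child (p : ℕ) : Formula → ℕ → Formula → Set where
  ∧ˡ : ∀ {φ ψ} → Child p (φ ∧ ψ) (suc p) φ
  ∧ʳ : ∀ {φ ψ} → Child p (φ ∧ ψ) (end (suc p) φ) ψ
  ∨ˡ : ∀ {φ ψ} → Child p (φ ∨ ψ) (suc p) φ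
  ∨ʳ : ∀ {φ ψ} → Child p (φ ∨ ψ) (end (suc p) φ) ψ
  □₁ : ∀ {φ} → Child p (□ φ) (suc p) φ
  ↓₁ : ∀ {x φ} → Child p (↓[ x ] φ) (nameEnd (suc p) x) φ
  at₁ : ∀ {x φ} → Child p (at[ x ] φ) (nameEnd (suc p) x) φ

-- Node p φ q χ: if φ starts at p, then χ is a subformula of it that starts at q.
data Node (p : ℕ) (φ : Formula) : ℕ → Formula → Set where
  here : Node p φ p φ
  step : ∀ {p′ φ′ q χ} → Child p φ p′ φ′ → Node p′ φ′ q χ → Node p φ q χ

child-< : ∀ {p φ q χ} → Child p φ q χ → p < q
child-< ∧ˡ         = ≤-refl
child-< {p} (∧ʳ {φ}) = <-trans ≤-refl (<-end (suc p) φ)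
child-< ∨ˡ         = ≤-refl
child-< {p} (∨ʳ {φ}) = <-trans ≤-refl (<-end (suc p) φ)
child-< □₁         = ≤-refl
child-< {p} (↓₁ {x}) = <-trans ≤-refl (<-nameEnd (suc p) x)
child-< {p} (at₁ {x}) = <-trans ≤-refl (<-nameEnd (suc p) x)

child-end : ∀ {p φ q χ} → Child p φ q χ → end q χ ≤ end p φ
child-end (∧ˡ {φ} {ψ}) = <⇒≤ (<-end _ ψ)
child-end ∧ʳ           = ≤-refl
child-end (∨ˡ {φ} {ψ}) = <⇒≤ (<-end _ ψ)
child-end ∨ʳ           = ≤-refl
child-end □₁           = ≤-refl
child-end ↓₁           = ≤-refl
child-end at₁           = ≤-refl

node-≤ : ∀ {p φ q χ} → Node p φ q χ → p ≤ q
node-≤ here       = ≤-refl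
node-≤ (step c m) = ≤-trans (<⇒≤ (child-< c)) (node-≤ m)

node-end : ∀ {p φ q χ} → Node p φ q χ → end q χ ≤ end p φ
node-end here       = ≤-refl
node-end (step c m) = ≤-trans (node-end m) (child-end c)

node-trans : ∀ {p φ q χ r ψ} → Node p φ q χ → Node q χ r ψ → Node p φ r ψ
node-trans here       m′ = m′
node-trans (step c m) m′ = step c (node-trans m m′)

node-child : ∀ {p φ q χ r ψ} → Node p φ q χ → Child q χ r ψ → Node p φ r ψ
node-child m c = node-trans m (step c here)

data Siblings (p : ℕ) (φ : Formula) (q : ℕ) (χ : Formula) : Set where
  same   : p ≡ q → φ ≡ χ → Siblings p φ q χ
  precedes : end p φ ≤ q → Siblings p φ q χ
  follows  : end q χ ≤ p → Siblings p φ q χ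

siblings : ∀ {p φ q χ r ψ} → Child p φ q χ → Child p φ r ψ → Siblings q χ r ψ
siblings ∧ˡ ∧ˡ = same refl refl
siblings ∧ˡ ∧ʳ = precedes ≤-refl
siblings ∧ʳ ∧ˡ = follows ≤-refl
siblings ∧ʳ ∧ʳ = same refl refl
siblings ∨ˡ ∨ˡ = same refl refl
siblings ∨ˡ ∨ʳ = precedes ≤-refl
siblings ∨ʳ ∨ˡ = follows ≤-refl
siblings ∨ʳ ∨ʳ = same refl refl
siblings □₁ □₁ = same refl refl
siblings ↓₁ ↓₁ = same refl refl
siblings at₁ at₁ = same refl refl

data Laminar (p : ℕ) (φ : Formula) (q : ℕ) (χ : Formula) : Set where
  above  : Node p φ q χ → Laminar p φ q χ
  below  : Node q χ p φ → Laminar p φ q χ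
  precedes : end p φ ≤ q → Laminar p φ q χ
  follows  : end q χ ≤ p → Laminar p φ q χ

-- Two paths from the root share an initial part; then either one of them ends, or they part into
-- two siblings, whose spans are disjoint by `siblings`.
laminar : ∀ {r ψ p φ q χ} → Node r ψ p φ → Node r ψ q χ → Laminar p φ q χ
laminar here       m         = above m
laminar m          here      = below m
laminar (step c m) (step c′ m′) with siblings c c′
... | same refl refl = laminar m m′
... | precedes le      = precedes (≤-trans (node-end m) (≤-trans le (node-≤ m′)))
... | follows le       = follows (≤-trans (node-end m′) (≤-trans le (node-≤ m)))

-- By `laminar`: a proper subformula starts strictly later, and no span is empty.
node-unique : ∀ {r ψ p φ χ} → Node r ψ p φ → Node r ψ p χ → φ ≡ χ
node-unique {p = p} {φ} {χ} m m′ with laminar m m′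
... | above here       = refl
... | above (step c l) = contradiction (≤-trans (child-< c) (node-≤ l)) 1+n≰n
... | below here       = refl
... | below (step c l) = contradiction (≤-trans (child-< c) (node-≤ l)) 1+n≰n
... | precedes le        = contradiction (≤-trans (<-end p φ) le) 1+n≰n
... | follows le         = contradiction (≤-trans (<-end p χ) le) 1+n≰n

data Named : Formula → SVAR → Set where
  ↓ₙ : ∀ {x φ} → Named (↓[ x ] φ) x
  atₙ : ∀ {x φ} → Named (at[ x ] φ) x

Binder : ℕ → Formula → ℕ → SVAR → Set
Binder p φ q x = ∃[ ψ ] Node p φ q (↓[ x ] ψ)

Once : ℕ → Formula → Set
Once p φ = ∀ {q q′ x} → Binder p φ q x → Binder p φ q′ x → q ≡ q′

head : Formula → Symbol
head (var x)     = ‵x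
head top         = ‵⊤
head bot         = ‵⊥
head (φ ∧ ψ)     = ‵∧
head (φ ∨ ψ)     = ‵∨
head (□ φ)       = ‵□
head (↓[ x ] φ)  = ‵↓
head (at[ x ] φ) = ‵at

head-nondigit : ∀ φ → digit? (head φ) ≡ false
head-nondigit (var x)     = refl
head-nondigit top         = refl
head-nondigit bot         = refl
head-nondigit (φ ∧ ψ)     = refl
head-nondigit (φ ∨ ψ)     = refl
head-nondigit (□ φ)       = refl
head-nondigit (↓[ x ] φ)  = refl
head-nondigit (at[ x ] φ) = refl

-- Encoded formulas in the input: skipping and comparison of names.

module Reading (w : List Symbol) where

  open Values w public

  -- Numerals have no closing delimiter; they extend as far as digits follow. So an encoding is
  -- delimited only together with the fact that no further digit comes next.
  Sep : ℕ → Set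
  Sep p = on digit? (at p) ≡ false

  Digits : ℕ → ℕᵇ → Set
  Digits p ℕᵇ.zero  = Sep p
  Digits p 2[1+ b ] = at p ≡ sym ‵2 × Digits (suc p) b
  Digits p 1+[2 b ] = at p ≡ sym ‵1 × Digits (suc p) b

  Name : ℕ → SVAR → Set
  Name p x = at p ≡ sym ‵x × Digits (suc p) (fromℕ x)

  -- The encoding of φ starts at p and is not followed by a digit.
  Enc : ℕ → Formula → Set
  Enc p (var x)     = Name p x
  Enc p top         = at p ≡ sym ‵⊤ × Sep (suc p)
  Enc p bot         = at p ≡ sym ‵⊥ × Sep (suc p)
  Enc p (φ ∧ ψ)     = at p ≡ sym ‵∧ × Enc (suc p) φ × Enc (end (suc p) φ) ψ
  Enc p (φ ∨ ψ)     = at p ≡ sym ‵∨ × Enc (suc p) φ × Enc (end (suc p) φ) ψ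
  Enc p (□ φ)       = at p ≡ sym ‵□ × Enc (suc p) φ
  Enc p (↓[ x ] φ)  = at p ≡ sym ‵↓ × Name (suc p) x × Enc (nameEnd (suc p) x) φ
  Enc p (at[ x ] φ) = at p ≡ sym ‵at × Name (suc p) x × Enc (nameEnd (suc p) x) φ

  enc-head : ∀ {p} φ → Enc p φ → at p ≡ sym (head φ)
  enc-head (var x)     e = proj₁ e
  enc-head top         e = proj₁ e
  enc-head bot         e = proj₁ e
  enc-head (φ ∧ ψ)     e = proj₁ e
  enc-head (φ ∨ ψ)     e = proj₁ e
  enc-head (□ φ)       e = proj₁ e
  enc-head (↓[ x ] φ)  e = proj₁ e
  enc-head (at[ x ] φ) e = proj₁ e

  digits-sep : ∀ {p} b → Digits p b → Sep (digitsEnd p b)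
  digits-sep ℕᵇ.zero  s       = s
  digits-sep 2[1+ b ] (_ , d) = digits-sep b d
  digits-sep 1+[2 b ] (_ , d) = digits-sep b d

  enc-sep : ∀ {p} φ → Enc p φ → Sep (end p φ)
  enc-sep (var x)     (_ , d)     = digits-sep (fromℕ x) d
  enc-sep top         (_ , s)     = s
  enc-sep bot         (_ , s)     = s
  enc-sep (φ ∧ ψ)     (_ , _ , e) = enc-sep ψ e
  enc-sep (φ ∨ ψ)     (_ , _ , e) = enc-sep ψ e
  enc-sep (□ φ)       (_ , e)     = enc-sep φ e
  enc-sep (↓[ x ] φ)  (_ , _ , e) = enc-sep φ e
  enc-sep (at[ x ] φ) (_ , _ , e) = enc-sep φ e

  at-≤ : ∀ {p a} → at p ≡ sym a → p ≤ n
  at-≤ eq = proj₂ (bounded⇒ eq)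

  digits-bound : ∀ {p} b → p ≤ suc n → Digits p b → digitsEnd p b ≤ suc n
  digits-bound ℕᵇ.zero  le _        = le
  digits-bound 2[1+ b ] le (eq , d) = digits-bound b (s≤s (at-≤ eq)) d
  digits-bound 1+[2 b ] le (eq , d) = digits-bound b (s≤s (at-≤ eq)) d

  enc-bound : ∀ {p} φ → Enc p φ → end p φ ≤ suc n
  enc-bound (var x)     (eq , d)    = digits-bound (fromℕ x) (s≤s (at-≤ eq)) d
  enc-bound top         (eq , _)    = s≤s (at-≤ eq)
  enc-bound bot         (eq , _)    = s≤s (at-≤ eq)
  enc-bound (φ ∧ ψ)     (_ , _ , e) = enc-bound ψ e
  enc-bound (φ ∨ ψ)     (_ , _ , e) = enc-bound ψ e
  enc-bound (□ φ)       (_ , e)     = enc-bound φ e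
  enc-bound (↓[ x ] φ)  (_ , _ , e) = enc-bound φ e
  enc-bound (at[ x ] φ) (_ , _ , e) = enc-bound φ e

  enc-child : ∀ {p φ q χ} → Child p φ q χ → Enc p φ → Enc q χ
  enc-child ∧ˡ (_ , e , _) = e
  enc-child ∧ʳ (_ , _ , e) = e
  enc-child ∨ˡ (_ , e , _) = e
  enc-child ∨ʳ (_ , _ , e) = e
  enc-child □₁ (_ , e)     = e
  enc-child ↓₁ (_ , _ , e) = e
  enc-child at₁ (_ , _ , e) = e

  enc-node : ∀ {p φ q χ} → Node p φ q χ → Enc p φ → Enc q χ
  enc-node here       e = e
  enc-node (step c m) e = enc-node m (enc-child c e)

  enc-named : ∀ {p φ x} → Named φ x → Enc p φ → Name (suc p) x
  enc-named ↓ₙ (_ , d , _) = d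
  enc-named atₙ (_ , d , _) = d

  data Located (p : ℕ) (φ : Formula) (q : ℕ) : Set where
    node  : ∀ {χ} → Node p φ q χ → Located p φ q
    name  : ∀ {r χ x} → Node p φ r χ → Named χ x → q ≡ suc r → Located p φ q
    digit : on digit? (at q) ≡ true → Located p φ q

  descend : ∀ {p φ p′ φ′ q} → Child p φ p′ φ′ → Located p′ φ′ q → Located p φ q
  descend c (node m)        = node (step c m)
  descend c (name m nm eq)  = name (step c m) nm eq
  descend c (digit eq)      = digit eq

  locate-digits : ∀ {p} b → Digits p b → ∀ {q} → p ≤ q → q < digitsEnd p b → on digit? (at q) ≡ true
  locate-digits ℕᵇ.zero _ le lt = contradiction (≤-trans lt le) 1+n≰n
  locate-digits 2[1+ b ] (eq , d) le lt with m≤n⇒m<n∨m≡n le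
  ... | inj₁ lt′  = locate-digits b d lt′ lt
  ... | inj₂ refl = cong (on digit?) eq
  locate-digits 1+[2 b ] (eq , d) le lt with m≤n⇒m<n∨m≡n le
  ... | inj₁ lt′  = locate-digits b d lt′ lt
  ... | inj₂ refl = cong (on digit?) eq

  locate-name : ∀ {p φ x} → Named φ x → Name (suc p) x → ∀ {q} → p < q → q < nameEnd (suc p) x → Located p φ q
  locate-name {x = x} nm (_ , d) lt lt′ with m≤n⇒m<n∨m≡n lt
  ... | inj₁ lt″  = digit (locate-digits (fromℕ x) d lt″ lt′)
  ... | inj₂ refl = name here nm refl

  -- This leads back from a symbol, which is all that a search can test, to the subformula
  -- occurrence responsible for it.
  locate : ∀ {p} φ → Enc p φ → ∀ {q} → p ≤ q → q < end p φ → Located p φ q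
  locate φ e {q} le lt with m≤n⇒m<n∨m≡n le
  locate φ e le lt | inj₂ refl = node here
  locate (var x) (_ , d) le lt | inj₁ lt′ = digit (locate-digits (fromℕ x) d lt′ lt)
  locate top e le lt | inj₁ lt′ = contradiction (≤-trans lt lt′) 1+n≰n
  locate bot e le lt | inj₁ lt′ = contradiction (≤-trans lt lt′) 1+n≰n
  locate {p} (φ ∧ ψ) (_ , e , e′) {q} le lt | inj₁ lt′ with q <? end (suc p) φ
  ... | yes lt″ = descend ∧ˡ (locate φ e lt′ lt″)
  ... | no ¬lt  = descend ∧ʳ (locate ψ e′ (≮⇒≥ ¬lt) lt)
  locate {p} (φ ∨ ψ) (_ , e , e′) {q} le lt | inj₁ lt′ with q <? end (suc p) φ
  ... | yes lt″ = descend ∨ˡ (locate φ e lt′ lt″)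
  ... | no ¬lt  = descend ∨ʳ (locate ψ e′ (≮⇒≥ ¬lt) lt)
  locate (□ φ) (_ , e) le lt | inj₁ lt′ = descend □₁ (locate φ e lt′ lt)
  locate {p} (↓[ x ] φ) (_ , d , e) {q} le lt | inj₁ lt′ with q <? nameEnd (suc p) x
  ... | yes lt″ = locate-name ↓ₙ d lt′ lt″
  ... | no ¬lt  = descend ↓₁ (locate φ e (≮⇒≥ ¬lt) lt)
  locate {p} (at[ x ] φ) (_ , d , e) {q} le lt | inj₁ lt′ with q <? nameEnd (suc p) x
  ... | yes lt″ = locate-name atₙ d lt′ lt″
  ... | no ¬lt  = descend at₁ (locate φ e (≮⇒≥ ¬lt) lt)

  skipStep : ℕ × ℕ → ℕ × ℕ
  skipStep = both (λ x y → ⟦ skipPosition ⟧ w (x ∷ y ∷ [])) (λ x y → ⟦ skipCount ⟧ w (x ∷ y ∷ []))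

  -- Opaque, so that later goals mention `skip` as such and never unfold the iteration.
  abstract
    skip : ℕ → ℕ
    skip p = proj₁ (iterate (suc n) skipStep (p , 1))

    skip-def : ∀ p → skip p ≡ proj₁ (iterate (suc n) skipStep (p , 1))
    skip-def p = refl

    ⟦skip⟧ : ∀ {k} (a : Tm k) {ρ} → ⟦ skipT a ⟧ w ρ ≡ skip (⟦ a ⟧ w ρ)
    ⟦skip⟧ a = refl

  skip-digit : ∀ {p a} d → at p ≡ sym a → digit? a ≡ true → binary? a ≡ false → atom? a ≡ false →
    skipStep (p , d) ≡ (suc p , d)
  skip-digit {p} zero    eq eq₁ eq₂ eq₃ rewrite eq | eq₁ = cong (_, 0) (up≡suc (at-≤ eq))
  skip-digit {p} (suc d) eq eq₁ eq₂ eq₃ rewrite symbolAt-pos w d | eq | eq₂ | eq₃ =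
    cong (_, suc d) (up≡suc (at-≤ eq))

  skip-binary : ∀ {p a} d → at p ≡ sym a → binary? a ≡ true → suc d ≤ p →
    skipStep (p , suc d) ≡ (suc p , suc (suc d))
  skip-binary {p} d eq eq₁ le rewrite symbolAt-pos w d | eq | eq₁ =
    cong₂ _,_ (up≡suc (at-≤ eq)) (up≡suc (≤-trans le (at-≤ eq)))

  skip-atom : ∀ {p a} d → at p ≡ sym a → binary? a ≡ false → atom? a ≡ true →
    skipStep (p , suc d) ≡ (suc p , d)
  skip-atom {p} d eq eq₁ eq₂ rewrite symbolAt-pos w d | eq | eq₁ | eq₂ = cong (_, d) (up≡suc (at-≤ eq))

  skip-box : ∀ {p a} d → at p ≡ sym a → binary? a ≡ false → atom? a ≡ false →
    skipStep (p , suc d) ≡ (suc p , suc d)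
  skip-box {p} d eq eq₁ eq₂ rewrite symbolAt-pos w d | eq | eq₁ | eq₂ = cong (_, suc d) (up≡suc (at-≤ eq))

  skip-digits : ∀ {p} b d → Digits p b → Reaches skipStep (p , d) (digitsEnd p b , d)
  skip-digits ℕᵇ.zero  d _         = reach-refl
  skip-digits 2[1+ b ] d (eq , ds) = reach-step (skip-digit d eq refl refl refl) ≤-refl (skip-digits b d ds)
  skip-digits 1+[2 b ] d (eq , ds) = reach-step (skip-digit d eq refl refl refl) ≤-refl (skip-digits b d ds)

  skip-name : ∀ {p} x d → Name p x → Reaches skipStep (p , suc d) (nameEnd p x , d)
  skip-name x d (eq , ds) = reach-step (skip-atom d eq refl refl) ≤-refl (skip-digits (fromℕ x) d ds)

  -- The count must not saturate. The hypothesis `suc d ≤ p` guarantees this and is preserved,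
  -- because the count grows by at most one for each symbol read.
  skip-formula : ∀ {p} φ d → suc d ≤ p → Enc p φ → Reaches skipStep (p , suc d) (end p φ , d)
  skip-formula (var x) d le e = skip-name x d e
  skip-formula top d le (eq , _) = reach-step (skip-atom d eq refl refl) ≤-refl reach-refl
  skip-formula bot d le (eq , _) = reach-step (skip-atom d eq refl refl) ≤-refl reach-refl
  skip-formula {p} (φ ∧ ψ) d le (eq , e , e′) = reach-step (skip-binary d eq refl le) ≤-refl
    (reach-trans (skip-formula φ (suc d) (s≤s le) e)
                 (skip-formula ψ d (≤-trans le (<⇒≤ (child-< {φ = φ ∧ ψ} ∧ʳ))) e′))
  skip-formula {p} (φ ∨ ψ) d le (eq , e , e′) = reach-step (skip-binary d eq refl le) ≤-refl
    (reach-trans (skip-formula φ (suc d) (s≤s le) e)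
                 (skip-formula ψ d (≤-trans le (<⇒≤ (child-< {φ = φ ∨ ψ} ∨ʳ))) e′))
  skip-formula (□ φ) d le (eq , e) =
    reach-step (skip-box d eq refl refl) ≤-refl (skip-formula φ d (m≤n⇒m≤1+n le) e)
  skip-formula {p} (↓[ x ] φ) d le (eq , ds , e) = reach-step (skip-binary d eq refl le) ≤-refl
    (reach-trans (skip-name x (suc d) ds)
                 (skip-formula φ d (≤-trans le (<⇒≤ (child-< {φ = ↓[ x ] φ} ↓₁))) e))
  skip-formula {p} (at[ x ] φ) d le (eq , ds , e) = reach-step (skip-binary d eq refl le) ≤-refl
    (reach-trans (skip-name x (suc d) ds)
                 (skip-formula φ d (≤-trans le (<⇒≤ (child-< {φ = at[ x ] φ} at₁))) e))

  skip-fixed : ∀ {p} → Sep p → skipStep (p , 0) ≡ (p , 0)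
  skip-fixed {p} s rewrite s = refl

  skip-run : ∀ {p} φ → Enc p φ → iterate (suc n) skipStep (p , 1) ≡ (end p φ , 0)
  skip-run {p} φ e = reach-iterate (skip-formula φ 0 (proj₁ (bounded⇒ (enc-head φ e))) e)
    (skip-fixed (enc-sep φ e)) (suc n) (≤-trans (enc-bound φ e) (m≤n+m (suc n) p))

  skip-end : ∀ {p} φ → Enc p φ → skip p ≡ end p φ
  skip-end {p} φ e = trans (skip-def p) (cong proj₁ (skip-run φ e))

  sep-one : ∀ {p} → Sep p → on one? (at p) ≡ false × on two? (at p) ≡ false
  sep-one {p} s with at p
  ... | ⊢      = refl , refl
  ... | ⊣      = refl , refl
  ... | sym a = go a s
    where
    go : ∀ a → digit? a ≡ false → one? a ≡ false × two? a ≡ false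
    go ‵x  _ = refl , refl
    go ‵⊤  _ = refl , refl
    go ‵⊥  _ = refl , refl
    go ‵∧  _ = refl , refl
    go ‵∨  _ = refl , refl
    go ‵□  _ = refl , refl
    go ‵↓  _ = refl , refl
    go ‵at _ = refl , refl

  sameStep : ℕ × ℕ → ℕ × ℕ
  sameStep = both (λ x y → ⟦ agree v0 ⟧ w (x ∷ y ∷ [])) (λ x y → ⟦ agree v1 ⟧ w (x ∷ y ∷ []))

  bothEnd : ℕ × ℕ → ℕ
  bothEnd (i , j) = if on digit? (at i) then 0 else (if on digit? (at j) then 0 else 1)

  abstract
    sameName : ℕ → ℕ → ℕ
    sameName p q = bothEnd (iterate (suc n) sameStep (moveHead w right p , moveHead w right q))

    sameName-def : ∀ p q →
      sameName p q ≡ bothEnd (iterate (suc n) sameStep (moveHead w right p , moveHead w right q))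
    sameName-def p q = refl

    ⟦same⟧ : ∀ {k} (a b : Tm k) {ρ} → ⟦ sameT a b ⟧ w ρ ≡ sameName (⟦ a ⟧ w ρ) (⟦ b ⟧ w ρ)
    ⟦same⟧ a b = refl

  -- The comparison rests at the first disagreement, where at least one position is on a digit, or
  -- behind both numerals, where neither is.
  same-digits : ∀ b b′ {i j} → i ≤ suc n → Digits i b → Digits j b′ →
    ∃[ t ] (proj₁ t ≤ suc n × Reaches sameStep (i , j) t × sameStep t ≡ t × bothEnd t ⊩ b ≡ b′)
  same-digits ℕᵇ.zero ℕᵇ.zero {i} {j} le s s′ = (i , j) , le , reach-refl , fixed , ends
    where
    fixed : sameStep (i , j) ≡ (i , j)
    fixed rewrite proj₁ (sep-one {i} s) | proj₂ (sep-one {i} s) = refl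
    ends : bothEnd (i , j) ⊩ ℕᵇ.zero ≡ ℕᵇ.zero
    ends rewrite s | s′ = ⊩-yes (s≤s z≤n) refl
  same-digits ℕᵇ.zero 2[1+ b′ ] {i} {j} le s (eq , _) = (i , j) , le , reach-refl , fixed , ends
    where
    fixed : sameStep (i , j) ≡ (i , j)
    fixed rewrite proj₁ (sep-one {i} s) | proj₂ (sep-one {i} s) = refl
    ends : bothEnd (i , j) ⊩ ℕᵇ.zero ≡ 2[1+ b′ ]
    ends rewrite s | eq = ⊩-no λ ()
  same-digits ℕᵇ.zero 1+[2 b′ ] {i} {j} le s (eq , _) = (i , j) , le , reach-refl , fixed , ends
    where
    fixed : sameStep (i , j) ≡ (i , j)
    fixed rewrite proj₁ (sep-one {i} s) | proj₂ (sep-one {i} s) = refl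
    ends : bothEnd (i , j) ⊩ ℕᵇ.zero ≡ 1+[2 b′ ]
    ends rewrite s | eq = ⊩-no λ ()
  same-digits 2[1+ b ] ℕᵇ.zero {i} {j} le (eq , _) s = (i , j) , le , reach-refl , fixed , ends
    where
    fixed : sameStep (i , j) ≡ (i , j)
    fixed rewrite eq | proj₂ (sep-one {j} s) = refl
    ends : bothEnd (i , j) ⊩ 2[1+ b ] ≡ ℕᵇ.zero
    ends rewrite eq = ⊩-no λ ()
  same-digits 1+[2 b ] ℕᵇ.zero {i} {j} le (eq , _) s = (i , j) , le , reach-refl , fixed , ends
    where
    fixed : sameStep (i , j) ≡ (i , j)
    fixed rewrite eq | proj₁ (sep-one {j} s) = refl
    ends : bothEnd (i , j) ⊩ 1+[2 b ] ≡ ℕᵇ.zero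
    ends rewrite eq = ⊩-no λ ()
  same-digits 2[1+ b ] 1+[2 b′ ] {i} {j} le (eq , _) (eq′ , _) = (i , j) , le , reach-refl , fixed , ends
    where
    fixed : sameStep (i , j) ≡ (i , j)
    fixed rewrite eq | eq′ = refl
    ends : bothEnd (i , j) ⊩ 2[1+ b ] ≡ 1+[2 b′ ]
    ends rewrite eq = ⊩-no λ ()
  same-digits 1+[2 b ] 2[1+ b′ ] {i} {j} le (eq , _) (eq′ , _) = (i , j) , le , reach-refl , fixed , ends
    where
    fixed : sameStep (i , j) ≡ (i , j)
    fixed rewrite eq | eq′ = refl
    ends : bothEnd (i , j) ⊩ 1+[2 b ] ≡ 2[1+ b′ ]
    ends rewrite eq = ⊩-no λ ()
  same-digits 2[1+ b ] 2[1+ b′ ] {i} {j} le (eq , d) (eq′ , d′) =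
    let (t , le′ , run , fixed , ends) = same-digits b b′ (s≤s (at-≤ eq)) d d′
    in t , le′ , reach-step advance ≤-refl run , fixed ,
       ⊩-resp (cong 2[1+_]) (λ { refl → refl }) ends
    where
    advance : sameStep (i , j) ≡ (suc i , suc j)
    advance rewrite eq | eq′ = cong₂ _,_ (up≡suc (at-≤ eq)) (up≡suc (at-≤ eq′))
  same-digits 1+[2 b ] 1+[2 b′ ] {i} {j} le (eq , d) (eq′ , d′) =
    let (t , le′ , run , fixed , ends) = same-digits b b′ (s≤s (at-≤ eq)) d d′
    in t , le′ , reach-step advance ≤-refl run , fixed ,
       ⊩-resp (cong 1+[2_]) (λ { refl → refl }) ends
    where
    advance : sameStep (i , j) ≡ (suc i , suc j)
    advance rewrite eq | eq′ = cong₂ _,_ (up≡suc (at-≤ eq)) (up≡suc (at-≤ eq′))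

  sameName-⊩ : ∀ {p q x y} → Name p x → Name q y → sameName p q ⊩ x ≡ y
  sameName-⊩ {p} {q} {x} {y} (eq , d) (eq′ , d′)
    with same-digits (fromℕ x) (fromℕ y) (s≤s (at-≤ eq)) d d′
  ... | t , le , run , fixed , ends =
    subst (_⊩ x ≡ y) (symm value) (⊩-resp ℕᵇ.fromℕ-injective (cong fromℕ) ends)
    where
    value : sameName p q ≡ bothEnd t
    value = trans (sameName-def p q) (trans
      (cong₂ (λ i j → bothEnd (iterate (suc n) sameStep (i , j))) (up≡suc (at-≤ eq)) (up≡suc (at-≤ eq′)))
      (cong bothEnd (reach-iterate run fixed (suc n) (≤-trans le (m≤n+m (suc n) (suc p))))))

sym-injective : ∀ {Σ : Set} {a b : Σ} → InputSymbol.sym a ≡ sym b → a ≡ b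
sym-injective refl = refl

data Modal : Formula → Set where
  □ₘ  : ∀ {φ} → Modal (□ φ)
  atₘ : ∀ {x φ} → Modal (at[ x ] φ)

head-modal : ∀ φ → modal? (head φ) ≡ true → Modal φ
head-modal (□ φ)       _ = □ₘ
head-modal (at[ x ] φ) _ = atₘ

modal-head : ∀ {φ} → Modal φ → modal? (head φ) ≡ true
modal-head □ₘ  = refl
modal-head atₘ = refl

head-bind : ∀ φ → bind? (head φ) ≡ true → ∃[ x ] ∃[ ψ ] φ ≡ ↓[ x ] ψ
head-bind (↓[ x ] φ) _ = x , φ , refl

head-conj : ∀ φ → conj? (head φ) ≡ true → ∃[ φ₁ ] ∃[ φ₂ ] φ ≡ φ₁ ∧ φ₂
head-conj (φ ∧ ψ) _ = φ , ψ , refl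

head-disj : ∀ φ → disj? (head φ) ≡ true → ∃[ φ₁ ] ∃[ φ₂ ] φ ≡ φ₁ ∨ φ₂
head-disj (φ ∨ ψ) _ = φ , ψ , refl

on-sym : ∀ {Σ : Set} (f : Σ → Bool) c → on f c ≡ true → ∃[ a ] (c ≡ sym a × f a ≡ true)
on-sym f (sym a) eq = a , refl , eq

-- Binders, modal ancestors and cuts.

module Lookup (w : List Symbol) where

  open Reading w public

  binderTest ancestorTest : Tm 3
  binderTest   = br (on bind?) v0 (sameT (up v0) v2) ze
  ancestorTest = br (on modal?) v0 (insideT v2 v0) ze

  cutTest : Tm 4
  cutTest = br (on conj?) v0 (br is⊢ v3 (eqT (skipT (up v0)) v2) ze)
           (br (on disj?) v0 (br is⊢ v3 ze (eqT (skipT (up v0)) v2)) ze)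

  abstract
    binder ancestor next point truth : ℕ → ℕ
    binder p   = pred (⟦ searchT binderTest ⟧ w (p ∷ []))
    ancestor p = pred (⟦ searchT ancestorTest ⟧ w (p ∷ []))
    next s     = if root? (at s) then s else (if on jump? (at s) then binder (moveHead w right s) else ancestor s)
    point s    = proj₁ (iterate (suc n) (both (λ x _ → next x) (λ _ _ → 0)) (s , 0))
    truth p    = ⟦ eqT v0 v1 ⟧ w (point p ∷ point (binder p) ∷ [])

    cut : ℕ → ℕ → ℕ
    cut p v = ⟦ searchT cutTest ⟧ w (p ∷ v ∷ [])

    binder-def : ∀ p → binder p ≡ pred (⟦ searchT binderTest ⟧ w (p ∷ []))
    binder-def p = refl

    ancestor-def : ∀ p → ancestor p ≡ pred (⟦ searchT ancestorTest ⟧ w (p ∷ []))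
    ancestor-def p = refl

    next-def : ∀ s → next s ≡
      (if root? (at s) then s else (if on jump? (at s) then binder (moveHead w right s) else ancestor s))
    next-def s = refl

    point-def : ∀ s → point s ≡ proj₁ (iterate (suc n) (both (λ x _ → next x) (λ _ _ → 0)) (s , 0))
    point-def s = refl

    truth-def : ∀ p → truth p ≡ ⟦ eqT v0 v1 ⟧ w (point p ∷ point (binder p) ∷ [])
    truth-def p = refl

    cut-def : ∀ p v → cut p v ≡ ⟦ searchT cutTest ⟧ w (p ∷ v ∷ [])
    cut-def p v = refl

    ⟦binder⟧ : ∀ {k} (a : Tm k) {ρ} → ⟦ binderT a ⟧ w ρ ≡ binder (⟦ a ⟧ w ρ)
    ⟦binder⟧ a = refl

    ⟦truth⟧ : ∀ {k} (a : Tm k) {ρ} → ⟦ truthT a ⟧ w ρ ≡ truth (⟦ a ⟧ w ρ)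
    ⟦truth⟧ a = refl

    ⟦cut⟧ : ∀ {k p v} {ρ : Vec ℕ k} → ⟦ cutT ⟧ w (p ∷ v ∷ ρ) ≡ cut p v
    ⟦cut⟧ = refl

  bounded₁ : ∀ {p} → p ≤ suc n → Bounded (suc n) (p ∷ [])
  bounded₁ le = bounded-∷ le λ ()

  skip-bound : ∀ p → p ≤ suc n → skip p ≤ suc n
  skip-bound p le = ≤-trans (≤-reflexive (symm (⟦skip⟧ v0 {p ∷ []}))) (⟦⟧-bounded (skipT v0) w {p ∷ []} (bounded₁ le))

  inside-⊩ : ∀ {k} (a b : Tm k) {ρ p q} → ⟦ a ⟧ w ρ ≡ p → ⟦ b ⟧ w ρ ≡ q → p ≤ suc n → q ≤ suc n →
    ⟦ insideT a b ⟧ w ρ ⊩ (q < p × p < skip q)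
  inside-⊩ a b {ρ} refl refl p≤ q≤ =
    ⊩-and (subst (_⊩ (⟦ b ⟧ w ρ < ⟦ a ⟧ w ρ)) (symm (⟦sub⟧ a b {ρ} p≤)) (⊩-∸ (⟦ b ⟧ w ρ) (⟦ a ⟧ w ρ)))
          (subst (_⊩ (⟦ a ⟧ w ρ < skip (⟦ b ⟧ w ρ))) (symm (trans (⟦sub⟧ (skipT b) a {ρ} (≤-trans (≤-reflexive (⟦skip⟧ b {ρ})) (skip-bound _ q≤)))
                                     (cong (_∸ ⟦ a ⟧ w ρ) (⟦skip⟧ b {ρ})))) (⊩-∸ (⟦ a ⟧ w ρ) (skip (⟦ b ⟧ w ρ))))

module Analysis (w : List Symbol) (Φ : Formula)
                (enc : Reading.Enc w 1 Φ) (whole : end 1 Φ ≡ suc (length w)) where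

  open Lookup w public

  Occurs : ℕ → Formula → Set
  Occurs = Node 1 Φ

  Binds : ℕ → SVAR → Set
  Binds = Binder 1 Φ

  occurs-enc : ∀ {q χ} → Occurs q χ → Enc q χ
  occurs-enc m = enc-node m enc

  occurs-head : ∀ {q χ} → Occurs q χ → at q ≡ sym (head χ)
  occurs-head {χ = χ} m = enc-head χ (occurs-enc m)

  occurs-≤ : ∀ {q χ} → Occurs q χ → q ≤ n
  occurs-≤ m = at-≤ (occurs-head m)

  occurs-skip : ∀ {q χ} → Occurs q χ → skip q ≡ end q χ
  occurs-skip {χ = χ} m = skip-end χ (occurs-enc m)

  located : ∀ {q a} → at q ≡ sym a → Located 1 Φ q
  located eq = let (pos , le) = bounded⇒ eq
               in locate Φ enc pos (≤-trans (s≤s le) (≤-reflexive (symm whole)))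

  -- Among the cases of `locate`, a digit and the name behind ↓ or @ are excluded by the symbol
  -- itself.
  operator : ∀ {q a} → at q ≡ sym a → digit? a ≡ false → x? a ≡ false →
    ∃[ χ ] (Occurs q χ × head χ ≡ a)
  operator eq d x with located eq
  ... | node {χ} m = χ , m , sym-injective (trans (symm (occurs-head m)) eq)
  ... | digit d′ = contradiction (trans (symm d′) (trans (cong (on digit?) eq) d)) λ ()
  ... | name m nm refl =
    contradiction (trans (cong (on x?) (symm (proj₁ (enc-named nm (occurs-enc m))))) (trans (cong (on x?) eq) x)) λ ()

  operator-by : ∀ (f : Symbol → Bool) {q} → (∀ a → f a ≡ true → digit? a ≡ false × x? a ≡ false) →
    on f (at q) ≡ true → ∃[ χ ] (Occurs q χ × f (head χ) ≡ true)
  operator-by f {q} op eq =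
    let (a , eq₁ , eq₂) = on-sym f (at q) eq
        (χ , m , eq₃)   = operator eq₁ (proj₁ (op a eq₂)) (proj₂ (op a eq₂))
    in χ , m , trans (cong f eq₃) eq₂

  binds : ∀ {q} → on bind? (at q) ≡ true → ∃[ x ] Binds q x
  binds eq with operator-by bind? (λ { ‵↓ _ → refl , refl }) eq
  ... | χ , m , eq′ with head-bind χ eq′
  ... | x , ψ , refl = x , ψ , m

  binds-at : ∀ {q x} → Binds q x → on bind? (at q) ≡ true
  binds-at (ψ , m) = cong (on bind?) (occurs-head m)

  binds-name : ∀ {q x} → Binds q x → Name (suc q) x
  binds-name {x = x} (ψ , m) = enc-named {φ = ↓[ x ] ψ} ↓ₙ (occurs-enc m)

  binds-unique : ∀ {q x y} → Binds q x → Binds q y → x ≡ y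
  binds-unique (_ , m) (_ , m′) with node-unique m m′
  ... | refl = refl

  -- If there are several binders, this is the last one. It thus has a meaning before the convention
  -- on variables is established, as the test of the convention requires.
  data BinderOf (x : SVAR) : ℕ → Set where
    unbound : (∀ q → ¬ Binds q x) → BinderOf x 0
    bound   : ∀ {q} → Binds q x → (∀ i → Binds i x → i ≤ q) → BinderOf x q

  binder-of : ∀ {p x} → Name p x → BinderOf x (binder p)
  binder-of {p} {x} nm = subst (BinderOf x) (symm (binder-def p)) (finish (search binderTest {p ∷ []} decides))
    where
    decides′ : ∀ j → j ≤ n → (if on bind? (at j) then sameName (suc j) p else 0) ⊩ Binds j x
    decides′ j le with on bind? (at j) in eq
    ... | false = ⊩-no λ b → contradiction (trans (symm eq) (binds-at b)) λ ()
    ... | true  = let (y , b) = binds eq in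
      ⊩-resp (λ { refl → b }) (λ b′ → binds-unique b b′) (sameName-⊩ (binds-name b) nm)
    decides : ∀ j r → j ≤ n → ⟦ binderTest ⟧ w (j ∷ r ∷ p ∷ []) ⊩ Binds j x
    decides j r le = subst (_⊩ Binds j x)
      (cong (λ v → if on bind? (at j) then v else 0)
        (symm (trans (⟦same⟧ (up v0) v2 {j ∷ r ∷ p ∷ []}) (cong (λ i → sameName i p) (up≡suc le)))))
      (decides′ j le)
    finish : ∀ {r} → Largest (λ q → Binds q x) r → BinderOf x (pred r)
    finish (absent ¬b)      = unbound λ q b → ¬b q (occurs-≤ (proj₂ b)) b
    finish (found le b max) = bound b λ i b′ → max i (occurs-≤ (proj₂ b′)) b′

  binderOf-unique : ∀ {x b b′} → BinderOf x b → BinderOf x b′ → b ≡ b′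
  binderOf-unique (unbound _)   (unbound _)   = refl
  binderOf-unique (unbound ¬b)  (bound b _)   = contradiction b (¬b _)
  binderOf-unique (bound b _)   (unbound ¬b)  = contradiction b (¬b _)
  binderOf-unique (bound b max) (bound b′ max′) = ≤-antisym (max′ _ b) (max _ b′)

  -- Containment is expressed by spans instead of `Node`, because the search can only compare
  -- positions.
  record ModalAbove (p q : ℕ) : Set where
    constructor modalAbove
    field
      {χ}    : Formula
      occurs : Occurs q χ
      modal  : Modal χ
      starts : q < p
      within : p < end q χ

  data Ancestor (p : ℕ) : ℕ → Set where
    none    : (∀ q → ¬ ModalAbove p q) → Ancestor p 0
    nearest : ∀ {q} → ModalAbove p q → (∀ i → ModalAbove p i → i ≤ q) → Ancestor p q

  ancestor-of : ∀ {p} → p ≤ suc n → Ancestor p (ancestor p)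
  ancestor-of {p} p≤ = subst (Ancestor p) (symm (ancestor-def p)) (finish (search ancestorTest {p ∷ []} decides))
    where
    inside : ∀ j r → j ≤ n → ⟦ insideT v2 v0 ⟧ w (j ∷ r ∷ p ∷ []) ⊩ (j < p × p < skip j)
    inside j r le = inside-⊩ v2 v0 {j ∷ r ∷ p ∷ []} refl refl p≤ (m≤n⇒m≤1+n le)
    decide : ∀ j v → v ⊩ (j < p × p < skip j) → (if on modal? (at j) then v else 0) ⊩ ModalAbove p j
    decide j v inside with on modal? (at j) in eq
    ... | false = ⊩-no λ a → contradiction
      (trans (symm eq) (trans (cong (on modal?) (occurs-head (ModalAbove.occurs a))) (modal-head (ModalAbove.modal a)))) λ ()
    ... | true with operator-by modal? (λ { ‵□ _ → refl , refl ; ‵at _ → refl , refl }) eq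
    ...   | χ , m , eq′ = ⊩-resp
      (λ (lt , lt′) → modalAbove m (head-modal χ eq′) lt (subst (p <_) (occurs-skip m) lt′))
      (λ (modalAbove m′ _ lt lt′) → lt , subst (p <_) (symm (occurs-skip m′)) lt′)
      inside
    decides : ∀ j r → j ≤ n → ⟦ ancestorTest ⟧ w (j ∷ r ∷ p ∷ []) ⊩ ModalAbove p j
    decides j r le = decide j _ (inside j r le)
    finish : ∀ {r} → Largest (ModalAbove p) r → Ancestor p (pred r)
    finish (absent ¬a)      = none λ q a → ¬a q (occurs-≤ (ModalAbove.occurs a)) a
    finish (found le a max) = nearest a λ i a′ → max i (occurs-≤ (ModalAbove.occurs a′)) a′

  ancestor-unique : ∀ {p a b} → Ancestor p a → Ancestor p b → a ≡ b
  ancestor-unique (none _)        (none _)          = refl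
  ancestor-unique (none ¬a)       (nearest a _)     = contradiction a (¬a _)
  ancestor-unique (nearest a _)   (none ¬a)         = contradiction a (¬a _)
  ancestor-unique (nearest a max) (nearest a′ max′) = ≤-antisym (max′ _ a) (max _ a′)

  -- The formula starting at p is the right argument of an operator whose value is
  -- already determined by the value v of the left argument.
  data Cut (p v : ℕ) (q : ℕ) : Set where
    conj : ∀ {φ ψ} → Occurs q (φ ∧ ψ) → end (suc q) φ ≡ p → v ≡ 0 → Cut p v q
    disj : ∀ {φ ψ} → Occurs q (φ ∨ ψ) → end (suc q) φ ≡ p → 0 < v → Cut p v q

  cut-⊩ : ∀ {p v} → p ≤ suc n → cut p v ⊩ (∃[ q ] Cut p v q)
  cut-⊩ {p} {v} p≤ = subst (_⊩ (∃[ q ] Cut p v q)) (symm (cut-def p v)) (finish (search cutTest {p ∷ v ∷ []} decides))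
    where
    meet : ∀ j r → ℕ
    meet j r = ⟦ eqT (skipT (up v0)) v2 ⟧ w (j ∷ r ∷ p ∷ v ∷ [])
    meet≡ : ∀ j r → j ≤ n → meet j r ≡ num (does (skip (suc j) ≟ p))
    meet≡ j r le = trans (⟦eq⟧ (skipT (up v0)) v2 {j ∷ r ∷ p ∷ v ∷ []}
        (≤-trans (≤-reflexive (⟦skip⟧ (up v0) {j ∷ r ∷ p ∷ v ∷ []})) (skip-bound _ (m⊓n≤n (suc j) (suc n)))) p≤)
      (cong (λ q → num (does (q ≟ p))) (trans (⟦skip⟧ (up v0) {j ∷ r ∷ p ∷ v ∷ []}) (cong skip (up≡suc le))))
    -- The value of `skip` is known only where a formula starts, which is available only after the
    -- symbol at `j` has been identified as ∧ or ∨.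
    MeetAt : ℕ → ℕ → Set
    MeetAt j v = ∀ {φ} → Enc (suc j) φ → v ⊩ end (suc j) φ ≡ p
    meet-⊩ : ∀ j r → j ≤ n → MeetAt j (meet j r)
    meet-⊩ j r le {φ} e = subst (_⊩ end (suc j) φ ≡ p)
      (symm (trans (meet≡ j r le) (cong (λ q → num (does (q ≟ p))) (skip-end φ e))))
      (num-⊩ (end (suc j) φ ≟ p))
    occurs-cut : ∀ {j} → Cut p v j → ∃[ χ ] Occurs j χ
    occurs-cut (conj m _ _) = _ , m
    occurs-cut (disj m _ _) = _ , m
    guard : ∀ j k (c d : Bool) v′ → v′ ≡ v → MeetAt j k → on conj? (at j) ≡ c → on disj? (at j) ≡ d →
      (if c then (if is⊢ (at v′) then k else 0)
            else (if d then (if is⊢ (at v′) then 0 else k) else 0)) ⊩ Cut p v j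
    guard j k true d v′ refl meets eq _ with operator-by conj? {j} (λ { ‵∧ _ → refl , refl }) eq
    ... | χ , m , eq′ with head-conj χ eq′
    guard j k true d zero refl meets eq _ | _ , m , _ | φ , ψ , refl =
      ⊩-resp (λ e → conj m e refl)
        (λ { (conj m′ e _) → trans (cong (λ { (φ ∧ _) → end (suc j) φ ; _ → 0 }) (node-unique m m′)) e
           ; (disj m′ e ()) })
        (meets (proj₁ (proj₂ (occurs-enc m))))
    guard j k true d (suc v′) refl meets eq _ | _ , m , _ | φ , ψ , refl rewrite symbolAt-pos w v′ =
      ⊩-no λ { (disj m′ _ _) → contradiction (node-unique m m′) λ () }
    guard j k false true v′ refl meets eq₁ eq with operator-by disj? {j} (λ { ‵∨ _ → refl , refl }) eq
    ... | χ , m , eq′ with head-disj χ eq′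
    guard j k false true zero refl meets eq₁ _ | _ , m , _ | φ , ψ , refl =
      ⊩-no λ { (conj m′ _ _) → contradiction (node-unique m m′) λ () ; (disj _ _ ()) }
    guard j k false true (suc v′) refl meets eq₁ _ | _ , m , _ | φ , ψ , refl rewrite symbolAt-pos w v′ =
      ⊩-resp (λ e → disj m e (s≤s z≤n))
        (λ { (disj m′ e _) → trans (cong (λ { (φ ∨ _) → end (suc j) φ ; _ → 0 }) (node-unique m m′)) e })
        (meets (proj₁ (proj₂ (occurs-enc m))))
    guard j k false false v′ refl meets eq₁ eq₂ = ⊩-no λ
      { (conj m _ _) → contradiction (trans (symm eq₁) (cong (on conj?) (occurs-head m))) λ ()
      ; (disj m _ _) → contradiction (trans (symm eq₂) (cong (on disj?) (occurs-head m))) λ () }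
    decides : ∀ j r → j ≤ n → ⟦ cutTest ⟧ w (j ∷ r ∷ p ∷ v ∷ []) ⊩ Cut p v j
    decides j r le = guard j (meet j r) (on conj? (at j)) (on disj? (at j)) v refl (meet-⊩ j r le) refl refl
    finish : ∀ {r} → Largest (Cut p v) r → r ⊩ (∃[ q ] Cut p v q)
    finish (absent ¬c)     = ⊩-no λ (q , c) → ¬c q (occurs-≤ (proj₂ (occurs-cut c))) c
    finish (found {j} _ c _) = ⊩-yes (s≤s z≤n) (j , c)

-- Symbolic evaluation

-- Every □ moves to a fresh world, different from all worlds met so far. As
-- satisfaction is monotone in the equalities between worlds, this is the
-- hardest instance of the universal quantifier.
ev : (SVAR → ℕ) → ℕ → ℕ → Formula → Bool
ev ρ c p (var x)     = does (c ≟ ρ x)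
ev ρ c p top         = true
ev ρ c p bot         = false
ev ρ c p (φ ∧ ψ)     = ev ρ c (suc p) φ Bool.∧ ev ρ c (end (suc p) φ) ψ
ev ρ c p (φ ∨ ψ)     = ev ρ c (suc p) φ Bool.∨ ev ρ c (end (suc p) φ) ψ
ev ρ c p (□ φ)       = ev ρ p (suc p) φ
ev ρ c p (↓[ x ] φ)  = ev (ρ [ x ↦ c ]) c (nameEnd (suc p) x) φ
ev ρ c p (at[ x ] φ) = ev ρ (ρ x) (nameEnd (suc p) x) φ

∧-true : ∀ {a b} → a Bool.∧ b ≡ true → a ≡ true × b ≡ true
∧-true {true} eq = refl , eq

∨-true : ∀ {a b} → a Bool.∨ b ≡ true → a ≡ true ⊎ b ≡ true
∨-true {true}  eq = inj₁ refl
∨-true {false} eq = inj₂ eq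

data Update (x y : SVAR) : Set where
  hit  : x ≡ y → (∀ g m → (g [ x ↦ m ]) y ≡ m) → Update x y
  miss : x ≢ y → (∀ g m → (g [ x ↦ m ]) y ≡ g y) → Update x y

update-view : ∀ x y → Update x y
update-view x y = decide (x ≟ y)
  where
  decide : Dec (x ≡ y) → Update x y
  decide (yes x≡y) = hit x≡y λ g m → cong (if_then m else g y) (dec-true (x ≟ y) x≡y)
  decide (no x≢y)  = miss x≢y λ g m → cong (if_then m else g y) (dec-false (x ≟ y) x≢y)

-- The concrete points satisfy at least the equalities of the symbolic ones. The last two fields
-- keep position `p` free to name a fresh world.
record Coarser (ρ : SVAR → ℕ) (c p : ℕ) (g : Assignment) (m : ℕ) : Set where
  constructor coarser
  field
    variables : ∀ x y → ρ x ≡ ρ y → g x ≡ g y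
    current   : ∀ x → c ≡ ρ x → g x ≡ m
    old       : ∀ x → ρ x < p
    c<p       : c < p

coarser-mono : ∀ {ρ c p q g m} → p ≤ q → Coarser ρ c p g m → Coarser ρ c q g m
coarser-mono le (coarser vs cur old c<) = coarser vs cur (λ x → ≤-trans (old x) le) (≤-trans c< le)

coarser-bind : ∀ {ρ c p g m} x → Coarser ρ c p g m → Coarser (ρ [ x ↦ c ]) c p (g [ x ↦ m ]) m
coarser-bind {ρ} {c} {p} {g} {m} x (coarser vs cur old c<) = coarser vs′ cur′ old′ c<
  where
  vs′ : ∀ y z → (ρ [ x ↦ c ]) y ≡ (ρ [ x ↦ c ]) z → (g [ x ↦ m ]) y ≡ (g [ x ↦ m ]) z
  vs′ y z eq with update-view x y | update-view x z
  ... | hit _ u  | hit _ u′  = trans (u g m) (symm (u′ g m))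
  ... | hit _ u  | miss _ u′ =
    trans (u g m) (symm (trans (u′ g m) (cur z (trans (symm (u ρ c)) (trans eq (u′ ρ c))))))
  ... | miss _ u | hit _ u′  =
    trans (trans (u g m) (cur y (trans (symm (u′ ρ c)) (trans (symm eq) (u ρ c))))) (symm (u′ g m))
  ... | miss _ u | miss _ u′ =
    trans (u g m) (trans (vs y z (trans (symm (u ρ c)) (trans eq (u′ ρ c)))) (symm (u′ g m)))
  cur′ : ∀ y → c ≡ (ρ [ x ↦ c ]) y → (g [ x ↦ m ]) y ≡ m
  cur′ y eq with update-view x y
  ... | hit _ u  = u g m
  ... | miss _ u = trans (u g m) (cur y (trans eq (u ρ c)))
  old′ : ∀ y → (ρ [ x ↦ c ]) y < p
  old′ y with update-view x y
  ... | hit _ u  = ≤-trans (s≤s (≤-reflexive (u ρ c))) c<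
  ... | miss _ u = ≤-trans (s≤s (≤-reflexive (u ρ c))) (old y)

does-true : ∀ {P : Set} (d : Dec P) → does d ≡ true → P
does-true (yes p) _ = p

ev-sound : ∀ {ρ c p g m} φ → Coarser ρ c p g m → ev ρ c p φ ≡ true → g , m ⊨ φ
ev-sound {ρ} {c} (var x) co eq = Coarser.current co x (does-true (c ≟ ρ x) eq)
ev-sound top co eq = tt
ev-sound {p = p} (φ ∧ ψ) co eq =
  let (eq₁ , eq₂) = ∧-true eq
  in ev-sound φ (coarser-mono (n≤1+n p) co) eq₁ ,
     ev-sound ψ (coarser-mono (<⇒≤ (child-< {φ = φ ∧ ψ} ∧ʳ)) co) eq₂
ev-sound {p = p} (φ ∨ ψ) co eq with ∨-true eq
... | inj₁ eq₁ = inj₁ (ev-sound φ (coarser-mono (n≤1+n p) co) eq₁)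
... | inj₂ eq₂ = inj₂ (ev-sound ψ (coarser-mono (<⇒≤ (child-< {φ = φ ∨ ψ} ∨ʳ)) co) eq₂)
ev-sound {p = p} (□ φ) (coarser vs cur old c<) eq m′ lt =
  -- No variable denotes the new world, so the arbitrary `m′` is under no constraint.
  ev-sound φ (coarser vs (λ x p≡ → contradiction (symm p≡) (<⇒≢ (old x))) (λ x → m<n⇒m<1+n (old x)) ≤-refl) eq
ev-sound (↓[ x ] φ) co eq =
  ev-sound φ (coarser-mono (<⇒≤ (child-< {φ = ↓[ x ] φ} ↓₁)) (coarser-bind x co)) eq
ev-sound (at[ x ] φ) (coarser vs cur old c<) eq =
  ev-sound φ (coarser-mono (<⇒≤ (child-< {φ = at[ x ] φ} at₁)) (coarser vs (λ y eq → vs y x (symm eq)) old (old x))) eq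

maxVar : Formula → ℕ
maxVar (var x)     = x
maxVar top         = 0
maxVar bot         = 0
maxVar (φ ∧ ψ)     = maxVar φ ⊔ maxVar ψ
maxVar (φ ∨ ψ)     = maxVar φ ⊔ maxVar ψ
maxVar (□ φ)       = maxVar φ
maxVar (↓[ x ] φ)  = x ⊔ maxVar φ
maxVar (at[ x ] φ) = x ⊔ maxVar φ

-- The converse invariant. It is restricted to variables up to `K` because an assignment may be
-- unbounded, whereas a point beyond the relevant values must be available.
record Finer (K : ℕ) (ρ : SVAR → ℕ) (c : ℕ) (g : Assignment) (m : ℕ) : Set where
  constructor finer
  field
    variables : ∀ x y → x ≤ K → y ≤ K → g x ≡ g y → ρ x ≡ ρ y
    current   : ∀ x → x ≤ K → g x ≡ m → c ≡ ρ x

finer-bind : ∀ {K ρ c g m} x → Finer K ρ c g m → Finer K (ρ [ x ↦ c ]) c (g [ x ↦ m ]) m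
finer-bind {K} {ρ} {c} {g} {m} x (finer vs cur) = finer vs′ cur′
  where
  vs′ : ∀ y z → y ≤ K → z ≤ K → (g [ x ↦ m ]) y ≡ (g [ x ↦ m ]) z → (ρ [ x ↦ c ]) y ≡ (ρ [ x ↦ c ]) z
  vs′ y z y≤ z≤ eq with update-view x y | update-view x z
  ... | hit _ u  | hit _ u′  = trans (u ρ c) (symm (u′ ρ c))
  ... | hit _ u  | miss _ u′ =
    trans (u ρ c) (trans (cur z z≤ (trans (symm (u′ g m)) (trans (symm eq) (u g m)))) (symm (u′ ρ c)))
  ... | miss _ u | hit _ u′  =
    trans (u ρ c) (trans (symm (cur y y≤ (trans (symm (u g m)) (trans eq (u′ g m))))) (symm (u′ ρ c)))
  ... | miss _ u | miss _ u′ =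
    trans (u ρ c) (trans (vs y z y≤ z≤ (trans (symm (u g m)) (trans eq (u′ g m)))) (symm (u′ ρ c)))
  cur′ : ∀ y → y ≤ K → (g [ x ↦ m ]) y ≡ m → c ≡ (ρ [ x ↦ c ]) y
  cur′ y y≤ eq with update-view x y
  ... | hit _ u  = symm (u ρ c)
  ... | miss _ u = trans (cur y y≤ (trans (symm (u g m)) eq)) (symm (u ρ c))

above-all : ∀ K (g : Assignment) → ∃[ u ] (∀ x → x ≤ K → g x < u)
above-all zero    g = suc (g 0) , λ { zero z≤n → ≤-refl }
above-all (suc K) g =
  let (u , lt) = above-all K g in
  u ⊔ suc (g (suc K)) , λ x le → case-≤ u lt x (m≤n⇒m<n∨m≡n le)
  where
  case-≤ : ∀ u → (∀ x → x ≤ K → g x < u) → ∀ x → x < suc K ⊎ x ≡ suc K → g x < u ⊔ suc (g (suc K))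
  case-≤ u lt x (inj₁ x<)   = ≤-trans (lt x (≤-pred x<)) (m≤m⊔n u _)
  case-≤ u lt x (inj₂ refl) = m≤n⊔m u _

ev-complete : ∀ {K ρ c p g m} φ → maxVar φ ≤ K → Finer K ρ c g m → g , m ⊨ φ → ev ρ c p φ ≡ true
ev-complete {ρ = ρ} {c} (var x) le fi s = dec-true (c ≟ ρ x) (Finer.current fi x le s)
ev-complete top le fi s = refl
ev-complete (φ ∧ ψ) le fi (s , s′) =
  cong₂ Bool._∧_ (ev-complete φ (m⊔n≤o⇒m≤o _ _ le) fi s) (ev-complete ψ (m⊔n≤o⇒n≤o (maxVar φ) _ le) fi s′)
ev-complete {ρ = ρ} {c} {p} (φ ∨ ψ) le fi (inj₁ s) =
  cong (Bool._∨ ev ρ c (end (suc p) φ) ψ) (ev-complete φ (m⊔n≤o⇒m≤o _ _ le) fi s)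
ev-complete {ρ = ρ} {c} {p} (φ ∨ ψ) le fi (inj₂ s) =
  trans (cong (ev ρ c (suc p) φ Bool.∨_) (ev-complete ψ (m⊔n≤o⇒n≤o (maxVar φ) _ le) fi s)) (∨-zeroʳ _)
ev-complete {K} {g = g} {m} (□ φ) le (finer vs cur) s =
  let (u , lt) = above-all K g
      -- Later than `m`, as □ requires, and beyond the values of all relevant variables: a concrete
      -- fresh point.
      m′ = u ⊔ suc m
  in ev-complete φ le
       (finer vs λ x x≤ eq → contradiction eq (<⇒≢ (≤-trans (lt x x≤) (m≤m⊔n u (suc m)))))
       (s m′ (m≤n⊔m u (suc m)))
ev-complete (↓[ x ] φ) le fi s =
  ev-complete φ (m⊔n≤o⇒n≤o x _ le) (finer-bind x fi) s
ev-complete (at[ x ] φ) le (finer vs cur) s =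
  ev-complete φ (m⊔n≤o⇒n≤o x _ le)
    (finer vs (λ y y≤ eq → vs x y (m⊔n≤o⇒m≤o x _ le) y≤ (symm eq))) s

-- By monotonicity it is best to identify all free variables with the initial world.
satisfiable⇔ev : ∀ φ → Satisfiable φ ⇔ ev (const 0) 0 1 φ ≡ true
satisfiable⇔ev φ = mk⇔
  (λ (g , m , s) → ev-complete φ ≤-refl (finer (λ _ _ _ _ _ → refl) (λ _ _ _ → refl)) s)
  (λ eq → const 0 , 0 ,
    ev-sound φ (coarser (λ _ _ _ → refl) (λ _ _ → refl) (λ _ → s≤s z≤n) (s≤s z≤n)) eq)

-- Correctness of the evaluation loop.

iterate-cong : ∀ {A : Set} {f g : A → A} → (∀ x → f x ≡ g x) → ∀ m x → iterate m f x ≡ iterate m g x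
iterate-cong eq zero    x = refl
iterate-cong {g = g} eq (suc m) x = trans (cong (iterate m _) (eq x)) (iterate-cong eq m (g x))

module Evaluation (w : List Symbol) (Φ : Formula)
                  (enc : Reading.Enc w 1 Φ) (whole : end 1 Φ ≡ suc (length w))
                  (binds-once : Once 1 Φ)
                  (free-unbound : ∀ {x} → x ∈ freeVars Φ → ∀ q → ¬ Binder 1 Φ q x) where

  open Analysis w Φ enc whole

  -- The chain followed by `pointT`. Every proper step leads to the left, so the chain has at most
  -- `s` of them and the fixed number of iterations exhausts it.
  data World (s : ℕ) : ℕ → Set where
    stays : next s ≡ s → World s s
    goes  : ∀ {t r} → next s ≡ t → t < s → World t r → World s r

  point-world : ∀ {s r} → World s r → s ≤ suc n → point s ≡ r
  point-world {s} {r} wo le = trans (point-def s) (go (suc n) wo le)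
    where
    F : ℕ × ℕ → ℕ × ℕ
    F = both (λ x _ → next x) (λ _ _ → 0)
    go : ∀ m {s r} → World s r → s ≤ m → proj₁ (iterate m F (s , 0)) ≡ r
    go m (stays eq) le = cong proj₁ (iterate-fixed {f = F} (cong (_, 0) eq) m)
    go zero (goes eq lt wo) le = contradiction (≤-trans lt le) λ ()
    go (suc m) (goes refl lt wo) le = go m wo (≤-pred (≤-trans lt le))

  world-≤ : ∀ {s r} → World s r → r ≤ s
  world-≤ (stays _)     = ≤-refl
  world-≤ (goes _ lt w) = ≤-trans (world-≤ w) (<⇒≤ lt)

  next-root : next 0 ≡ 0
  next-root = next-def 0

  next-box : ∀ {p φ} → Occurs p (□ φ) → next p ≡ p
  next-box {p} m = trans (next-def p) (cong
    (λ c → if root? c then p else (if on jump? c then binder (moveHead w right p) else ancestor p)) (occurs-head m))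

  next-at : ∀ {p x φ} → Occurs p (at[ x ] φ) → next p ≡ binder (suc p)
  next-at {p} m = trans (next-def p) (trans (cong
    (λ c → if root? c then p else (if on jump? c then binder (moveHead w right p) else ancestor p)) (occurs-head m))
    (cong binder (up≡suc (occurs-≤ m))))

  next-other : ∀ {p φ} → Occurs p φ → box? (head φ) ≡ false → jump? (head φ) ≡ false → next p ≡ ancestor p
  next-other {p} m eq₁ eq₂ = trans (next-def p) (trans (cong
    (λ c → if root? c then p else (if on jump? c then binder (moveHead w right p) else ancestor p)) (occurs-head m))
    (cong₂ (λ b j → if b then p else (if j then binder (moveHead w right p) else ancestor p)) eq₁ eq₂))

  modalAbove-child : ∀ {p φ p′ φ′ a} → Occurs p φ → Child p φ p′ φ′ → ModalAbove p a → ModalAbove p′ a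
  modalAbove-child {p} {φ} {p′} {φ′} m c (modalAbove {χ} m′ mo lt lt′) with laminar m′ m
  ... | above l     = modalAbove m′ mo (<-trans lt (child-< c))
                        (≤-trans (<-end p′ φ′) (≤-trans (child-end c) (node-end l)))
  ... | below l     = contradiction (≤-trans lt (node-≤ l)) 1+n≰n
  ... | precedes le = contradiction (≤-trans lt′ le) 1+n≰n
  ... | follows le  = contradiction (≤-trans (<-trans lt (<-end p φ)) le) 1+n≰n

  -- Spans cannot cross, so an operator whose span contains the start of a child, and which starts
  -- before it, is the parent or contains the parent.
  modalAbove-parent : ∀ {p φ p′ φ′ q} → Occurs p φ → Child p φ p′ φ′ → ModalAbove p′ q →
    (q ≡ p × Modal φ) ⊎ ModalAbove p q
  modalAbove-parent {p} {φ} {p′} {φ′} {q} m c (modalAbove {χ} m′ mo lt lt′) with laminar m′ m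
  ... | above here        = inj₁ (refl , mo)
  ... | above (step c′ l) = inj₂ (modalAbove m′ mo (≤-trans (child-< c′) (node-≤ l)) (<-trans (child-< c) lt′))
  ... | precedes le       = contradiction (≤-trans (<-trans (child-< c) lt′) le) 1+n≰n
  ... | follows le        = contradiction (≤-trans (<-trans lt (<-end p′ φ′)) (≤-trans (child-end c) le)) 1+n≰n
  ... | below here        = inj₁ (refl , mo)
  ... | below (step c′ l) with siblings c c′
  ...   | same refl refl = contradiction (≤-trans lt (node-≤ l)) 1+n≰n
  ...   | precedes le    = contradiction (≤-trans (<-trans lt (<-end p′ φ′)) (≤-trans le (node-≤ l))) 1+n≰n
  ...   | follows le     = contradiction (≤-trans lt′ (≤-trans (node-end l) le)) 1+n≰n

  ancestor-child : ∀ {p φ p′ φ′ a} → Occurs p φ → Child p φ p′ φ′ → ¬ Modal φ → Ancestor p a → Ancestor p′ a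
  ancestor-child m c ¬mo (none ¬a) = none λ q a → case-⊎ q (modalAbove-parent m c a)
    where
    case-⊎ : ∀ q → _ → _
    case-⊎ q (inj₁ (_ , mo)) = ¬mo mo
    case-⊎ q (inj₂ a)        = ¬a q a
  ancestor-child m c ¬mo (nearest a max) =
    nearest (modalAbove-child m c a) λ i a′ → case-⊎ i (modalAbove-parent m c a′)
    where
    case-⊎ : ∀ i → _ → i ≤ _
    case-⊎ i (inj₁ (_ , mo)) = contradiction mo ¬mo
    case-⊎ i (inj₂ a′)       = max i a′

  ancestor-modal : ∀ {p φ p′ φ′} → Occurs p φ → Child p φ p′ φ′ → Modal φ → Ancestor p′ p
  ancestor-modal {p} {φ} {p′} {φ′} m c mo =
    nearest (modalAbove m mo (child-< c) (≤-trans (<-end p′ φ′) (child-end c)))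
      λ i a → case-⊎ i (modalAbove-parent m c a)
    where
    case-⊎ : ∀ i → (i ≡ p × Modal φ) ⊎ ModalAbove p i → i ≤ p
    case-⊎ i (inj₁ (refl , _)) = ≤-refl
    case-⊎ i (inj₂ a)          = <⇒≤ (ModalAbove.starts a)

  ancestor-< : ∀ {p a} → 0 < p → Ancestor p a → a < p
  ancestor-< pos (none _)      = pos
  ancestor-< pos (nearest a _) = ModalAbove.starts a

  -- The simulation invariant: the world `c` and the environment `ρ` of `ev` are what the chains
  -- compute from positions. The condition `b < p` makes the jump from @ to a binder a step to the
  -- left.
  record State (p : ℕ) (φ : Formula) (ρ : SVAR → ℕ) (c : ℕ) : Set where
    constructor state
    field
      occurs : Occurs p φ
      {a}    : ℕ
      anc    : Ancestor p a
      world  : World a c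
      env    : ∀ {x} → x ∈ freeVars φ → ∃[ b ] (b < p × BinderOf x b × World b (ρ x))

  occurs-pos : ∀ {p φ} → Occurs p φ → 0 < p
  occurs-pos m = node-≤ m

  state-next : ∀ {p φ ρ c} → State p φ ρ c → box? (head φ) ≡ false → jump? (head φ) ≡ false → World p c
  state-next (state m anc wo _) eq₁ eq₂ =
    goes (trans (next-other m eq₁ eq₂) (ancestor-unique (ancestor-of (m≤n⇒m≤1+n (occurs-≤ m))) anc))
         (ancestor-< (occurs-pos m) anc) wo

  start : State 1 Φ (const 0) 0
  start = state here (none λ { zero (modalAbove m _ _ _) → contradiction (occurs-head m) λ ()
                             ; (suc _) (modalAbove _ _ (s≤s ()) _) })
    (stays next-root) (λ x∈ → 0 , s≤s z≤n , unbound (free-unbound x∈) , stays next-root)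

  env-weaken : ∀ {p q φ ψ} {ρ : SVAR → ℕ} → p ≤ q → (∀ {x} → x ∈ freeVars ψ → x ∈ freeVars φ) →
    (∀ {x} → x ∈ freeVars φ → ∃[ b ] (b < p × BinderOf x b × World b (ρ x))) →
    (∀ {x} → x ∈ freeVars ψ → ∃[ b ] (b < q × BinderOf x b × World b (ρ x)))
  env-weaken le sub env x∈ = let (b , lt , bo , wo) = env (sub x∈) in b , ≤-trans lt le , bo , wo

  state-child : ∀ {p φ p′ φ′ ρ c} → Child p φ p′ φ′ → ¬ Modal φ →
    (∀ {x} → x ∈ freeVars φ′ → x ∈ freeVars φ) → State p φ ρ c → State p′ φ′ ρ c
  state-child {φ = φ} {φ′ = φ′} {ρ} ch ¬mo sub (state m anc wo env) =
    state (node-child m ch) (ancestor-child m ch ¬mo anc) wo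
      (env-weaken {φ = φ} {ψ = φ′} {ρ} (<⇒≤ (child-< ch)) sub env)

  state-box : ∀ {p φ ρ c} → State p (□ φ) ρ c → State (suc p) φ ρ p
  state-box {φ = φ} {ρ} (state m anc wo env) =
    state (node-child m □₁) (ancestor-modal m □₁ □ₘ) (stays (next-box m))
      (env-weaken {φ = φ} {ψ = φ} {ρ} (<⇒≤ ≤-refl) (λ x∈ → x∈) env)

  state-at : ∀ {p x φ ρ c} → State p (at[ x ] φ) ρ c → State (nameEnd (suc p) x) φ ρ (ρ x)
  state-at {p} {x} {φ} {ρ} (state m anc wo env) =
    state (node-child m at₁) (ancestor-modal m at₁ atₘ) there′
      (env-weaken {φ = at[ x ] φ} {ψ = φ} {ρ} (<⇒≤ (child-< {φ = at[ x ] φ} at₁)) there env)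
    where
    there′ : World p (ρ x)
    there′ = let (b , lt , bo , wo′) = env (here refl)
                 nm = enc-named {φ = at[ x ] φ} {x = x} atₙ (occurs-enc m)
             in goes (trans (next-at m) (binderOf-unique (binder-of nm) bo)) lt wo′

  state-bind : ∀ {p x φ ρ c} → State p (↓[ x ] φ) ρ c → State (nameEnd (suc p) x) φ (ρ [ x ↦ c ]) c
  state-bind {p} {x} {φ} {ρ} {c} st@(state m anc wo env) =
    state (node-child m ↓₁) (ancestor-child m ↓₁ (λ ()) anc) wo env′
    where
    lt₁ : p < nameEnd (suc p) x
    lt₁ = child-< {φ = ↓[ x ] φ} ↓₁
    env′ : ∀ {y} → y ∈ freeVars φ → ∃[ b ] (b < nameEnd (suc p) x × BinderOf y b × World b ((ρ [ x ↦ c ]) y))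
    env′ {y} y∈ with update-view x y
    -- `binds-once` ensures that the search for `x` finds this binder, and the chain from it ends in
    -- the current world.
    ... | hit refl u = p , lt₁ , bound (φ , m) (λ i b → ≤-reflexive (binds-once b (φ , m))) ,
                       subst (World p) (symm (u ρ c)) (state-next st refl refl)
    ... | miss x≢y u = let (b , lt , bo , wo′) = env (∈-filter⁺ (λ y → ¬? (x ≟ y)) y∈ x≢y)
                       in b , <-trans lt lt₁ , bo , subst (World b) (symm (u ρ c)) wo′

  truth-value : ∀ {p x ρ c} → State p (var x) ρ c → truth p ≡ num (does (c ≟ ρ x))
  truth-value {p} {x} {ρ} {c} st@(state m _ _ env) =
    let (b , lt , bo , wo) = env (here refl)
        nm    = occurs-enc m
        p≤    = m≤n⇒m≤1+n (occurs-≤ m)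
        b≤    = ≤-trans (<⇒≤ lt) p≤
        wo₀   = state-next st refl refl
        here′ = point-world wo₀ p≤
        bind′ = trans (cong point (binderOf-unique (binder-of {x = x} nm) bo)) (point-world wo b≤)
    in trans (truth-def p) (trans (⟦eq⟧ v0 v1 {point p ∷ point (binder p) ∷ []}
           (≤-trans (≤-reflexive here′) (≤-trans (world-≤ wo₀) p≤))
           (≤-trans (≤-reflexive bind′) (≤-trans (world-≤ wo) b≤)))
         (cong₂ (λ u v → num (does (u ≟ v))) here′ bind′))


  -- The case distinctions of `evalPosition` and `evalValue` with the values of their subterms as
  -- parameters, so that opaque values can be substituted by congruence.
  newPosition : (p c s s′ u : ℕ) → ℕ
  newPosition p c s s′ u =
    if is⊣ (at p) then p else (if is⊢ (at c)
      then (if on atom? (at p) then s else (if on name? (at p) then s′ else u)) else s)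

  newValue : (p v c t : ℕ) → ℕ
  newValue p v c t =
    if is⊣ (at p) then v else (if is⊢ (at c)
      then (if on top? (at p) then 1 else (if on bot? (at p) then 0 else (if on x? (at p) then t else v))) else v)

  evalStep : ℕ × ℕ → ℕ × ℕ
  evalStep = both (λ p v → newPosition p (cut p v) (skip p) (skip (moveHead w right p)) (moveHead w right p))
                  (λ p v → newValue p v (cut p v) (truth p))

  evalStep-enter : ∀ {p v a} → at p ≡ sym a → cut p v ≡ 0 → evalStep (p , v) ≡
    ((if atom? a then skip p else (if name? a then skip (suc p) else suc p)) ,
     (if top? a then 1 else (if bot? a then 0 else (if x? a then truth p else v))))
  evalStep-enter {p} {v} {a} eq cut≡ = cong₂ _,_
    (trans (cong₂ (λ c u → newPosition p c (skip p) (skip u) u) cut≡ (up≡suc (at-≤ eq)))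
           (cong (λ i → if is⊣ i then p else (if on atom? i then skip p else (if on name? i then skip (suc p) else suc p))) eq))
    (trans (cong (λ c → newValue p v c (truth p)) cut≡)
           (cong (λ i → if is⊣ i then v else (if on top? i then 1 else (if on bot? i then 0 else (if on x? i then truth p else v)))) eq))

  evalStep-cut : ∀ {p v a} → at p ≡ sym a → 0 < cut p v → evalStep (p , v) ≡ (skip p , v)
  evalStep-cut {p} {v} eq pos = cong₂ _,_
    (trans (⊣-before {v = p} (at-≤ eq)) (⊢-pos {v = cut p v} pos))
    (trans (⊣-before {v = p} (at-≤ eq)) (⊢-pos {v = cut p v} pos))

  data Binary : Formula → Formula → Set where
    ∧ₐ : ∀ {φ ψ} → Binary (φ ∧ ψ) φ
    ∨ₐ : ∀ {φ ψ} → Binary (φ ∨ ψ) φ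

  binary-end : ∀ {q χ α} → Binary χ α → end (suc q) α < end q χ
  binary-end (∧ₐ {φ} {ψ}) = <-end _ ψ
  binary-end (∨ₐ {φ} {ψ}) = <-end _ ψ

  binary-child : ∀ {q χ α p φ} → Binary χ α → Child q χ p φ → (p ≡ suc q × φ ≡ α) ⊎ p ≡ end (suc q) α
  binary-child ∧ₐ ∧ˡ = inj₁ (refl , refl)
  binary-child ∧ₐ ∧ʳ = inj₂ refl
  binary-child ∨ₐ ∨ˡ = inj₁ (refl , refl)
  binary-child ∨ₐ ∨ʳ = inj₂ refl

  -- An occurrence has only one parent: every other relative position of the two operators
  -- contradicts the inclusion or disjointness of spans.
  right-argument : ∀ {p φ p′ φ′ q χ α} → Occurs p φ → Child p φ p′ φ′ →
    Occurs q χ → Binary χ α → end (suc q) α ≡ p′ → q ≡ p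
  right-argument {p} {φ} {p′} {φ′} {q} {χ} {α} m c m′ bi refl with laminar m′ m
  ... | above here        = refl
  ... | below here        = refl
  ... | precedes le       = contradiction (≤-trans (binary-end bi) (≤-trans le (<⇒≤ (child-< c)))) 1+n≰n
  ... | follows le        = contradiction (≤-trans (<-end p′ φ′) (≤-trans (child-end c) (≤-trans le (<⇒≤ (<-trans ≤-refl (<-end (suc q) α)))))) 1+n≰n
  ... | above (step c′ l) with binary-child bi c′
  ...   | inj₁ (refl , refl) = contradiction (≤-trans (<-end p′ φ′) (≤-trans (child-end c) (node-end l))) 1+n≰n
  ...   | inj₂ refl          = contradiction (≤-trans (child-< c) (node-≤ l)) 1+n≰n
  right-argument {p} {φ} {p′} {φ′} {q} {χ} {α} m c m′ bi refl | below (step c′ l) with siblings c c′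
  ...   | same refl refl = contradiction (≤-trans (<-trans ≤-refl (<-end (suc q) α)) (node-≤ l)) 1+n≰n
  ...   | precedes le    = contradiction (≤-trans (<-end p′ φ′) (≤-trans le (≤-trans (node-≤ l) (<⇒≤ (<-trans ≤-refl (<-end (suc q) α)))))) 1+n≰n
  ...   | follows le     = contradiction (≤-trans (binary-end bi) (≤-trans (node-end l) le)) 1+n≰n

  data Determined (p v : ℕ) : Formula → ℕ → Set where
    conj : ∀ {φ ψ} → end (suc p) φ ≡ v → Determined p v (φ ∧ ψ) 0
    disj : ∀ {φ ψ u} → end (suc p) φ ≡ v → 0 < u → Determined p v (φ ∨ ψ) u

  cut-child : ∀ {p φ p′ φ′ v} → Occurs p φ → Child p φ p′ φ′ → cut p′ v ⊩ Determined p p′ φ v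
  cut-child {p} {φ} {p′} {φ′} {v} m c =
    ⊩-resp ⇒ ⇐ (cut-⊩ (m≤n⇒m≤1+n (occurs-≤ (node-child m c))))
    where
    ⇒ : (∃[ q ] Cut p′ v q) → Determined p p′ φ v
    ⇒ (q , conj m′ eq refl) with right-argument m c m′ ∧ₐ eq
    ... | refl with node-unique m m′
    ... | refl = conj eq
    ⇒ (q , disj m′ eq pos) with right-argument m c m′ ∨ₐ eq
    ... | refl with node-unique m m′
    ... | refl = disj eq pos
    ⇐ : Determined p p′ φ v → ∃[ q ] Cut p′ v q
    ⇐ (conj eq)     = p , conj m eq refl
    ⇐ (disj eq pos) = p , disj m eq pos

  -- No right argument starts where a first argument starts, so a value left over from earlier
  -- reading cannot cause a cut.
  first-uncut : ∀ {p φ p′ φ′} v → Occurs p φ → Child p φ p′ φ′ →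
    (∀ {α} → Binary φ α → p′ ≢ end (suc p) α) → cut p′ v ≡ 0
  first-uncut v m c ≢ = no⇒ (cut-child m c)
    λ { (conj eq) → ≢ ∧ₐ (symm eq) ; (disj eq _) → ≢ ∨ₐ (symm eq) }

  left-≢ : ∀ {p} φ → suc p ≢ end (suc p) φ
  left-≢ {p} φ eq = <-irrefl eq (<-end (suc p) φ)

  -- The incoming `v` is arbitrary as long as it causes no cut, since the first atom reached
  -- overwrites it. After the left argument of ∧ or ∨, either its value decides and survives the
  -- skipping of the right one, or the right one supplies the value of the whole.
  eval-run : ∀ {p ρ c} φ v → State p φ ρ c → cut p v ≡ 0 →
    Reaches evalStep (p , v) (end p φ , num (ev ρ c p φ))

  eval-skip : ∀ {p φ v} → Occurs p φ → 0 < cut p v → Reaches evalStep (p , v) (end p φ , v)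
  eval-skip {p} {φ} m pos = reach-step
    (trans (evalStep-cut (occurs-head m) pos) (cong (_, _) (occurs-skip m))) (<-end p φ) reach-refl

  eval-run {p} (var x) v st cut≡ = reach-step
    (trans (evalStep-enter (occurs-head m) cut≡) (cong₂ _,_ (occurs-skip m) (truth-value st)))
    (<-end p (var x)) reach-refl
    where m = State.occurs st
  eval-run {p} top v st cut≡ = reach-step
    (trans (evalStep-enter (occurs-head m) cut≡) (cong (_, 1) (occurs-skip m))) ≤-refl reach-refl
    where m = State.occurs st
  eval-run {p} bot v st cut≡ = reach-step
    (trans (evalStep-enter (occurs-head m) cut≡) (cong (_, 0) (occurs-skip m))) ≤-refl reach-refl
    where m = State.occurs st
  eval-run {p} {ρ} {c} (φ ∧ ψ) v st cut≡ =
    reach-step (evalStep-enter (occurs-head m) cut≡) ≤-refl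
      (reach-trans (eval-run φ v (state-child {φ = φ ∧ ψ} {φ′ = φ} ∧ˡ (λ ()) ∈-++⁺ˡ st)
                      (first-uncut v m ∧ˡ λ { ∧ₐ → left-≢ φ }))
        (second (ev ρ c (suc p) φ) refl))
    where
    m  = State.occurs st
    m′ = node-child {φ = Φ} m (∧ʳ {φ = φ} {ψ})
    second : ∀ b → ev ρ c (suc p) φ ≡ b →
      Reaches evalStep (end (suc p) φ , num b) (end p (φ ∧ ψ) , num (b Bool.∧ ev ρ c (end (suc p) φ) ψ))
    second true  _ = eval-run ψ 1 (state-child {φ = φ ∧ ψ} {φ′ = ψ} ∧ʳ (λ ()) (∈-++⁺ʳ (freeVars φ)) st)
      (no⇒ (cut-child m ∧ʳ) λ ())
    second false _ = eval-skip m′ (⇒yes (cut-child m ∧ʳ) (conj refl))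
  eval-run {p} {ρ} {c} (φ ∨ ψ) v st cut≡ =
    reach-step (evalStep-enter (occurs-head m) cut≡) ≤-refl
      (reach-trans (eval-run φ v (state-child {φ = φ ∨ ψ} {φ′ = φ} ∨ˡ (λ ()) ∈-++⁺ˡ st)
                      (first-uncut v m ∨ˡ λ { ∨ₐ → left-≢ φ }))
        (second (ev ρ c (suc p) φ) refl))
    where
    m  = State.occurs st
    m′ = node-child {φ = Φ} m (∨ʳ {φ = φ} {ψ})
    second : ∀ b → ev ρ c (suc p) φ ≡ b →
      Reaches evalStep (end (suc p) φ , num b) (end p (φ ∨ ψ) , num (b Bool.∨ ev ρ c (end (suc p) φ) ψ))
    second true  _ = eval-skip m′ (⇒yes (cut-child m ∨ʳ) (disj refl (s≤s z≤n)))
    second false _ = eval-run ψ 0 (state-child {φ = φ ∨ ψ} {φ′ = ψ} ∨ʳ (λ ()) (∈-++⁺ʳ (freeVars φ)) st)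
      (no⇒ (cut-child m ∨ʳ) λ { (disj _ ()) })
  eval-run {p} (□ φ) v st cut≡ =
    reach-step (evalStep-enter (occurs-head m) cut≡) ≤-refl
      (eval-run φ v (state-box st) (first-uncut v m □₁ λ ()))
    where m = State.occurs st
  eval-run {p} (↓[ x ] φ) v st cut≡ =
    reach-step (trans (evalStep-enter (occurs-head m) cut≡)
                 (cong (_, v) (skip-end (var x) (enc-named {φ = ↓[ x ] φ} ↓ₙ (occurs-enc m)))))
      (child-< {φ = ↓[ x ] φ} ↓₁)
      (eval-run φ v (state-bind st) (first-uncut v m ↓₁ λ ()))
    where m = State.occurs st
  eval-run {p} (at[ x ] φ) v st cut≡ =
    reach-step (trans (evalStep-enter (occurs-head m) cut≡)
                 (cong (_, v) (skip-end (var x) (enc-named {φ = at[ x ] φ} atₙ (occurs-enc m)))))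
      (child-< {φ = at[ x ] φ} at₁)
      (eval-run φ v (state-at st) (first-uncut v m at₁ λ ()))
    where m = State.occurs st

  root-uncut : ∀ v → cut 1 v ≡ 0
  root-uncut v = no⇒ (cut-⊩ (s≤s z≤n)) λ
    { (q , conj {φ} m eq _) → contradiction (≤-trans (<-trans ≤-refl (<-end (suc q) φ)) (≤-reflexive eq)) (<⇒≱ (s≤s (node-≤ m)))
    ; (q , disj {φ} m eq _) → contradiction (≤-trans (<-trans ≤-refl (<-end (suc q) φ)) (≤-reflexive eq)) (<⇒≱ (s≤s (node-≤ m))) }

  evalStep-fixed : ∀ v → evalStep (suc n , v) ≡ (suc n , v)
  evalStep-fixed v = cong₂ _,_ (at-end (suc n) _) (at-end v _)
    where
    at-end : ∀ (a b : ℕ) → (if is⊣ (at (suc n)) then a else b) ≡ a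
    at-end a b = cong (λ i → if is⊣ i then a else b) (nth-length w)

  ⟦evalStep⟧ : ∀ s → both (λ p v → ⟦ evalPosition ⟧ w (p ∷ v ∷ [])) (λ p v → ⟦ evalValue ⟧ w (p ∷ v ∷ [])) s ≡ evalStep s
  ⟦evalStep⟧ (p , v) = cong₂ _,_
    (trans (cong (λ c → newPosition p c (⟦ skipT v0 ⟧ w ρ) (⟦ skipT (up v0) ⟧ w ρ) u) (⟦cut⟧ {p = p} {v} {[]}))
           (cong₂ (λ s s′ → newPosition p (cut p v) s s′ u) (⟦skip⟧ v0 {ρ}) (⟦skip⟧ (up v0) {ρ})))
    (cong₂ (newValue p v) (⟦cut⟧ {p = p} {v} {[]}) (⟦truth⟧ v0 {ρ}))
    where
    ρ = p ∷ v ∷ []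
    u = moveHead w right p

  ⟦eval⟧ : ⟦ evalT ⟧ w [] ≡ num (ev (const 0) 0 1 Φ)
  ⟦eval⟧ = trans (cong proj₂ (iterate-cong ⟦evalStep⟧ (suc n) (1 , 0)))
    (cong proj₂ (reach-iterate run fixed (suc n) (≤-trans (≤-reflexive whole) (n≤1+n (suc n)))))
    where
    run = eval-run Φ 0 start (root-uncut 0)
    fixed : evalStep (end 1 Φ , num (ev (const 0) 0 1 Φ)) ≡ (end 1 Φ , num (ev (const 0) 0 1 Φ))
    fixed = subst (λ q → evalStep (q , num (ev (const 0) 0 1 Φ)) ≡ (q , num (ev (const 0) 0 1 Φ)))
      (symm whole) (evalStep-fixed _)

  eval-⊩ : ⟦ evalT ⟧ w [] ⊩ Satisfiable Φ
  eval-⊩ = subst (_⊩ Satisfiable Φ) (symm ⟦eval⟧) (go _ refl)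
    where
    go : ∀ b → ev (const 0) 0 1 Φ ≡ b → num b ⊩ Satisfiable Φ
    go true  eq = ⊩-yes (s≤s z≤n) (Equivalence.from (satisfiable⇔ev Φ) eq)
    go false eq = ⊩-no λ s → contradiction (trans (symm eq) (Equivalence.to (satisfiable⇔ev Φ) s)) λ ()

-- Parsing

digitsEnd-length : ∀ p b → digitsEnd p b ≡ p + length (digits b)
digitsEnd-length p ℕᵇ.zero  = symm (+-identityʳ p)
digitsEnd-length p 2[1+ b ] = trans (digitsEnd-length (suc p) b) (symm (+-suc p _))
digitsEnd-length p 1+[2 b ] = trans (digitsEnd-length (suc p) b) (symm (+-suc p _))

nameEnd-length : ∀ p x → nameEnd p x ≡ p + length (encodeVar x)
nameEnd-length p x = trans (digitsEnd-length (suc p) (fromℕ x)) (symm (+-suc p _))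

length-append : ∀ {q} p (s t : List Symbol) → q ≡ p + length s → q + length t ≡ p + length (s ++ t)
length-append p s t refl = trans (+-assoc p _ _) (cong (p +_) (symm (length-++ s)))

end-length : ∀ p φ → end p φ ≡ p + length (encode φ)
end-length p (var x)     = nameEnd-length p x
end-length p top         = +-comm 1 p
end-length p bot         = +-comm 1 p
end-length p (φ ∧ ψ)     = trans (end-length _ ψ)
  (trans (length-append (suc p) (encode φ) (encode ψ) (end-length (suc p) φ)) (symm (+-suc p _)))
end-length p (φ ∨ ψ)     = trans (end-length _ ψ)
  (trans (length-append (suc p) (encode φ) (encode ψ) (end-length (suc p) φ)) (symm (+-suc p _)))
end-length p (□ φ)       = trans (end-length (suc p) φ) (symm (+-suc p _))
end-length p (↓[ x ] φ)  = trans (end-length _ φ)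
  (trans (length-append (suc p) (encodeVar x) (encode φ) (nameEnd-length (suc p) x)) (symm (+-suc p _)))
end-length p (at[ x ] φ) = trans (end-length _ φ)
  (trans (length-append (suc p) (encodeVar x) (encode φ) (nameEnd-length (suc p) x)) (symm (+-suc p _)))

encodes : ∀ {d} → Vec Formula d → List Symbol
encodes []       = []
encodes (φ ∷ φs) = encode φ ++ encodes φs

encode-head : ∀ φ → ∃[ s ] encode φ ≡ head φ ∷ s
encode-head (var x)     = _ , refl
encode-head top         = _ , refl
encode-head bot         = _ , refl
encode-head (φ ∧ ψ)     = _ , refl
encode-head (φ ∨ ψ)     = _ , refl
encode-head (□ φ)       = _ , refl
encode-head (↓[ x ] φ)  = _ , refl
encode-head (at[ x ] φ) = _ , refl

head-x : ∀ φ → x? (head φ) ≡ true → ∃[ x ] φ ≡ var x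
head-x (var x) _ = x , refl

module Syntax (w : List Symbol) where

  open Lookup w

  Reads : ℕ → List Symbol → Set
  Reads p []      = ⊤
  Reads p (a ∷ s) = at p ≡ sym a × Reads (suc p) s

  reads-input : Reads 1 w
  reads-input = go w 1 (λ i → refl)
    where
    go : ∀ s k → (∀ i → nth s i ≡ at (k + i)) → Reads k s
    go []      k eq = tt
    go (a ∷ s) k eq = trans (cong at (symm (+-identityʳ k))) (symm (eq 0)) ,
      go s (suc k) (λ i → trans (eq (suc i)) (cong at (+-suc k i)))

  reads-head : ∀ {p} φ r → Reads p (encode φ ++ r) → at p ≡ sym (head φ)
  reads-head φ r rd with encode φ | encode-head φ
  ... | _ | s , refl = proj₁ rd

  reads-digits : ∀ {p} b r → Reads p (digits b ++ r) → Reads (digitsEnd p b) r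
  reads-digits ℕᵇ.zero  r rd = rd
  reads-digits 2[1+ b ] r rd = reads-digits b r (proj₂ rd)
  reads-digits 1+[2 b ] r rd = reads-digits b r (proj₂ rd)

  reads-name : ∀ {p} x r → Reads p (encodeVar x ++ r) → Reads (nameEnd p x) r
  reads-name x r rd = reads-digits (fromℕ x) r (proj₂ rd)

  reads-assoc : ∀ {p} (s t r : List Symbol) → Reads p ((s ++ t) ++ r) → Reads p (s ++ t ++ r)
  reads-assoc s t r = subst (Reads _) (++-assoc s t r)

  reads-rest : ∀ {p} φ r → Reads p (encode φ ++ r) → Reads (end p φ) r
  reads-rest (var x)     r rd = reads-name x r rd
  reads-rest top         r rd = proj₂ rd
  reads-rest bot         r rd = proj₂ rd
  reads-rest (φ ∧ ψ)     r rd = reads-rest ψ r (reads-rest φ _ (reads-assoc (encode φ) (encode ψ) r (proj₂ rd)))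
  reads-rest (φ ∨ ψ)     r rd = reads-rest ψ r (reads-rest φ _ (reads-assoc (encode φ) (encode ψ) r (proj₂ rd)))
  reads-rest (□ φ)       r rd = reads-rest φ r (proj₂ rd)
  reads-rest (↓[ x ] φ)  r rd = reads-rest φ r (reads-name x _ (reads-assoc (encodeVar x) (encode φ) r (proj₂ rd)))
  reads-rest (at[ x ] φ) r rd = reads-rest φ r (reads-name x _ (reads-assoc (encodeVar x) (encode φ) r (proj₂ rd)))

  reads-sep : ∀ {p} φ r → Reads p (encode φ ++ r) → Sep p
  reads-sep φ r rd = trans (cong (on digit?) (reads-head φ r rd)) (head-nondigit φ)

  digits-read : ∀ {p} b r → Reads p (digits b ++ r) → Sep (digitsEnd p b) → Digits p b
  digits-read ℕᵇ.zero  r rd s = s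
  digits-read 2[1+ b ] r rd s = proj₁ rd , digits-read b r (proj₂ rd) s
  digits-read 1+[2 b ] r rd s = proj₁ rd , digits-read b r (proj₂ rd) s

  name-read : ∀ {p} x r → Reads p (encodeVar x ++ r) → Sep (nameEnd p x) → Name p x
  name-read x r rd s = proj₁ rd , digits-read (fromℕ x) r (proj₂ rd) s

  -- A separator within the text is supplied by what follows, since the head of a formula is not a
  -- digit; only the one at the very end has to be assumed.
  enc-read : ∀ {p} φ r → Reads p (encode φ ++ r) → Sep (end p φ) → Enc p φ
  enc-read (var x) r rd s = name-read x r rd s
  enc-read top     r rd s = proj₁ rd , s
  enc-read bot     r rd s = proj₁ rd , s
  enc-read (φ ∧ ψ) r rd s =
    let rd₁ = reads-assoc (encode φ) (encode ψ) r (proj₂ rd)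
        rd₂ = reads-rest φ (encode ψ ++ r) rd₁
    in proj₁ rd , enc-read φ _ rd₁ (reads-sep ψ r rd₂) , enc-read ψ r rd₂ s
  enc-read (φ ∨ ψ) r rd s =
    let rd₁ = reads-assoc (encode φ) (encode ψ) r (proj₂ rd)
        rd₂ = reads-rest φ (encode ψ ++ r) rd₁
    in proj₁ rd , enc-read φ _ rd₁ (reads-sep ψ r rd₂) , enc-read ψ r rd₂ s
  enc-read (□ φ) r rd s = proj₁ rd , enc-read φ r (proj₂ rd) s
  enc-read (↓[ x ] φ) r rd s =
    let rd₁ = reads-assoc (encodeVar x) (encode φ) r (proj₂ rd)
        rd₂ = reads-name x (encode φ ++ r) rd₁
    in proj₁ rd , name-read x _ rd₁ (reads-sep φ r rd₂) , enc-read φ r rd₂ s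
  enc-read (at[ x ] φ) r rd s =
    let rd₁ = reads-assoc (encodeVar x) (encode φ) r (proj₂ rd)
        rd₂ = reads-name x (encode φ ++ r) rd₁
    in proj₁ rd , name-read x _ rd₁ (reads-sep φ r rd₂) , enc-read φ r rd₂ s

  at-last : at (suc n) ≡ ⊣
  at-last = nth-length w

  whole-encode : ∀ φ → w ≡ encode φ → end 1 φ ≡ suc n
  whole-encode φ eq = trans (end-length 1 φ) (cong (suc ∘ length) (symm eq))

  enc-encode : ∀ φ → w ≡ encode φ → Enc 1 φ
  enc-encode φ eq = enc-read φ [] (subst (Reads 1) (trans eq (symm (++-identityʳ _))) reads-input)
    (trans (cong (λ p → on digit? (at p)) (whole-encode φ eq)) (cong (on digit?) at-last))

  data Misplaced (j : ℕ) : Set where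
    unnamed : on name? (at j) ≡ true → on x? (at (suc j)) ≡ false → Misplaced j
    stray   : on name? (at j) ≡ false → on digit? (at (suc j)) ≡ true → on numeral? (at j) ≡ false → Misplaced j

  misplaced-⊩ : ∀ j r → j ≤ n → ⟦ misplacedT ⟧ w (j ∷ r ∷ []) ⊩ Misplaced j
  misplaced-⊩ j r le = subst (λ i → table₄ (on name? (at j)) (on x? (at i)) (on digit? (at i)) (on numeral? (at j)) ⊩ Misplaced j)
    (symm (up≡suc le)) (go _ _ _ _ refl refl refl refl)
    where
    table₄ : (a b c d : Bool) → ℕ
    table₄ a b c d = if a then (if b then 0 else 1) else (if c then (if d then 0 else 1) else 0)
    go : ∀ a b c d → on name? (at j) ≡ a → on x? (at (suc j)) ≡ b → on digit? (at (suc j)) ≡ c →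
      on numeral? (at j) ≡ d → table₄ a b c d ⊩ Misplaced j
    go true  true  c     d     ea eb ec ed = ⊩-no λ { (unnamed _ e) → contradiction (trans (symm eb) e) λ ()
                                                    ; (stray e _ _) → contradiction (trans (symm ea) e) λ () }
    go true  false c     d     ea eb ec ed = ⊩-yes (s≤s z≤n) (unnamed ea eb)
    go false b     true  true  ea eb ec ed = ⊩-no λ { (unnamed e _) → contradiction (trans (symm ea) e) λ ()
                                                    ; (stray _ _ e) → contradiction (trans (symm ed) e) λ () }
    go false b     true  false ea eb ec ed = ⊩-yes (s≤s z≤n) (stray ea ec ed)
    go false b     false d     ea eb ec ed = ⊩-no λ { (unnamed e _) → contradiction (trans (symm ea) e) λ ()
                                                    ; (stray _ e _) → contradiction (trans (symm ec) e) λ () }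

  -- A list of formulas, possibly preceded by the digits of a variable that
  -- starts further to the left.
  record Parse (v : List Symbol) (d : ℕ) : Set where
    constructor parsed
    field
      prefix   : ℕᵇ
      formulas : Vec Formula d
      text     : v ≡ digits prefix ++ encodes formulas

  module _ (placed : ∀ j → j ≤ n → ¬ Misplaced j) where

    no-digit : ∀ {p a} b r → at p ≡ sym a → numeral? a ≡ false → Reads (suc p) (digits b ++ r) → b ≡ ℕᵇ.zero
    no-digit ℕᵇ.zero r eq num rd = refl
    no-digit {p} {a} 2[1+ b ] r eq num rd with name? a in nm
    ... | true  = contradiction (unnamed (trans (cong (on name?) eq) nm) (cong (on x?) (proj₁ rd))) (placed p (at-≤ eq))
    ... | false = contradiction (stray (trans (cong (on name?) eq) nm) (cong (on digit?) (proj₁ rd))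
                                       (trans (cong (on numeral?) eq) num)) (placed p (at-≤ eq))
    no-digit {p} {a} 1+[2 b ] r eq num rd with name? a in nm
    ... | true  = contradiction (unnamed (trans (cong (on name?) eq) nm) (cong (on x?) (proj₁ rd))) (placed p (at-≤ eq))
    ... | false = contradiction (stray (trans (cong (on name?) eq) nm) (cong (on digit?) (proj₁ rd))
                                       (trans (cong (on numeral?) eq) num)) (placed p (at-≤ eq))

    -- Induction on the remaining input: the formulas are assembled from the right, and the count at
    -- each position tells how many the rest must consist of. `k` is the number of iterations left,
    -- at least one for each symbol.
    parse : ∀ v {p d k x} → Reads p v → p + length v ≡ suc n → d ≤ p → length v ≤ k →
      iterate k skipStep (p , d) ≡ (x , 0) → at x ≡ ⊣ → Parse v d

    parse-next : ∀ {a} v {p d d′ k x} → at p ≡ sym a → Reads (suc p) v → p + suc (length v) ≡ suc n →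
      d′ ≤ suc p → suc (length v) ≤ k → skipStep (p , d) ≡ (suc p , d′) →
      iterate k skipStep (p , d) ≡ (x , 0) → at x ≡ ⊣ → Parse v d′
    parse-next v {p} eq rd len le (s≤s {n = k} k≥) next≡ run halted =
      parse v rd (trans (symm (+-suc p _)) len) le k≥ (trans (cong (iterate k skipStep) (symm next≡)) run) halted

    -- Digits directly behind a symbol that is no part of a variable would be misplaced, so the
    -- prefix is empty.
    clean : ∀ {p a v d} → at p ≡ sym a → numeral? a ≡ false → Reads (suc p) v → Parse v d →
      ∃[ φs ] v ≡ encodes {d} φs
    clean eq num rd (parsed b φs refl) with no-digit b (encodes φs) eq num rd
    ... | refl = φs , refl

    -- The count treats the name as one more formula; correct placement forces that formula to start
    -- with ‵x, hence to be a variable.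
    named : ∀ {p a v d} → at p ≡ sym a → numeral? a ≡ false → name? a ≡ true → Reads (suc p) v → Parse v (suc d) →
      ∃[ x ] ∃[ φs ] v ≡ encodeVar x ++ encodes {d} φs
    named {p} {v = v} eq num nm rd pr with clean eq num rd pr
    ... | φ ∷ φs , refl with on x? (at (suc p)) in ex
    ...   | false = contradiction (unnamed (trans (cong (on name?) eq) nm) ex) (placed p (at-≤ eq))
    ...   | true with head-x φ (trans (cong (on x?) (symm (reads-head φ (encodes φs) rd))) ex)
    ...     | x , refl = x , φs , refl

    parse-digit : ∀ {a v d} (f : ℕᵇ → ℕᵇ) → (∀ b → digits (f b) ≡ a ∷ digits b) → Parse v d → Parse (a ∷ v) d
    parse-digit f eq (parsed b φs refl) = parsed (f b) φs (cong (_++ encodes φs) (symm (eq b)))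

    -- With nothing left to read, the loop moves over digits only and rests at any other symbol.
    stuck : ∀ {p a k x} → at p ≡ sym a → digit? a ≡ false → iterate k skipStep (p , 0) ≡ (x , 0) → at x ≢ ⊣
    stuck {p} {k = k} eq nd run halted with trans (symm run) (iterate-fixed (skip-fixed {p} (trans (cong (on digit?) eq) nd)) k)
    ... | refl = contradiction (trans (symm eq) halted) λ ()

    parse [] {p} {zero} rd len le k≥ run halted = parsed ℕᵇ.zero [] refl
    -- At the end marker `up` saturates and the count stays positive, so the loop could never reach
    -- count 0.
    parse [] {p} {suc d} {k} rd len le k≥ run halted
      with trans (symm run) (iterate-fixed (fixed p (trans (symm (+-identityʳ p)) len)) k)
      where
      fixed : ∀ p → p ≡ suc n → skipStep (p , suc d) ≡ (p , suc d)
      fixed p refl rewrite symbolAt-pos w d | at-last = cong (_, suc d) (m≥n⇒m⊓n≡n (n≤1+n (suc n)))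
    ... | ()
    parse (‵1 ∷ v) {d = d} (eq , rd) len le k≥ run halted =
      parse-digit 1+[2_] (λ _ → refl)
        (parse-next v eq rd len (m≤n⇒m≤1+n le) k≥ (skip-digit d eq refl refl refl) run halted)
    parse (‵2 ∷ v) {d = d} (eq , rd) len le k≥ run halted =
      parse-digit 2[1+_] (λ _ → refl)
        (parse-next v eq rd len (m≤n⇒m≤1+n le) k≥ (skip-digit d eq refl refl refl) run halted)
    parse (‵x  ∷ v) {d = zero} {k} (eq , rd) len le k≥ run halted = contradiction halted (stuck {k = k} eq refl run)
    parse (‵⊤  ∷ v) {d = zero} {k} (eq , rd) len le k≥ run halted = contradiction halted (stuck {k = k} eq refl run)
    parse (‵⊥  ∷ v) {d = zero} {k} (eq , rd) len le k≥ run halted = contradiction halted (stuck {k = k} eq refl run)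
    parse (‵∧  ∷ v) {d = zero} {k} (eq , rd) len le k≥ run halted = contradiction halted (stuck {k = k} eq refl run)
    parse (‵∨  ∷ v) {d = zero} {k} (eq , rd) len le k≥ run halted = contradiction halted (stuck {k = k} eq refl run)
    parse (‵□  ∷ v) {d = zero} {k} (eq , rd) len le k≥ run halted = contradiction halted (stuck {k = k} eq refl run)
    parse (‵↓  ∷ v) {d = zero} {k} (eq , rd) len le k≥ run halted = contradiction halted (stuck {k = k} eq refl run)
    parse (‵at ∷ v) {d = zero} {k} (eq , rd) len le k≥ run halted = contradiction halted (stuck {k = k} eq refl run)
    parse (‵x ∷ v) {d = suc d} (eq , rd) len le k≥ run halted
      with parse-next v eq rd len (m≤n⇒m≤1+n (<⇒≤ le)) k≥ (skip-atom d eq refl refl) run halted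
    -- The digits left over in front of the rest are the numeral of this variable.
    ... | parsed b φs refl = parsed ℕᵇ.zero (var (ℕᵇ.toℕ b) ∷ φs)
      (cong (λ b′ → ‵x ∷ digits b′ ++ encodes φs) (symm (ℕᵇ.fromℕ-toℕ b)))
    parse (‵⊤ ∷ v) {d = suc d} (eq , rd) len le k≥ run halted
      with clean eq refl rd (parse-next v eq rd len (m≤n⇒m≤1+n (<⇒≤ le)) k≥ (skip-atom d eq refl refl) run halted)
    ... | φs , refl = parsed ℕᵇ.zero (top ∷ φs) refl
    parse (‵⊥ ∷ v) {d = suc d} (eq , rd) len le k≥ run halted
      with clean eq refl rd (parse-next v eq rd len (m≤n⇒m≤1+n (<⇒≤ le)) k≥ (skip-atom d eq refl refl) run halted)
    ... | φs , refl = parsed ℕᵇ.zero (bot ∷ φs) refl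
    parse (‵∧ ∷ v) {d = suc d} (eq , rd) len le k≥ run halted
      with clean eq refl rd (parse-next v eq rd len (s≤s le) k≥ (skip-binary d eq refl le) run halted)
    ... | φ ∷ ψ ∷ φs , refl = parsed ℕᵇ.zero ((φ ∧ ψ) ∷ φs) (cong (‵∧ ∷_) (symm (++-assoc (encode φ) _ _)))
    parse (‵∨ ∷ v) {d = suc d} (eq , rd) len le k≥ run halted
      with clean eq refl rd (parse-next v eq rd len (s≤s le) k≥ (skip-binary d eq refl le) run halted)
    ... | φ ∷ ψ ∷ φs , refl = parsed ℕᵇ.zero ((φ ∨ ψ) ∷ φs) (cong (‵∨ ∷_) (symm (++-assoc (encode φ) _ _)))
    parse (‵□ ∷ v) {d = suc d} (eq , rd) len le k≥ run halted
      with clean eq refl rd (parse-next v eq rd len (m≤n⇒m≤1+n le) k≥ (skip-box d eq refl refl) run halted)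
    ... | φ ∷ φs , refl = parsed ℕᵇ.zero ((□ φ) ∷ φs) refl
    parse (‵↓ ∷ v) {d = suc d} (eq , rd) len le k≥ run halted
      with named eq refl refl rd (parse-next v eq rd len (s≤s le) k≥ (skip-binary d eq refl le) run halted)
    ... | x , ψ ∷ φs , refl = parsed ℕᵇ.zero ((↓[ x ] ψ) ∷ φs) (cong (‵↓ ∷_) (symm (++-assoc (encodeVar x) _ _)))
    parse (‵at ∷ v) {d = suc d} (eq , rd) len le k≥ run halted
      with named eq refl refl rd (parse-next v eq rd len (s≤s le) k≥ (skip-binary d eq refl le) run halted)
    ... | x , ψ ∷ φs , refl = parsed ℕᵇ.zero ((at[ x ] ψ) ∷ φs) (cong (‵at ∷_) (symm (++-assoc (encodeVar x) _ _)))

    parse-input : ∀ {x} → iterate (suc n) skipStep (1 , 1) ≡ (x , 0) → at x ≡ ⊣ → ∃[ φ ] w ≡ encode φ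
    parse-input run halted with parse w {k = suc n} reads-input refl ≤-refl (n≤1+n n) run halted
    ... | parsed ℕᵇ.zero  (φ ∷ []) text = φ , trans text (++-identityʳ _)
    ... | parsed 2[1+ b ] φs text =
      contradiction (stray refl (cong (on digit?) (proj₁ (subst (Reads 1) text reads-input))) refl) (placed 0 z≤n)
    ... | parsed 1+[2 b ] φs text =
      contradiction (stray refl (cong (on digit?) (proj₁ (subst (Reads 1) text reads-input))) refl) (placed 0 z≤n)

  enc-second : ∀ {p} φ → Enc p φ → x? (head φ) ≡ true ⊎ Sep (suc p)
  enc-second (var x)     e           = inj₁ refl
  enc-second top         (_ , s)     = inj₂ s
  enc-second bot         (_ , s)     = inj₂ s
  enc-second (φ ∧ ψ)     (_ , e , _) = inj₂ (trans (cong (on digit?) (enc-head φ e)) (head-nondigit φ))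
  enc-second (φ ∨ ψ)     (_ , e , _) = inj₂ (trans (cong (on digit?) (enc-head φ e)) (head-nondigit φ))
  enc-second (□ φ)       (_ , e)     = inj₂ (trans (cong (on digit?) (enc-head φ e)) (head-nondigit φ))
  enc-second (↓[ x ] φ)  (_ , d , _) = inj₂ (cong (on digit?) (proj₁ d))
  enc-second (at[ x ] φ) (_ , d , _) = inj₂ (cong (on digit?) (proj₁ d))

  module _ (φ : Formula) (text : w ≡ encode φ) where

    open Analysis w φ (enc-encode φ text) (whole-encode φ text)
      using (operator-by; located; node; name; digit; occurs-enc; occurs-head)

    head-name : ∀ χ → name? (head χ) ≡ true → ∃[ x ] Named χ x
    head-name (↓[ x ] χ)  _ = x , ↓ₙ
    head-name (at[ x ] χ) _ = x , atₙ

    x-numeral : ∀ a → x? a ≡ true → numeral? a ≡ true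
    x-numeral ‵x _ = refl

    digit-numeral : ∀ a → digit? a ≡ true → numeral? a ≡ true
    digit-numeral ‵1 _ = refl
    digit-numeral ‵2 _ = refl

    follows-numeral : ∀ {j} → on digit? (at (suc j)) ≡ true → on numeral? (at j) ≡ false → ⊥
    follows-numeral {j} eq num = go (at j) refl
      where
      go : ∀ c → at j ≡ c → ⊥
      go ⊣ e = ⊣-last j (proj₂ (bounded⇒ (proj₁ (proj₂ (on-sym digit? (at (suc j)) eq))))) e
        where
        ⊣-last : ∀ j → suc j ≤ n → at j ≢ ⊣
        ⊣-last j le e = contradiction (trans (symm (cong is⊣ e)) (symbolAt-end w (<⇒≤ le))) λ ()
      go ⊢ e = first j eq e
        where
        first : ∀ j → on digit? (at (suc j)) ≡ true → at j ≡ ⊢ → ⊥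
        first zero    eq _ = contradiction
          (trans (symm eq) (trans (cong (on digit?) (enc-head φ (enc-encode φ text))) (head-nondigit φ))) λ ()
        first (suc i) _  e = contradiction (trans (symm (cong is⊢ e)) (symbolAt-pos w i)) λ ()
      go (sym a) e with located {j} e
      ... | digit d = contradiction (trans (symm num) (trans (cong (on numeral?) e)
                        (digit-numeral a (trans (cong (on digit?) (symm e)) d)))) λ ()
      ... | name m nm j≡ = contradiction (trans (symm num) (trans (cong (λ i → on numeral? (at i)) j≡)
                              (cong (on numeral?) (proj₁ (enc-named nm (occurs-enc m)))))) λ ()
      ... | node {χ} m with enc-second χ (occurs-enc m)
      ...   | inj₁ hx = contradiction (trans (symm num) (trans (cong (on numeral?) (occurs-head m)) (x-numeral (head χ) hx))) λ ()
      ...   | inj₂ s  = contradiction (trans (symm eq) s) λ ()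

    well-placed : ∀ j → ¬ Misplaced j
    well-placed j (stray _ dg num) = follows-numeral dg num
    well-placed j (unnamed nm nx) with operator-by name? {j} (λ { ‵↓ _ → refl , refl ; ‵at _ → refl , refl }) nm
    ... | χ , m , eq with head-name χ eq
    ... | x , nd = contradiction (trans (symm nx) (cong (on x?) (proj₁ (enc-named nd (occurs-enc m))))) λ ()

  syntax-⊩ : ⟦ syntaxT ⟧ w [] ⊩ (∃[ φ ] w ≡ encode φ)
  syntax-⊩ = go (search misplacedT {[]} misplaced-⊩)
    where
    accepts : ℕ × ℕ → ℕ
    accepts (x , y) = if is⊢ (at y) then (if is⊣ (at x) then 1 else 0) else 0

    sound : ∀ s → iterate (suc n) skipStep (1 , 1) ≡ s → (∀ j → j ≤ n → ¬ Misplaced j) →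
      0 < accepts s → ∃[ φ ] w ≡ encode φ
    sound (x , suc y) run placed pos = contradiction (subst (0 <_) (⊢-pos {v = suc y} (s≤s z≤n)) pos) λ ()
    sound (x , zero) run placed pos = parse-input placed run (at-end (at x) refl pos)
      where
      at-end : ∀ c → at x ≡ c → 0 < (if is⊣ (at x) then 1 else 0) → at x ≡ ⊣
      at-end ⊣ e _ = e
      at-end ⊢ e pos = contradiction (subst (λ c → 0 < (if is⊣ c then 1 else 0)) e pos) λ ()
      at-end (sym a) e pos = contradiction (subst (λ c → 0 < (if is⊣ c then 1 else 0)) e pos) λ ()

    go : ∀ {r} → Largest Misplaced r →
      (if is⊢ (at r) then accepts (iterate (suc n) skipStep (1 , 1)) else 0) ⊩ (∃[ φ ] w ≡ encode φ)
    go (found {j} _ bad _) = subst (_⊩ _) (symm (⊢-pos {v = suc j} (s≤s z≤n)))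
      (⊩-no λ (φ , text) → well-placed φ text j bad)
    go (absent placed) = mk⇔ (sound _ refl placed) λ (φ , text) → subst (λ s → 0 < accepts s)
      (symm (trans (skip-run φ (enc-encode φ text)) (cong (_, 0) (whole-encode φ text))))
      (subst (λ c → 0 < (if is⊣ c then 1 else 0)) (symm at-last) (s≤s z≤n))

-- The convention on variables

unique-++⁻ : ∀ {A : Set} (xs : List A) {ys} → Unique (xs ++ ys) → Unique xs × Unique ys × Disjoint xs ys
unique-++⁻ []       u        = [] , u , λ { (() , _) }
unique-++⁻ (x ∷ xs) {ys} (x∉ ∷ u) =
  let (u₁ , u₂ , dis) = unique-++⁻ xs u
      (x∉xs , x∉ys)   = All.++⁻ xs x∉
  in x∉xs ∷ u₁ , u₂ , disjoint x∉ys dis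
  where
  disjoint : All (x ≢_) ys → Disjoint xs ys → Disjoint (x ∷ xs) ys
  disjoint x∉ys dis (here refl , ∈ys) = All.lookup x∉ys ∈ys refl
  disjoint x∉ys dis (there ∈xs , ∈ys) = dis (∈xs , ∈ys)

lift-binder : ∀ {p φ p′ φ′ q x} → Child p φ p′ φ′ → Binder p′ φ′ q x → Binder p φ q x
lift-binder c (ψ , m) = ψ , step c m

bound⇒binder : ∀ p φ {x} → x ∈ boundVars φ → ∃[ q ] Binder p φ q x
bound⇒binder p (φ ∧ ψ) x∈ with ∈-++⁻ (boundVars φ) x∈
... | inj₁ x∈φ = let (q , b) = bound⇒binder _ φ x∈φ in q , lift-binder ∧ˡ b
... | inj₂ x∈ψ = let (q , b) = bound⇒binder _ ψ x∈ψ in q , lift-binder ∧ʳ b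
bound⇒binder p (φ ∨ ψ) x∈ with ∈-++⁻ (boundVars φ) x∈
... | inj₁ x∈φ = let (q , b) = bound⇒binder _ φ x∈φ in q , lift-binder ∨ˡ b
... | inj₂ x∈ψ = let (q , b) = bound⇒binder _ ψ x∈ψ in q , lift-binder ∨ʳ b
bound⇒binder p (□ φ) x∈ = let (q , b) = bound⇒binder _ φ x∈ in q , lift-binder □₁ b
bound⇒binder p (↓[ x ] φ) (here refl) = p , φ , here
bound⇒binder p (↓[ x ] φ) (there x∈)  = let (q , b) = bound⇒binder _ φ x∈ in q , lift-binder ↓₁ b
bound⇒binder p (at[ x ] φ) x∈ = let (q , b) = bound⇒binder _ φ x∈ in q , lift-binder at₁ b

binder⇒bound : ∀ {p φ q x ψ} → Node p φ q (↓[ x ] ψ) → x ∈ boundVars φ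
binder⇒bound here                    = here refl
binder⇒bound (step ∧ˡ m)             = ∈-++⁺ˡ (binder⇒bound m)
binder⇒bound (step (∧ʳ {φ}) m)       = ∈-++⁺ʳ (boundVars φ) (binder⇒bound m)
binder⇒bound (step ∨ˡ m)             = ∈-++⁺ˡ (binder⇒bound m)
binder⇒bound (step (∨ʳ {φ}) m)       = ∈-++⁺ʳ (boundVars φ) (binder⇒bound m)
binder⇒bound (step □₁ m)             = binder⇒bound m
binder⇒bound (step ↓₁ m)             = there (binder⇒bound m)
binder⇒bound (step at₁ m)            = binder⇒bound m

node-< : ∀ {p φ q χ} → Node p φ q χ → q < end p φ
node-< {q = q} {χ} m = ≤-trans (<-end q χ) (node-end m)

unique⇒once : ∀ {p} φ {q q′ x} → Unique (boundVars φ) → Binder p φ q x → Binder p φ q′ x → q ≡ q′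
unique⇒once (φ ∧ ψ) u (_ , step ∧ˡ m) (_ , step ∧ˡ m′) =
  unique⇒once φ (proj₁ (unique-++⁻ (boundVars φ) u)) (_ , m) (_ , m′)
unique⇒once (φ ∧ ψ) u (_ , step ∧ˡ m) (_ , step ∧ʳ m′) =
  ⊥-elim (proj₂ (proj₂ (unique-++⁻ (boundVars φ) u)) (binder⇒bound m , binder⇒bound m′))
unique⇒once (φ ∧ ψ) u (_ , step ∧ʳ m) (_ , step ∧ˡ m′) =
  ⊥-elim (proj₂ (proj₂ (unique-++⁻ (boundVars φ) u)) (binder⇒bound m′ , binder⇒bound m))
unique⇒once (φ ∧ ψ) u (_ , step ∧ʳ m) (_ , step ∧ʳ m′) =
  unique⇒once ψ (proj₁ (proj₂ (unique-++⁻ (boundVars φ) u))) (_ , m) (_ , m′)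
unique⇒once (φ ∨ ψ) u (_ , step ∨ˡ m) (_ , step ∨ˡ m′) =
  unique⇒once φ (proj₁ (unique-++⁻ (boundVars φ) u)) (_ , m) (_ , m′)
unique⇒once (φ ∨ ψ) u (_ , step ∨ˡ m) (_ , step ∨ʳ m′) =
  ⊥-elim (proj₂ (proj₂ (unique-++⁻ (boundVars φ) u)) (binder⇒bound m , binder⇒bound m′))
unique⇒once (φ ∨ ψ) u (_ , step ∨ʳ m) (_ , step ∨ˡ m′) =
  ⊥-elim (proj₂ (proj₂ (unique-++⁻ (boundVars φ) u)) (binder⇒bound m′ , binder⇒bound m))
unique⇒once (φ ∨ ψ) u (_ , step ∨ʳ m) (_ , step ∨ʳ m′) =
  unique⇒once ψ (proj₁ (proj₂ (unique-++⁻ (boundVars φ) u))) (_ , m) (_ , m′)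
unique⇒once (□ φ) u (_ , step □₁ m) (_ , step □₁ m′) = unique⇒once φ u (_ , m) (_ , m′)
unique⇒once (↓[ x ] φ) (x∉ ∷ u) (_ , here) (_ , here) = refl
unique⇒once (↓[ x ] φ) (x∉ ∷ u) (_ , here) (_ , step ↓₁ m′) = contradiction refl (All.lookup x∉ (binder⇒bound m′))
unique⇒once (↓[ x ] φ) (x∉ ∷ u) (_ , step ↓₁ m) (_ , here) = contradiction refl (All.lookup x∉ (binder⇒bound m))
unique⇒once (↓[ x ] φ) (x∉ ∷ u) (_ , step ↓₁ m) (_ , step ↓₁ m′) = unique⇒once φ u (_ , m) (_ , m′)
unique⇒once (at[ x ] φ) u (_ , step at₁ m) (_ , step at₁ m′) = unique⇒once φ u (_ , m) (_ , m′)

once-child : ∀ {p φ p′ φ′} → Child p φ p′ φ′ → Once p φ → Once p′ φ′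
once-child c once b b′ = once (lift-binder c b) (lift-binder c b′)

once-disjoint : ∀ {p φ p₁ φ₁ p₂ φ₂} → Child p φ p₁ φ₁ → Child p φ p₂ φ₂ → end p₁ φ₁ ≤ p₂ → Once p φ →
  Disjoint (boundVars φ₁) (boundVars φ₂)
once-disjoint {p₁ = p₁} {φ₁} {p₂} {φ₂} c₁ c₂ le once (x∈₁ , x∈₂) =
  let (q₁ , b₁) = bound⇒binder p₁ φ₁ x∈₁
      (q₂ , b₂) = bound⇒binder p₂ φ₂ x∈₂
  in <-irrefl (once (lift-binder c₁ b₁) (lift-binder c₂ b₂))
       (≤-trans (node-< (proj₂ b₁)) (≤-trans le (node-≤ (proj₂ b₂))))

once⇒unique : ∀ p φ → Once p φ → Unique (boundVars φ)
once⇒unique p (var x) once = []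
once⇒unique p top     once = []
once⇒unique p bot     once = []
once⇒unique p (φ ∧ ψ) once = Unique.++⁺ (once⇒unique _ φ (once-child ∧ˡ once))
  (once⇒unique _ ψ (once-child ∧ʳ once)) (once-disjoint {φ = φ ∧ ψ} ∧ˡ ∧ʳ ≤-refl once)
once⇒unique p (φ ∨ ψ) once = Unique.++⁺ (once⇒unique _ φ (once-child ∨ˡ once))
  (once⇒unique _ ψ (once-child ∨ʳ once)) (once-disjoint {φ = φ ∨ ψ} ∨ˡ ∨ʳ ≤-refl once)
once⇒unique p (□ φ) once = once⇒unique _ φ (once-child □₁ once)
once⇒unique p (↓[ x ] φ) once =
  All.tabulate (λ y∈ x≡y → absurd y∈ x≡y) ∷ once⇒unique _ φ (once-child ↓₁ once)
  where
  absurd : ∀ {y} → y ∈ boundVars φ → x ≢ y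
  absurd y∈ refl = let (q , b) = bound⇒binder _ φ y∈ in
    <-irrefl (once (φ , here) (lift-binder ↓₁ b))
      (≤-trans (child-< {φ = ↓[ x ] φ} ↓₁) (node-≤ (proj₂ b)))
once⇒unique p (at[ x ] φ) once = once⇒unique _ φ (once-child at₁ once)

-- `u` is the position of the symbol ‵x itself, where `binder` reads the name; behind @ it is one
-- place to the right of the operator. Binding occurrences are left out.
data Use (p : ℕ) (φ : Formula) (x : SVAR) : ℕ → Set where
  atom : ∀ {q} → Node p φ q (var x) → Use p φ x q
  jump : ∀ {q ψ} → Node p φ q (at[ x ] ψ) → Use p φ x (suc q)

lift-use : ∀ {p φ p′ φ′ x u} → Child p φ p′ φ′ → Use p′ φ′ x u → Use p φ x u
lift-use c (atom m) = atom (step c m)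
lift-use c (jump m) = jump (step c m)

use-≤ : ∀ {p φ x u} → Use p φ x u → p ≤ u
use-≤ (atom m) = node-≤ m
use-≤ (jump m) = m≤n⇒m≤1+n (node-≤ m)

use-< : ∀ {p φ x u} → Use p φ x u → u < end p φ
use-< (atom m) = node-< m
use-< {x = x} (jump {q} {ψ} m) = ≤-trans (<-trans (<-nameEnd (suc q) x) (<-end _ ψ)) (node-end m)

InScope : ℕ → Formula → SVAR → ℕ → Set
InScope p φ x u = ∃[ q ] ∃[ ψ ] (Node p φ q (↓[ x ] ψ) × q < u × u < end q (↓[ x ] ψ))

OutOfScope : ℕ → Formula → SVAR → Set
OutOfScope p φ x = ∃[ u ] (Use p φ x u × ¬ InScope p φ x u)

-- A binder of the larger formula that lies outside the child has a span disjoint from it and cannot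
-- capture the use.
lift-out : ∀ {p χ p′ φ x} → Child p χ p′ φ →
  (∀ {q θ} → Node p χ q (↓[ x ] θ) →
     Node p′ φ q (↓[ x ] θ) ⊎ (end q (↓[ x ] θ) ≤ p′ ⊎ end p′ φ ≤ q)) →
  OutOfScope p′ φ x → OutOfScope p χ x
lift-out {p} {χ} {p′} {φ} {x} c split (u , use , out) = u , lift-use c use ,
  λ (q , θ , m , lt , lt′) → scope q θ lt lt′ (split m)
  where
  scope : ∀ q θ → q < u → u < end q (↓[ x ] θ) →
    Node p′ φ q (↓[ x ] θ) ⊎ (end q (↓[ x ] θ) ≤ p′ ⊎ end p′ φ ≤ q) → ⊥
  scope q θ lt lt′ (inj₁ m)         = out (q , θ , m , lt , lt′)
  scope q θ lt lt′ (inj₂ (inj₁ le)) = <-irrefl refl (≤-trans lt′ (≤-trans le (use-≤ use)))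
  scope q θ lt lt′ (inj₂ (inj₂ le)) = <-irrefl refl (≤-trans (use-< use) (≤-trans le (<⇒≤ lt)))

free⇒use : ∀ p φ {x} → x ∈ freeVars φ → OutOfScope p φ x
free⇒use p (var x) (here refl) = p , atom here , λ { (_ , _ , step () _ , _) }
free⇒use p (φ ∧ ψ) x∈ with ∈-++⁻ (freeVars φ) x∈
... | inj₁ x∈φ = lift-out ∧ˡ (λ { (step ∧ˡ m) → inj₁ m ; (step ∧ʳ m) → inj₂ (inj₂ (node-≤ m)) }) (free⇒use _ φ x∈φ)
... | inj₂ x∈ψ = lift-out ∧ʳ (λ { (step ∧ˡ m) → inj₂ (inj₁ (node-end m)) ; (step ∧ʳ m) → inj₁ m }) (free⇒use _ ψ x∈ψ)
free⇒use p (φ ∨ ψ) x∈ with ∈-++⁻ (freeVars φ) x∈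
... | inj₁ x∈φ = lift-out ∨ˡ (λ { (step ∨ˡ m) → inj₁ m ; (step ∨ʳ m) → inj₂ (inj₂ (node-≤ m)) }) (free⇒use _ φ x∈φ)
... | inj₂ x∈ψ = lift-out ∨ʳ (λ { (step ∨ˡ m) → inj₂ (inj₁ (node-end m)) ; (step ∨ʳ m) → inj₁ m }) (free⇒use _ ψ x∈ψ)
free⇒use p (□ φ) x∈ = lift-out □₁ (λ { (step □₁ m) → inj₁ m }) (free⇒use _ φ x∈)
free⇒use p (↓[ y ] φ) x∈ =
  let (x∈φ , y≢x) = ∈-filter⁻ (λ z → ¬? (y ≟ z)) x∈
  in lift-out ↓₁ (λ { here → contradiction refl y≢x ; (step ↓₁ m) → inj₁ m }) (free⇒use _ φ x∈φ)
-- The name stands before the body, so no binder in the body has it in its scope.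
free⇒use p (at[ y ] φ) (here refl) = suc p , jump here ,
  λ { (q , θ , step at₁ m , lt , _) → <-irrefl refl (≤-trans (<-nameEnd (suc p) y) (≤-trans (node-≤ m) (<⇒≤ lt))) }
free⇒use p (at[ y ] φ) (there x∈) = lift-out at₁ (λ { (step at₁ m) → inj₁ m }) (free⇒use _ φ x∈)

use⇒free : ∀ {p φ x u} → Use p φ x u → x ∈ freeVars φ ⊎ InScope p φ x u

use⇒free-step : ∀ {p φ p′ φ′ x u} → Child p φ p′ φ′ → Use p′ φ′ x u → x ∈ freeVars φ′ ⊎ InScope p′ φ′ x u →
  x ∈ freeVars φ ⊎ InScope p φ x u
use⇒free-step c use (inj₂ (q , ψ , m , lt)) = inj₂ (q , ψ , step c m , lt)
use⇒free-step ∧ˡ use (inj₁ x∈) = inj₁ (∈-++⁺ˡ x∈)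
use⇒free-step (∧ʳ {φ}) use (inj₁ x∈) = inj₁ (∈-++⁺ʳ (freeVars φ) x∈)
use⇒free-step ∨ˡ use (inj₁ x∈) = inj₁ (∈-++⁺ˡ x∈)
use⇒free-step (∨ʳ {φ}) use (inj₁ x∈) = inj₁ (∈-++⁺ʳ (freeVars φ) x∈)
use⇒free-step □₁ use (inj₁ x∈) = inj₁ x∈
use⇒free-step at₁ use (inj₁ x∈) = inj₁ (there x∈)
use⇒free-step {p} {x = x} (↓₁ {y} {φ}) use (inj₁ x∈) with y ≟ x
... | yes refl = inj₂ (p , φ , here , ≤-trans (child-< {φ = ↓[ y ] φ} ↓₁) (use-≤ use) , use-< use)
... | no y≢x   = inj₁ (∈-filter⁺ (λ z → ¬? (y ≟ z)) x∈ y≢x)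

use⇒free (atom here)       = inj₁ (here refl)
use⇒free (jump here)       = inj₁ (here refl)
use⇒free (atom (step c m)) = use⇒free-step c (atom m) (use⇒free (atom m))
use⇒free (jump (step c m)) = use⇒free-step c (jump m) (use⇒free (jump m))

-- Correctness of the test for the convention.

module Naming (w : List Symbol) (Φ : Formula)
              (enc : Reading.Enc w 1 Φ) (whole : end 1 Φ ≡ suc (length w)) where

  open Analysis w Φ enc whole

  Inside : ℕ → Set
  Inside j = binder j < j × j < skip (binder j)

  data Clash (j : ℕ) : Set where
    rebound : on bind? (at j) ≡ true → binder (suc j) ≢ j → Clash j
    outside : on bind? (at j) ≡ false → on x? (at j) ≡ true → 0 < binder j → ¬ Inside j → Clash j

  binder-bound : ∀ p → p ≤ suc n → binder p ≤ suc n
  binder-bound p le = ≤-trans (≤-reflexive (symm (⟦binder⟧ v0 {p ∷ []})))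
    (⟦⟧-bounded (binderT v0) w {p ∷ []} (bounded₁ le))

  clash-⊩ : ∀ j r → j ≤ n → ⟦ clashT ⟧ w (j ∷ r ∷ []) ⊩ Clash j
  clash-⊩ j r le = go _ _ refl refl rebound-⊩ outside-⊩
    where
    ρ = j ∷ r ∷ []
    b = ⟦ binderT v0 ⟧ w ρ
    suc-binder : ⟦ binderT (up v0) ⟧ w ρ ≡ binder (suc j)
    suc-binder = trans (⟦binder⟧ (up v0) {ρ}) (cong binder (up≡suc le))
    rebound-⊩ : ⟦ notT (eqT (binderT (up v0)) v0) ⟧ w ρ ⊩ binder (suc j) ≢ j
    rebound-⊩ = ⊩-not (subst (_⊩ binder (suc j) ≡ j)
      (symm (trans (⟦eq⟧ (binderT (up v0)) v0 {ρ}
                      (≤-trans (≤-reflexive suc-binder) (binder-bound (suc j) (s≤s le))) (m≤n⇒m≤1+n le))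
                   (cong (λ i → num (does (i ≟ j))) suc-binder)))
      (num-⊩ (binder (suc j) ≟ j)))
    outside-⊩ : ⟦ andT v0 (notT (insideT v1 v0)) ⟧ w (b ∷ ρ) ⊩ (0 < binder j × ¬ Inside j)
    outside-⊩ = ⊩-and (subst (_⊩ 0 < binder j) (symm (⟦binder⟧ v0 {ρ})) (mk⇔ (λ x → x) (λ x → x)))
      (⊩-not (inside-⊩ v1 v0 {b ∷ ρ} refl (⟦binder⟧ v0 {ρ}) (m≤n⇒m≤1+n le) (binder-bound j (m≤n⇒m≤1+n le))))
    go : ∀ c d {k l} → on bind? (at j) ≡ c → on x? (at j) ≡ d →
      k ⊩ binder (suc j) ≢ j → l ⊩ (0 < binder j × ¬ Inside j) →
      (if c then k else (if d then l else 0)) ⊩ Clash j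
    go true  d     ec ed k l = ⊩-resp (rebound ec)
      (λ { (rebound _ ne) → ne ; (outside e _ _ _) → contradiction (trans (symm ec) e) λ () }) k
    go false true  ec ed k l = ⊩-resp (λ (pos , out) → outside ec ed pos out)
      (λ { (rebound e _) → contradiction (trans (symm ec) e) λ () ; (outside _ _ pos out) → pos , out }) l
    go false false ec ed k l = ⊩-no
      λ { (rebound e _) → contradiction (trans (symm ec) e) λ ()
        ; (outside _ e _ _) → contradiction (trans (symm ed) e) λ () }

  use-name : ∀ {x u} → Use 1 Φ x u → Name u x
  use-name (atom m) = occurs-enc m
  use-name {x} (jump {ψ = ψ} m) = enc-named {φ = at[ x ] ψ} atₙ (occurs-enc m)

  use-inside : ∀ {x u} → Use 1 Φ x u → (∀ {q q′} → Binds q x → Binds q′ x → q ≡ q′) →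
    (x ∈ freeVars Φ → ∀ q → ¬ Binds q x) → 0 < binder u → Inside u
  use-inside {x} {u} use once free pos = go (binder-of (use-name use)) (use⇒free use) pos
    where
    go : ∀ {b} → BinderOf x b → x ∈ freeVars Φ ⊎ InScope 1 Φ x u → 0 < b → b < u × u < skip b
    go (unbound _) _ ()
    go (bound b _) (inj₁ x∈) _ = contradiction b (free x∈ _)
    go (bound b _) (inj₂ (q , ψ , m , lt , lt′)) _ with once b (ψ , m)
    ... | refl = lt , subst (u <_) (symm (occurs-skip m)) lt′

  free-unbound : WellNamed Φ → ∀ {x} → x ∈ freeVars Φ → ∀ q → ¬ Binds q x
  free-unbound (_ , dis) x∈ q (_ , m) = dis (x∈ , binder⇒bound m)

  wellNamed⇒ : WellNamed Φ → ∀ j → ¬ Clash j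
  wellNamed⇒ wn@(u , _) j (rebound bi ne) with binds bi
  ... | x , b = ne (go (binder-of (binds-name b)))
    where
    go : ∀ {i} → BinderOf x i → i ≡ j
    go (unbound ¬b) = contradiction b (¬b j)
    go (bound b′ _) = unique⇒once Φ u b′ b
  wellNamed⇒ wn@(u , _) j (outside nb isx pos out) =
    go (on-sym x? (at j) isx)
    where
    inside : ∀ {x} → Use 1 Φ x j → Inside j
    inside use = use-inside use (unique⇒once Φ u) (free-unbound wn) pos
    go : ∃[ a ] (at j ≡ sym a × x? a ≡ true) → ⊥
    go (a , eq , ax) with located {j} eq
    ... | digit d = x-digit a ax (trans (cong (on digit?) (symm eq)) d)
      where
      x-digit : ∀ a → x? a ≡ true → digit? a ≡ true → ⊥
      x-digit ‵x _ ()
    ... | node {χ} m with head-x χ (trans (cong x? (sym-injective (trans (symm (occurs-head m)) eq))) ax)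
    ...   | x , refl = out (inside (atom m))
    -- The name behind ↓ is no `Use`, but it lies within the span of its own binder.
    go (a , eq , ax) | name {r} {x = x} m (↓ₙ {φ = ψ}) j≡ = out (own (binder-of nm))
      where
      nm : Name j x
      nm = subst (λ i → Name i x) (symm j≡) (enc-named {φ = ↓[ x ] ψ} ↓ₙ (occurs-enc m))
      own : ∀ {b} → BinderOf x b → b < j × j < skip b
      own (unbound ¬b) = contradiction (ψ , m) (¬b r)
      own (bound b _) with unique⇒once Φ u b (ψ , m)
      ... | refl = ≤-reflexive (symm j≡) ,
        subst (j <_) (symm (occurs-skip m))
          (subst (_< end r (↓[ x ] ψ)) (symm j≡) (<-trans (<-nameEnd (suc r) x) (<-end _ ψ)))
    go (a , eq , ax) | name m atₙ j≡ = out (inside (subst (Use 1 Φ _) (symm j≡) (jump m)))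

  -- Every binder is the last binder of its own variable, so two binders of one variable coincide. A
  -- free variable has a use outside all scopes, which is a clash as soon as the variable is also
  -- bound.
  wellNamed⇐ : (∀ j → j ≤ n → ¬ Clash j) → WellNamed Φ
  wellNamed⇐ clean = once⇒unique 1 Φ once , disjoint
    where
    own : ∀ {q x} → Binds q x → binder (suc q) ≡ q
    own {q} b with binder (suc q) ≟ q
    ... | yes eq = eq
    ... | no ne  = contradiction (rebound (binds-at b) ne) (clean q (occurs-≤ (proj₂ b)))
    once : Once 1 Φ
    once {x = x} b b′ = trans (symm (own b))
      (trans (binderOf-unique (binder-of {x = x} (binds-name b)) (binder-of {x = x} (binds-name b′))) (own b′))
    disjoint : Disjoint (freeVars Φ) (boundVars Φ)
    disjoint {x} (x∈ , x∈′) =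
      let (u , use , out) = free⇒use 1 Φ x∈
          (q , b)         = bound⇒binder 1 Φ x∈′
      in go use out (binder-of (use-name use)) refl b
      where
      go : ∀ {u i q} → Use 1 Φ x u → ¬ InScope 1 Φ x u → BinderOf x i → binder u ≡ i → Binds q x → ⊥
      go use out (unbound ¬b) eq b = ¬b _ b
      go {u} {i} use out (bound (ψ , m) _) eq _ = clean u (at-≤ ux)
        (outside (cong (on bind?) ux) (cong (on x?) ux) (subst (0 <_) (symm eq) (node-≤ m))
          λ (lt , lt′) → out (i , ψ , m , subst (_< u) eq lt ,
            subst (u <_) (trans (cong skip eq) (occurs-skip m)) lt′))
        where
        ux : at u ≡ sym ‵x
        ux = proj₁ (use-name use)

  naming-⊩ : ⟦ notT (searchT clashT) ⟧ w [] ⊩ WellNamed Φ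
  naming-⊩ = go (search clashT {[]} clash-⊩)
    where
    go : ∀ {r} → Largest Clash r → (if is⊢ (at r) then 1 else 0) ⊩ WellNamed Φ
    go (absent clean) = ⊩-yes (s≤s z≤n) (wellNamed⇐ clean)
    go (found {j} _ c _) = subst (_⊩ WellNamed Φ) (symm (⊢-pos {v = suc j} (s≤s z≤n)))
      (⊩-no λ wn → wellNamed⇒ wn j c)

-- Correctness of the decision procedure.

-- The second term has a meaning only on inputs that pass the first test, so its specification may
-- depend on the outcome of that test.
⊩-and-then : ∀ (w : List Symbol) {a b} {P Q : Set} → a ⊩ P → (P → b ⊩ Q) → (if is⊢ (symbolAt w a) then 0 else b) ⊩ (P × Q)
⊩-and-then w {zero}  p q = ⊩-no λ (x , _) → contradiction (⇒yes p x) λ ()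
⊩-and-then w {suc a} p q rewrite symbolAt-pos w a =
  let x = yes⇒ p (s≤s z≤n) in ⊩-resp (x ,_) proj₂ (q x)

formula-⊩ : ∀ w φ → w ≡ encode φ →
  ⟦ andT (notT (searchT clashT)) evalT ⟧ w [] ⊩ (WellNamed φ × Satisfiable φ)
formula-⊩ w φ text = ⊩-and-then w naming-⊩ λ wn →
  Evaluation.eval-⊩ w φ enc whole (unique⇒once φ (proj₁ wn)) (free-unbound wn)
  where
  open Syntax w using (enc-encode; whole-encode)
  enc   = enc-encode φ text
  whole = whole-encode φ text
  open Naming w φ enc whole

decide-⊩ : ∀ w → ⟦ decideT ⟧ w [] ⊩ MSAT-ℕ w
decide-⊩ w = ⊩-resp proj₂ (λ (φ , text , s) → (φ , text) , φ , text , s)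
  (⊩-and-then w (Syntax.syntax-⊩ w) λ (φ , text) → mk⇔
    (λ pos → φ , text , yes⇒ (formula-⊩ w φ text) pos)
    -- The value of the term depends on the input alone, so `formula-⊩` applies to whichever formula
    -- witnesses membership.
    (λ (ψ , text′ , s) → ⇒yes (formula-⊩ w ψ text′) s))

Symbol-finite : Finite Symbol
Symbol-finite = 10 , mk↔ₛ′ index symbol symbol-index index-symbol
  where
  index : Symbol → Fin 10
  index ‵x  = zero
  index ‵1  = suc zero
  index ‵2  = suc (suc zero)
  index ‵⊤  = suc (suc (suc zero))
  index ‵⊥  = suc (suc (suc (suc zero)))
  index ‵∧  = suc (suc (suc (suc (suc zero))))
  index ‵∨  = suc (suc (suc (suc (suc (suc zero)))))
  index ‵□  = suc (suc (suc (suc (suc (suc (suc zero))))))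
  index ‵↓  = suc (suc (suc (suc (suc (suc (suc (suc zero)))))))
  index ‵at = suc (suc (suc (suc (suc (suc (suc (suc (suc zero))))))))
  symbols : Vec Symbol 10
  symbols = ‵x ∷ ‵1 ∷ ‵2 ∷ ‵⊤ ∷ ‵⊥ ∷ ‵∧ ∷ ‵∨ ∷ ‵□ ∷ ‵↓ ∷ ‵at ∷ []
  symbol : Fin 10 → Symbol
  symbol = lookup symbols
  symbol-index : ∀ i → index (symbol i) ≡ i
  symbol-index zero = refl
  symbol-index (suc zero) = refl
  symbol-index (suc (suc zero)) = refl
  symbol-index (suc (suc (suc zero))) = refl
  symbol-index (suc (suc (suc (suc zero)))) = refl
  symbol-index (suc (suc (suc (suc (suc zero))))) = refl
  symbol-index (suc (suc (suc (suc (suc (suc zero)))))) = refl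
  symbol-index (suc (suc (suc (suc (suc (suc (suc zero))))))) = refl
  symbol-index (suc (suc (suc (suc (suc (suc (suc (suc zero)))))))) = refl
  symbol-index (suc (suc (suc (suc (suc (suc (suc (suc (suc zero))))))))) = refl
  index-symbol : ∀ a → symbol (index a) ≡ a
  index-symbol ‵x  = refl
  index-symbol ‵1  = refl
  index-symbol ‵2  = refl
  index-symbol ‵⊤  = refl
  index-symbol ‵⊥  = refl
  index-symbol ‵∧  = refl
  index-symbol ‵∨  = refl
  index-symbol ‵□  = refl
  index-symbol ‵↓  = refl
  index-symbol ‵at = refl

nonzero-⊩ : ∀ {v} {Q : Set} → v ⊩ Q → nonzero v ≡ true ⇔ Q
nonzero-⊩ {zero}  r = mk⇔ (λ ()) (λ q → contradiction (⇒yes r q) λ ())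
nonzero-⊩ {suc v} r = mk⇔ (λ _ → yes⇒ r (s≤s z≤n)) (λ _ → refl)

theorem4p7 : LOGSPACE MSAT-ℕ
theorem4p7 = logspace Symbol-finite decideT λ w → nonzero-⊩ (decide-⊩ w)
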